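{- Let $n\ge 10$. Then $$ex(n,P_{5}\cup P_{5})= \max\left\{[n,10,5],\ 3n-5\right\}.$$ Moreover, every $n$-vertex graph with no subgraph isomorphic to $P_5\cup P_5$ and with $ex(n,P_5\cup P_5)$ edges is either $K_9\cup H$, where $H$ is an $(n-9)$-vertex $P_5$-free graph with $ex(n-9,P_5)$ edges, or $K_3+(K_2\cup \overline{K}_{n-5})$.
   Context: All graphs are finite and simple. $P_k$ is the path on $k$ vertices, $K_k$ the complete graph, $\overline{K}_k$ the edgeless graph on $k$ vertices; $\cup$ is vertex-disjoint union and $+$ is the join. $ex(n,H)$ is the maximum number of edges of an $n$-vertex graph with no subgraph isomorphic to $H$. For $n\ge 10$, write $n=9+4t+r$ with $t\ge 0$, $0\le r<4$; then $[n,10,5]={9\choose 2}+6t+{r\choose 2}$. -}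

module Defs where

open import Data.Bool using (Bool; true; false; _∨_; not; if_then_else_)
open import Data.Bool.Properties using (∨-comm)
open import Data.Nat using (ℕ; zero; suc; _+_; _*_; _∸_; _≤_; _<ᵇ_; _≡ᵇ_; _⊔_; _/_; _%_)
open import Data.Nat.Combinatorics using (_C_)
open import Data.Fin using (Fin; toℕ; splitAt)
open import Data.List using (map; allFin)
open import Data.Nat.ListAction using (sum)
open import Data.Sum using (_⊎_; inj₁; inj₂)
open import Data.Product using (Σ; _×_; _,_; ∃)
open import Function.Bundles using (_↔_; Inverse)
open import Function.Definitions using (Injective)
open import Relation.Binary.PropositionalEquality using (_≡_; refl)
open import Relation.Nullary using (¬_)

record Graph (n : ℕ) : Set where
  field
    adj    : Fin n → Fin n → Bool
    adj-sym : ∀ i j → adj i j ≡ adj j i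
    irrefl : ∀ i → adj i i ≡ false
open Graph public

edges : ∀ {n} → Graph n → ℕ
edges {n} G = sum (map (λ i → sum (map (λ j →
  if (toℕ i <ᵇ toℕ j) then (if adj G i j then 1 else 0) else 0) (allFin n))) (allFin n))

_⊆ᵍ_ : ∀ {m n} → Graph m → Graph n → Set
_⊆ᵍ_ {m} {n} H G = Σ (Fin m → Fin n) λ f → Injective _≡_ _≡_ f ×
  (∀ a b → adj H a b ≡ true → adj G (f a) (f b) ≡ true)

Free : ∀ {m n} → Graph m → Graph n → Set
Free H G = ¬ (H ⊆ᵍ G)

IsEx : ∀ {m} → ℕ → Graph m → ℕ → Set
IsEx n H e = (Σ (Graph n) λ G → Free H G × edges G ≡ e)
           × (∀ (G : Graph n) → Free H G → edges G ≤ e)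

-- graph isomorphism (between graphs with possibly differently-written vertex counts)
_≅_ : ∀ {m n} → Graph m → Graph n → Set
_≅_ {m} {n} G H = Σ (Fin m ↔ Fin n) λ φ →
  ∀ i j → adj G i j ≡ adj H (Inverse.to φ i) (Inverse.to φ j)

private
  sucneq : ∀ m → (suc m ≡ᵇ m) ≡ false
  sucneq zero = refl
  sucneq (suc m) = sucneq m

  eqᵇ-refl : ∀ m → (m ≡ᵇ m) ≡ true
  eqᵇ-refl zero = refl
  eqᵇ-refl (suc m) = eqᵇ-refl m

  eqᵇ-sym : ∀ a b → (a ≡ᵇ b) ≡ (b ≡ᵇ a)
  eqᵇ-sym zero zero = refl
  eqᵇ-sym zero (suc b) = refl
  eqᵇ-sym (suc a) zero = refl
  eqᵇ-sym (suc a) (suc b) = eqᵇ-sym a b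

P : (k : ℕ) → Graph k
P k = record
  { adj = λ i j → (suc (toℕ i) ≡ᵇ toℕ j) ∨ (suc (toℕ j) ≡ᵇ toℕ i)
  ; adj-sym = λ i j → ∨-comm (suc (toℕ i) ≡ᵇ toℕ j) (suc (toℕ j) ≡ᵇ toℕ i)
  ; irrefl = λ i → pf (toℕ i) }
  where
  pf : ∀ m → ((suc m ≡ᵇ m) ∨ (suc m ≡ᵇ m)) ≡ false
  pf m rewrite sucneq m = refl

K : (k : ℕ) → Graph k
K k = record
  { adj = λ i j → not (toℕ i ≡ᵇ toℕ j)
  ; adj-sym = λ i j → pf (toℕ i) (toℕ j)
  ; irrefl = λ i → pf2 (toℕ i) }
  where
  pf : ∀ a b → not (a ≡ᵇ b) ≡ not (b ≡ᵇ a)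
  pf a b rewrite eqᵇ-sym a b = refl
  pf2 : ∀ a → not (a ≡ᵇ a) ≡ false
  pf2 a rewrite eqᵇ-refl a = refl

E : (k : ℕ) → Graph k
E k = record { adj = λ _ _ → false ; adj-sym = λ _ _ → refl ; irrefl = λ _ → refl }

private
  combAdj : ∀ {m n} → Bool → Graph m → Graph n → Fin (m + n) → Fin (m + n) → Bool
  combAdj {m} b G H i j with splitAt m i | splitAt m j
  ... | inj₁ x | inj₁ y = adj G x y
  ... | inj₂ x | inj₂ y = adj H x y
  ... | inj₁ _ | inj₂ _ = b
  ... | inj₂ _ | inj₁ _ = b

  combSym : ∀ {m n} b (G : Graph m) (H : Graph n) i j → combAdj b G H i j ≡ combAdj b G H j i
  combSym {m} b G H i j with splitAt m i | splitAt m j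
  ... | inj₁ x | inj₁ y = Graph.adj-sym G x y
  ... | inj₂ x | inj₂ y = Graph.adj-sym H x y
  ... | inj₁ _ | inj₂ _ = refl
  ... | inj₂ _ | inj₁ _ = refl

  combIrr : ∀ {m n} b (G : Graph m) (H : Graph n) i → combAdj b G H i i ≡ false
  combIrr {m} b G H i with splitAt m i
  ... | inj₁ x = irrefl G x
  ... | inj₂ x = irrefl H x

comb : ∀ {m n} → Bool → Graph m → Graph n → Graph (m + n)
comb b G H = record { adj = combAdj b G H ; adj-sym = combSym b G H ; irrefl = combIrr b G H }

_∪ᵍ_ : ∀ {m n} → Graph m → Graph n → Graph (m + n)
G ∪ᵍ H = comb false G H

_+ᵍ_ : ∀ {m n} → Graph m → Graph n → Graph (m + n)
G +ᵍ H = comb true G H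

-- [n,10,5] = C(9,2) + 6t + C(r,2) where n = 9 + 4t + r, 0 ≤ r < 4
bracket : ℕ → ℕ
bracket n = 9 C 2 + 6 * ((n ∸ 9) / 4) + ((n ∸ 9) % 4) C 2

{-# OPTIONS --safe #-}

-- Deleting vertices of degree at most 3 costs at most 3 edges each and stops at a 4-core Q; if Q
-- is empty then e ≤ 3n − 6. The key fact is that deleting a P₅ leaves a P₅-free graph, which on
-- m vertices has at most g m = 6⌊m/4⌋ + C(m mod 4, 2) edges. A longest path of Q either has nine
-- vertices or closes up to a Hamiltonian cycle of Q.
--  * Nine vertices: they form a component (hence at most 36 + g (n − 9) edges, with equality only
--    for K₉), or two K₅'s sharing a vertex through which everything else is attached, which
--    leaves fewer than 3n − 5 edges.
--  * |Q| = 7 or 8: a large matching between Q and the other vertices gives 2P₅ (or, for |Q| = 7,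
--    a core dominated by three hubs), and a small one gives fewer than 36 + g (n − 9) edges.
--  * |Q| = 6: Q and the last four deleted vertices span at most 24 edges, so e ≤ 3n − 6.
--  * |Q| = 5: Q and the last five deleted vertices span at most 24 edges, or exactly
--    K₃ + (K₂ ∪ K̄₅), to which each further vertex must be joined through the three hubs.
-- The configurations on ten vertices are settled by case trees over the possible edges, whose
-- leaves exhibit two disjoint P₅ or a vertex violating a degree condition.
module Submission where

open import Defs
open import Data.Bool as Bool using (Bool; true; false; if_then_else_; _∧_; not; _∨_)
open import Data.Nat using (ℕ; zero; suc; _+_; _*_; _∸_; _≤_; _<_; _<ᵇ_; z≤n; s≤s; z<s; _≤?_; _≡ᵇ_; _/_; _%_; _≤ᵇ_; _⊔_; _⊓_)
open import Data.Nat.Properties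
open import Data.Nat.ListAction using (sum)
open import Data.Nat.Tactic.RingSolver using (solve-∀)
open import Data.Fin as Fin using (Fin; toℕ; splitAt; cast; _↑ˡ_; _↑ʳ_; #_)
import Data.Fin.Properties as Finₚ
open import Data.List using (List; []; _∷_; _++_; [_]; length; map; allFin; tabulate; lookup; take; drop; upTo; concatMap; applyUpTo)
open import Data.List.Properties using (length-++; ++-assoc; map-++; length-map; ++-identityʳ; map-upTo; take++drop≡id; length-take; length-upTo; length-tabulate; map-tabulate; tabulate-lookup; tabulate-cong)
open import Data.List.Relation.Unary.All as All using (All; []; _∷_)
import Data.List.Relation.Unary.All.Properties as Allₚ
open import Data.List.Relation.Unary.Any as Any using (Any; here; there; index)
open import Data.List.Relation.Unary.AllPairs as AllPairs using (AllPairs; []; _∷_)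
import Data.List.Relation.Unary.AllPairs.Properties as AllPairsₚ
open import Data.List.Relation.Unary.Unique.Propositional using (Unique)
import Data.List.Relation.Unary.Unique.Propositional.Properties as Uniqueₚ
open import Data.List.Membership.Propositional using (_∈_; _∉_; find; lose)
open import Data.List.Membership.Propositional.Properties using (∈-∃++; ∈-++⁺ˡ; ∈-++⁺ʳ; ∈-++⁻; ∈-allFin; ∈-lookup; ∈-map⁻; ∈-map⁺; ∈-upTo⁺)
open import Data.List.Relation.Binary.Permutation.Propositional using (_↭_; refl; prep; swap; trans; ↭-sym; ↭-refl; ↭-trans; ↭⇒↭ₛ; ↭-reflexive)
open import Data.List.Relation.Binary.Permutation.Propositional.Properties using (∈-resp-↭; All-resp-↭; ↭-length; shift; ++⁺ˡ; ++⁺ʳ; ++-comm; ++⁺; drop-∷; ↭-reverse; map⁺)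
import Data.List.Relation.Binary.Permutation.Setoid.Properties as Permₛ
open import Data.Product using (Σ; _×_; _,_; ∃; proj₁; proj₂)
open import Data.Sum using (_⊎_; inj₁; inj₂; [_,_]′)
open import Data.Empty using (⊥; ⊥-elim)
open import Relation.Nullary using (¬_; Dec; yes; no)
open import Relation.Binary.PropositionalEquality as ≡ using (_≡_; _≢_; refl; sym; cong; cong₂; subst)
open import Data.List.Relation.Unary.Linked using (Linked; []; [-]; _∷_)
open import Data.Nat.DivMod using (m/n≡1+[m∸n]/n; [m+n]%n≡m%n; m%n<n)
import Data.Nat.Combinatorics as Comb
open import Relation.Nullary.Decidable using (_×-dec_; ¬?)
import Data.Bool.Properties as Boolₚ
open import Data.Nat.ListAction.Properties using (sum-↭; sum-++)
import Data.List.Relation.Unary.Any.Properties as Anyₚ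
open import Function.Base using (_∘_)
open import Function.Bundles using (mk↔ₛ′)

-- Two maxima compete. With m = n - 9, the graph built on K₉ has 36 + g m edges and the hub graph 22
-- + 3m = 3n - 5; which is larger depends on m, so every case has to end strictly below one of the
-- two, for all m, or in one of the two extremal graphs. Peeling stops at degree 3 because 3 is the
-- slope of the second value. Nine is the critical path length: a path on ten vertices already
-- splits into two P₅, whereas two path ends of degree at least four have degree sum 8, which forces
-- a cycle only up to eight vertices. The finite configurations are settled by certificates: a
-- decision tree over adjacency atoms is plain data, a Boolean `check` evaluates it, one soundness
-- lemma transfers the result to arbitrary vertices, and each use is a proof by `refl`. Vertex sets
-- are lists without repetition, so that edge counts split additively along permutations.

lin : ∀ c {X Y A B} → A ≤ B → X + c ≡ A → B ≡ Y + c → X ≤ Y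
lin c {X} {Y} A≤B p q = +-cancelʳ-≤ c X Y (≤-trans (≤-reflexive p) (≤-trans A≤B (≤-reflexive q)))

-- Lists without repetition

module _ {A : Set} where

  Unique-↭ : {xs ys : List A} → xs ↭ ys → Unique xs → Unique ys
  Unique-↭ p = Permₛ.Unique-resp-↭ (≡.setoid A) (↭⇒↭ₛ p)

  Unique-++ˡ : (xs : List A) {ys : List A} → Unique (xs ++ ys) → Unique xs
  Unique-++ˡ [] u = []
  Unique-++ˡ (x ∷ xs) (a ∷ u) = Allₚ.++⁻ˡ xs a ∷ Unique-++ˡ xs u

  Unique-++ʳ : (xs : List A) {ys : List A} → Unique (xs ++ ys) → Unique ys
  Unique-++ʳ [] u = u
  Unique-++ʳ (x ∷ xs) (a ∷ u) = Unique-++ʳ xs u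

  extract : {x : A} {xs : List A} → x ∈ xs → ∃ λ ys → xs ↭ x ∷ ys
  extract {x} x∈xs with ys , zs , refl ← ∈-∃++ x∈xs = ys ++ zs , shift x ys zs

  Unique-head : {x : A} {xs : List A} → Unique (x ∷ xs) → x ∉ xs
  Unique-head (a ∷ _) x∈xs = All.lookup a x∈xs refl

  split-off : {xs ys : List A} → Unique xs → All (_∈ ys) xs → ∃ λ zs → ys ↭ xs ++ zs
  split-off {[]} {ys} u a = ys , ↭-refl
  split-off {x ∷ xs} {ys} (d ∷ u) (x∈ys ∷ a) with zs , p ← extract x∈ys =
    let ws , q = split-off u (All.tabulate λ {y} y∈xs → keep y∈xs (∈-resp-↭ p (All.lookup a y∈xs)))
    in ws , ↭-trans p (prep x q)
    where
    keep : ∀ {y} → y ∈ xs → y ∈ x ∷ zs → y ∈ zs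
    keep y∈xs (here refl) = ⊥-elim (All.lookup d y∈xs refl)
    keep y∈xs (there y∈zs) = y∈zs

-- Degrees and edge counts over vertex lists

bit : Bool → ℕ
bit true = 1
bit false = 0

bit≤1 : ∀ b → bit b ≤ 1
bit≤1 true = ≤-refl
bit≤1 false = z≤n

module Count {n} (G : Graph n) where

  V : Set
  V = Fin n

  infix 4 _~_
  _~_ : V → V → Set
  u ~ v = adj G u v ≡ true

  ~-sym : ∀ {u v} → u ~ v → v ~ u
  ~-sym {u} {v} p = ≡.trans (adj-sym G v u) p

  ~-irrefl : ∀ {v} → ¬ v ~ v
  ~-irrefl {v} p with () ← ≡.trans (sym p) (irrefl G v)

  deg : V → List V → ℕ
  deg v [] = 0
  deg v (u ∷ L) = bit (adj G v u) + deg v L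

  cross : List V → List V → ℕ
  cross [] B = 0
  cross (a ∷ A) B = deg a B + cross A B

  -- Each pair is met once, at its earlier member, so on a list without repetition this is the
  -- number of induced edges. The order is immaterial (`size-↭`), and `size-++` splits the count
  -- along a partition.
  size : List V → ℕ
  size [] = 0
  size (v ∷ L) = deg v L + size L

  deg-++ : ∀ v A B → deg v (A ++ B) ≡ deg v A + deg v B
  deg-++ v [] B = refl
  deg-++ v (a ∷ A) B rewrite deg-++ v A B = sym (+-assoc (bit (adj G v a)) (deg v A) (deg v B))

  cross-++ʳ : ∀ C A B → cross C (A ++ B) ≡ cross C A + cross C B
  cross-++ʳ [] A B = refl
  cross-++ʳ (c ∷ C) A B rewrite deg-++ c A B | cross-++ʳ C A B = lemma (deg c A) (deg c B) (cross C A) (cross C B)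
    where
    lemma : ∀ a b c d → a + b + (c + d) ≡ a + c + (b + d)
    lemma = solve-∀

  cross-++ˡ : ∀ A B C → cross (A ++ B) C ≡ cross A C + cross B C
  cross-++ˡ [] B C = refl
  cross-++ˡ (a ∷ A) B C rewrite cross-++ˡ A B C = sym (+-assoc (deg a C) (cross A C) (cross B C))

  size-++ : ∀ A B → size (A ++ B) ≡ size A + cross A B + size B
  size-++ [] B = refl
  size-++ (a ∷ A) B rewrite deg-++ a A B | size-++ A B = lemma (deg a A) (deg a B) (size A) (cross A B) (size B)
    where
    lemma : ∀ x y z w t → x + y + (z + w + t) ≡ x + z + (y + w) + t
    lemma = solve-∀

  deg-↭ : ∀ v {A B} → A ↭ B → deg v A ≡ deg v B
  deg-↭ v refl = refl
  deg-↭ v (prep x p) = cong (bit (adj G v x) +_) (deg-↭ v p)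
  deg-↭ v (swap {ys = B} x y p) rewrite deg-↭ v p = lemma (bit (adj G v x)) (bit (adj G v y)) (deg v B)
    where
    lemma : ∀ a b c → a + (b + c) ≡ b + (a + c)
    lemma = solve-∀
  deg-↭ v (trans p q) = ≡.trans (deg-↭ v p) (deg-↭ v q)

  cross-↭ʳ : ∀ C {A B} → A ↭ B → cross C A ≡ cross C B
  cross-↭ʳ [] p = refl
  cross-↭ʳ (c ∷ C) p = cong₂ _+_ (deg-↭ c p) (cross-↭ʳ C p)

  cross-↭ˡ : ∀ C {A B} → A ↭ B → cross A C ≡ cross B C
  cross-↭ˡ C refl = refl
  cross-↭ˡ C (prep x p) = cong (deg x C +_) (cross-↭ˡ C p)
  cross-↭ˡ C (swap {ys = B} x y p) rewrite cross-↭ˡ C p = lemma (deg x C) (deg y C) (cross B C)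
    where
    lemma : ∀ a b c → a + (b + c) ≡ b + (a + c)
    lemma = solve-∀
  cross-↭ˡ C (trans p q) = ≡.trans (cross-↭ˡ C p) (cross-↭ˡ C q)

  size-↭ : ∀ {A B} → A ↭ B → size A ≡ size B
  size-↭ refl = refl
  size-↭ (prep x p) = cong₂ _+_ (deg-↭ x p) (size-↭ p)
  size-↭ (swap {ys = B} x y p) rewrite deg-↭ x p | deg-↭ y p | size-↭ p | adj-sym G x y =
    lemma (bit (adj G y x)) (deg x B) (deg y B) (size B)
    where
    lemma : ∀ a b c d → a + b + (c + d) ≡ a + c + (b + d)
    lemma = solve-∀
  size-↭ (trans p q) = ≡.trans (size-↭ p) (size-↭ q)

  cross-[] : ∀ A → cross A [] ≡ 0
  cross-[] [] = refl
  cross-[] (a ∷ A) = cross-[] A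

  cross-∷ʳ : ∀ A b B → cross A (b ∷ B) ≡ deg b A + cross A B
  cross-∷ʳ [] b B = refl
  cross-∷ʳ (a ∷ A) b B rewrite cross-∷ʳ A b B | adj-sym G a b =
    lemma (bit (adj G b a)) (deg a B) (deg b A) (cross A B)
    where
    lemma : ∀ a b c d → a + b + (c + d) ≡ a + c + (b + d)
    lemma = solve-∀

  cross-sym : ∀ A B → cross A B ≡ cross B A
  cross-sym A [] = cross-[] A
  cross-sym A (b ∷ B) = ≡.trans (cross-∷ʳ A b B) (cong (deg b A +_) (cross-sym A B))

  deg≤length : ∀ v L → deg v L ≤ length L
  deg≤length v [] = z≤n
  deg≤length v (u ∷ L) = +-mono-≤ (bit≤1 (adj G v u)) (deg≤length v L)

  cross≤ : ∀ k A B → All (λ a → deg a B ≤ k) A → cross A B ≤ length A * k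
  cross≤ k [] B [] = z≤n
  cross≤ k (a ∷ A) B (p ∷ ps) = +-mono-≤ p (cross≤ k A B ps)

  triangle : ℕ → ℕ
  triangle zero = 0
  triangle (suc k) = k + triangle k

  size≤triangle : ∀ L → size L ≤ triangle (length L)
  size≤triangle [] = z≤n
  size≤triangle (v ∷ L) = +-mono-≤ (deg≤length v L) (size≤triangle L)

  deg>0⇒ : ∀ v L → 0 < deg v L → ∃ λ u → u ∈ L × v ~ u
  deg>0⇒ v (u ∷ L) p with adj G v u in eq
  ... | true = u , here refl , eq
  ... | false with w , w∈L , q ← deg>0⇒ v L p = w , there w∈L , q

  ~⇒deg>0 : ∀ {v u L} → u ∈ L → v ~ u → 0 < deg v L
  ~⇒deg>0 (here refl) p rewrite p = s≤s z≤n
  ~⇒deg>0 {v} {L = w ∷ L} (there u∈L) p = ≤-trans (~⇒deg>0 u∈L p) (m≤n+m _ (bit (adj G v w)))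

  deg≡0⇒ : ∀ {v u L} → deg v L ≡ 0 → u ∈ L → ¬ v ~ u
  deg≡0⇒ eq u∈L p with () ← ≤-trans (~⇒deg>0 u∈L p) (≤-reflexive eq)

  cross>0⇒ : ∀ A B → 0 < cross A B → ∃ λ a → ∃ λ b → a ∈ A × b ∈ B × a ~ b
  cross>0⇒ (a ∷ A) B p with deg a B in eq
  ... | suc _ with b , b∈B , q ← deg>0⇒ a B (≤-trans z<s (≤-reflexive (sym eq))) = a , b , here refl , b∈B , q
  ... | zero with a′ , b , a∈A , r ← cross>0⇒ A B p = a′ , b , there a∈A , r

  cross≡0⇒deg : ∀ {a A} B → cross A B ≡ 0 → a ∈ A → deg a B ≡ 0
  cross≡0⇒deg B eq (here refl) = m+n≡0⇒m≡0 _ eq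
  cross≡0⇒deg {A = a′ ∷ A} B eq (there a∈A) = cross≡0⇒deg B (m+n≡0⇒n≡0 (deg a′ B) eq) a∈A

  -- Each excluded vertex accounts for at most one neighbour in a list without repetition, so more
  -- neighbours than exclusions leave one over. The greedy choices of distinct neighbours rest on
  -- this.
  fresh : ∀ v X {L} → Unique L → length X < deg v L → ∃ λ u → u ∈ L × u ∉ X × v ~ u
  fresh v [] {L} u lt with w , w∈L , p ← deg>0⇒ v L lt = w , w∈L , (λ ()) , p
  fresh v (x ∷ X) {L} u lt with Any.any? (x Finₚ.≟_) L
  ... | no x∉L with w , w∈L , w∉X , p ← fresh v X u (≤-trans (n≤1+n _) lt) =
    w , w∈L , (λ { (here refl) → x∉L w∈L ; (there w∈X) → w∉X w∈X }) , p
  ... | yes x∈L with L′ , q ← extract x∈L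
    with x∷u ← Unique-↭ q u
    with w , w∈L′ , w∉X , p ← fresh v X (AllPairs.tail x∷u) (≤-pred (≤-trans lt (≤-trans (≤-reflexive (deg-↭ v q)) (+-monoˡ-≤ _ (bit≤1 (adj G v x)))))) =
    w , ∈-resp-↭ (↭-sym q) (there w∈L′) , (λ { (here refl) → Unique-head x∷u w∈L′ ; (there w∈X) → w∉X w∈X }) , p

  -- `allFin` is increasing, so the test on `toℕ` in `edges` keeps just the pairs whose second
  -- member comes later in the list. A smaller vertex put in front adds its row, which is its
  -- degree, and a column of zeros.
  edges≡size : edges G ≡ size (allFin n)
  edges≡size = go (AllPairsₚ.tabulate⁺-< (λ i<j → i<j))
    where
    w : V → V → ℕ
    w i j = if (toℕ i <ᵇ toℕ j) then (if adj G i j then 1 else 0) else 0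

    w-< : ∀ {i j} → toℕ i < toℕ j → w i j ≡ bit (adj G i j)
    w-< {i} {j} lt with toℕ i <ᵇ toℕ j | <⇒<ᵇ lt | adj G i j
    ... | true | _ | true = refl
    ... | true | _ | false = refl

    w-≥ : ∀ {i j} → toℕ j ≤ toℕ i → w i j ≡ 0
    w-≥ {i} {j} le with toℕ i <ᵇ toℕ j in eq
    ... | false = refl
    ... | true = ⊥-elim (<⇒≱ (<ᵇ⇒< (toℕ i) (toℕ j) (subst Bool.T (sym eq) _)) le)

    row : ∀ {v L} → All (λ u → toℕ v < toℕ u) L → sum (map (w v) L) ≡ deg v L
    row [] = refl
    row (p ∷ ps) = cong₂ _+_ (w-< p) (row ps)

    rows : ∀ {v L} M → All (λ u → toℕ v < toℕ u) M →
           sum (map (λ i → sum (map (w i) (v ∷ L))) M) ≡ sum (map (λ i → sum (map (w i) L)) M)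
    rows [] [] = refl
    rows {v} {L} (m ∷ M) (p ∷ ps) rewrite w-≥ {m} {v} (<⇒≤ p) = cong (sum (map (w m) L) +_) (rows {v} {L} M ps)

    go : ∀ {L} → AllPairs (λ u v → toℕ u < toℕ v) L → sum (map (λ i → sum (map (w i) L)) L) ≡ size L
    go [] = refl
    go {v ∷ L} (p ∷ ps) rewrite w-≥ {v} {v} ≤-refl | row p = cong (deg v L +_) (≡.trans (rows {v} {L} L p) (go ps))

-- Case trees over Boolean atoms

Atom : Set
Atom = ℕ × ℕ

-- In `split i j` the left subtree is the branch where the atom `(i , j)` holds, the right one the
-- branch where it fails.
data Tree (C : Set) : Set where
  leaf  : C → Tree C
  split : ℕ → ℕ → Tree C → Tree C → Tree C

∧-split : ∀ {a b} → a ∧ b ≡ true → a ≡ true × b ≡ true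
∧-split {true} {true} _ = refl , refl

≡ᵇ-true : ∀ m n → (m ≡ᵇ n) ≡ true → m ≡ n
≡ᵇ-true m n p = ≡ᵇ⇒≡ m n (subst Bool.T (sym p) _)

<ᵇ-true : ∀ m n → (m <ᵇ n) ≡ true → m < n
<ᵇ-true m n p = <ᵇ⇒< m n (subst Bool.T (sym p) _)

≢ᵇ-true : ∀ m n → not (m ≡ᵇ n) ≡ true → m ≢ n
≢ᵇ-true m n p m≡n with m ≡ᵇ n | ≡⇒≡ᵇ m n m≡n
≢ᵇ-true m n () m≡n | true | _

member : Atom → List Atom → Bool
member a [] = false
member (i , j) ((k , l) ∷ as) = if (i ≡ᵇ k) ∧ (j ≡ᵇ l) then true else member (i , j) as

member-All : ∀ {P : Atom → Set} a as → member a as ≡ true → All P as → P a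
member-All {P} (i , j) ((k , l) ∷ as) m (p ∷ ps) with (i ≡ᵇ k) ∧ (j ≡ᵇ l) in eq
... | false = member-All (i , j) as m ps
... | true with e , e′ ← ∧-split {i ≡ᵇ k} eq rewrite ≡ᵇ-true i k e | ≡ᵇ-true j l e′ = p

members : List Atom → List Atom → Bool
members [] T = true
members (a ∷ as) T = member a T ∧ members as T

members-All : ∀ {P : Atom → Set} as T → members as T ≡ true → All P T → All P as
members-All [] T m ps = []
members-All (a ∷ as) T m ps with m₁ , m₂ ← ∧-split {member a T} m = member-All a T m₁ ps ∷ members-All as T m₂ ps

count : (Atom → Bool) → List Atom → ℕ
count f [] = 0
count f (a ∷ as) = bit (f a) + count f as

count-≤ : ∀ {f g} as → (∀ a → f a ≡ true → g a ≡ true) → count f as ≤ count g as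
count-≤ [] h = z≤n
count-≤ {f} {g} (a ∷ as) h = +-mono-≤ (bit-≤ (h a)) (count-≤ as h)
  where
  bit-≤ : ∀ {x y} → (x ≡ true → y ≡ true) → bit x ≤ bit y
  bit-≤ {false} k = z≤n
  bit-≤ {true} k rewrite k refl = ≤-refl

-- A leaf claims that all atoms in req hold and fewer than bnd of those in lim do.
module Cases {C : Set} (ok : C → Bool) (req lim : C → List Atom) (bnd : C → ℕ) where

  -- `T` and `F` collect the answers along the branch. In `lim` every atom not known to be false
  -- counts as true, so the comparison with `bnd` is valid however the undecided atoms turn out.
  check : List Atom → List Atom → Tree C → Bool
  check T F (leaf c) = ok c ∧ (members (req c) T ∧ (count (λ a → not (member a F)) (lim c) <ᵇ bnd c))
  check T F (split i j l r) = check ((i , j) ∷ T) F l ∧ check T ((i , j) ∷ F) r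

  Outcome : (Atom → Bool) → Set
  Outcome val = ∃ λ c → ok c ≡ true × All (λ a → val a ≡ true) (req c) × count val (lim c) < bnd c

  sound′ : ∀ val T F t → All (λ a → val a ≡ true) T → All (λ a → val a ≡ false) F →
           check T F t ≡ true → Outcome val
  sound′ val T F (leaf c) ts fs p
    with p₁ , p₂ ← ∧-split {ok c} p
    with p₃ , p₄ ← ∧-split {members (req c) T} p₂ =
    c , p₁ , members-All (req c) T p₃ ts ,
    ≤-<-trans (count-≤ (lim c) unknown) (<ᵇ-true _ _ p₄)
    where
    unknown : ∀ a → val a ≡ true → not (member a F) ≡ true
    unknown a v with member a F in eq
    ... | false = refl
    ... | true with () ← ≡.trans (sym v) (member-All a F eq fs)
  sound′ val T F (split i j l r) ts fs p
    with p₁ , p₂ ← ∧-split {check ((i , j) ∷ T) F l} p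
    with val (i , j) in eq
  ... | true = sound′ val _ F l (eq ∷ ts) fs p₁
  ... | false = sound′ val T _ r ts (eq ∷ fs) p₂

  sound : ∀ val T t → check T [] t ≡ true → All (λ a → val a ≡ true) T → Outcome val
  sound val T t p ts = sound′ val T [] t ts [] p

-- The smaller index comes first, so `member` finds an edge whichever way it is traversed.
edge : ℕ → ℕ → Atom
edge i j = if i <ᵇ j then (i , j) else (j , i)

chain : List ℕ → List Atom
chain [] = []
chain (i ∷ []) = []
chain (i ∷ j ∷ is) = edge i j ∷ chain (j ∷ is)

star : ℕ → List ℕ → List Atom
star i [] = []
star i (j ∷ js) = if i ≡ᵇ j then star i js else edge i j ∷ star i js

-- Index lists are written as numerals, least significant digit first.
digits : ℕ → ℕ → List ℕ
digits zero c = []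
digits (suc k) c = c % 10 ∷ digits k (c / 10)

notIn : ℕ → List ℕ → Bool
notIn i [] = true
notIn i (j ∷ js) = not (i ≡ᵇ j) ∧ notIn i js

distinctBelow : ℕ → List ℕ → Bool
distinctBelow m [] = true
distinctBelow m (i ∷ is) = (i <ᵇ m) ∧ (notIn i is ∧ distinctBelow m is)

-- Paths as vertex lists, and list positions as labels for atoms

module Paths {n} (G : Graph n) where

  open Count G public

  Path : List V → Set
  Path = Linked _~_

  NoP5 : List V → Set
  NoP5 L = ∀ p → length p ≡ 5 → Unique p → All (_∈ L) p → Path p → ⊥

  No2P5 : Set
  No2P5 = ∀ p q → length p ≡ 5 → length q ≡ 5 → Unique (p ++ q) → Path p → Path q → ⊥

  Unique-sub : ∀ (p : List V) {q L} → Unique (p ++ L) → Unique q → All (_∈ L) q → Unique (p ++ q)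
  Unique-sub [] u v a = v
  Unique-sub (x ∷ p) (d ∷ u) v a =
    Allₚ.++⁺ (Allₚ.++⁻ˡ p d) (All.map (All.lookup (Allₚ.++⁻ʳ p d)) a) ∷ Unique-sub p u v a

  No2P5⇒NoP5 : No2P5 → ∀ {p L} → length p ≡ 5 → Path p → Unique (p ++ L) → NoP5 L
  No2P5⇒NoP5 free {p} lp pp u q lq uq q⊆L pq = free p q lp lq (Unique-sub p u uq q⊆L) pp pq

  lookup-linked : ∀ {p} → Path p → ∀ i j → suc (toℕ i) ≡ toℕ j → lookup p i ~ lookup p j
  lookup-linked (e ∷ pp) Fin.zero (Fin.suc Fin.zero) eq = e
  lookup-linked (e ∷ pp) (Fin.suc i) (Fin.suc j) eq = lookup-linked pp i j (suc-injective eq)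

  lookup-P : ∀ {p} → Path p → ∀ i j → adj (P (length p)) i j ≡ true → lookup p i ~ lookup p j
  lookup-P pp i j a with suc (toℕ i) ≡ᵇ toℕ j in eq
  ... | true = lookup-linked pp i j (≡ᵇ-true _ _ eq)
  ... | false = ~-sym (lookup-linked pp j i (≡ᵇ-true _ _ a))

  lookup-injective : ∀ {p : List V} → Unique p → ∀ i j → lookup p i ≡ lookup p j → i ≡ j
  lookup-injective (d ∷ u) Fin.zero Fin.zero eq = refl
  lookup-injective (d ∷ u) Fin.zero (Fin.suc j) eq = ⊥-elim (All.lookup d (∈-lookup j) eq)
  lookup-injective (d ∷ u) (Fin.suc i) Fin.zero eq = ⊥-elim (All.lookup d (∈-lookup i) (sym eq))
  lookup-injective (d ∷ u) (Fin.suc i) (Fin.suc j) eq = cong Fin.suc (lookup-injective u i j eq)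

  disjoint-++ : ∀ p {q : List V} → Unique (p ++ q) → ∀ {x y} → x ∈ p → y ∈ q → x ≢ y
  disjoint-++ (a ∷ p) (d ∷ u) (here refl) y∈q = All.lookup (Allₚ.++⁻ʳ p d) y∈q
  disjoint-++ (a ∷ p) (d ∷ u) (there x∈p) y∈q = disjoint-++ p u x∈p y∈q

  Free⇒No2P5 : Free (P 5 ∪ᵍ P 5) G → No2P5
  Free⇒No2P5 free p@(_ ∷ _ ∷ _ ∷ _ ∷ _ ∷ []) q@(_ ∷ _ ∷ _ ∷ _ ∷ _ ∷ []) refl refl u pp pq = free (f , inj , hom)
    where
    f : Fin 10 → V
    f i = [ lookup p , lookup q ]′ (splitAt 5 i)

    inj : ∀ {i j} → f i ≡ f j → i ≡ j
    inj {i} {j} eq with splitAt 5 i in ei | splitAt 5 j in ej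
    ... | inj₁ x | inj₁ y with refl ← lookup-injective (Unique-++ˡ p u) x y eq =
      ≡.trans (sym (Finₚ.splitAt⁻¹-↑ˡ ei)) (Finₚ.splitAt⁻¹-↑ˡ ej)
    ... | inj₂ x | inj₂ y with refl ← lookup-injective (Unique-++ʳ p u) x y eq =
      ≡.trans (sym (Finₚ.splitAt⁻¹-↑ʳ ei)) (Finₚ.splitAt⁻¹-↑ʳ ej)
    ... | inj₁ x | inj₂ y = ⊥-elim (disjoint-++ p u (∈-lookup x) (∈-lookup y) eq)
    ... | inj₂ x | inj₁ y = ⊥-elim (disjoint-++ p u (∈-lookup y) (∈-lookup x) (sym eq))

    hom : ∀ i j → adj (P 5 ∪ᵍ P 5) i j ≡ true → f i ~ f j
    hom i j a with splitAt 5 i | splitAt 5 j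
    ... | inj₁ x | inj₁ y = lookup-P pp x y a
    ... | inj₂ x | inj₂ y = lookup-P pq x y a

  -- Atoms (i , j) of a case tree refer to positions in a list; out-of-range positions denote its first entry.
  nth : V → List V → ℕ → V
  nth x xs zero = x
  nth x [] (suc i) = x
  nth x (y ∷ ys) (suc i) = nth y ys i

  nth-∈ : ∀ x xs i → nth x xs i ∈ x ∷ xs
  nth-∈ x xs zero = here refl
  nth-∈ x [] (suc i) = here refl
  nth-∈ x (y ∷ ys) (suc i) = there (nth-∈ y ys i)

  nth-injective : ∀ {x xs} → Unique (x ∷ xs) → ∀ i j → i < suc (length xs) → j < suc (length xs) →
                  nth x xs i ≡ nth x xs j → i ≡ j
  nth-injective u zero zero _ _ eq = refl
  nth-injective {x} {y ∷ ys} u (suc i) zero _ _ eq = ⊥-elim (Unique-head u (subst (_∈ y ∷ ys) eq (nth-∈ y ys i)))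
  nth-injective {x} {y ∷ ys} u zero (suc j) _ _ eq = ⊥-elim (Unique-head u (subst (_∈ y ∷ ys) (sym eq) (nth-∈ y ys j)))
  nth-injective {x} {y ∷ ys} (_ ∷ u) (suc i) (suc j) (s≤s p) (s≤s q) eq = cong suc (nth-injective u i j p q eq)
  nth-injective {xs = []} u (suc i) j (s≤s ()) q eq
  nth-injective {xs = []} u zero (suc j) p (s≤s ()) eq

  module Labelled (x : V) (xs : List V) where

    at : ℕ → V
    at = nth x xs

    val : Atom → Bool
    val (i , j) = adj G (at i) (at j)

    val-edge : ∀ i j → val (edge i j) ≡ adj G (at i) (at j)
    val-edge i j with i <ᵇ j
    ... | true = refl
    ... | false = adj-sym G (at j) (at i)

    Holds : List Atom → Set
    Holds = All (λ a → val a ≡ true)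

    chain⇒Path : ∀ is → Holds (chain is) → Path (map at is)
    chain⇒Path [] h = []
    chain⇒Path (i ∷ []) h = [-]
    chain⇒Path (i ∷ j ∷ is) (a ∷ h) = ≡.trans (sym (val-edge i j)) a ∷ chain⇒Path (j ∷ is) h

    count-star : ∀ i js → count val (star i js) ≡ deg (at i) (map at js)
    count-star i [] = refl
    count-star i (j ∷ js) with i ≡ᵇ j in eq
    ... | false = cong₂ _+_ (cong bit (val-edge i j)) (count-star i js)
    ... | true rewrite ≡ᵇ-true i j eq | irrefl G (at j) = count-star j js

    distinct⇒Unique : Unique (x ∷ xs) → ∀ m → m ≤ suc (length xs) → ∀ is →
                      distinctBelow m is ≡ true → Unique (map at is)
    distinct⇒Unique u m le [] p = []
    distinct⇒Unique u m le (i ∷ is) p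
      with p₁ , p₂ ← ∧-split {i <ᵇ m} p
      with p₃ , p₄ ← ∧-split {notIn i is} p₂ = apart is p₃ p₄ ∷ distinct⇒Unique u m le is p₄
      where
      apart : ∀ js → notIn i js ≡ true → distinctBelow m js ≡ true → All (at i ≢_) (map at js)
      apart [] _ _ = []
      apart (j ∷ js) q r
        with q₁ , q₂ ← ∧-split {not (i ≡ᵇ j)} q
        with r₁ , r₂ ← ∧-split {j <ᵇ m} r
        with r₃ , r₄ ← ∧-split {notIn j js} r₂ = ne ∷ apart js q₂ r₄
        where
        ne : at i ≢ at j
        ne eq = ≢ᵇ-true i j q₁ (nth-injective u i j (≤-trans (<ᵇ-true i m p₁) le) (≤-trans (<ᵇ-true j m r₁) le) eq)

-- A ten-digit numeral is read from the right: its last five digits are the vertices of one P₅, its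
-- first five those of the other.
twoPaths : ℕ → List Atom
twoPaths c = chain (digits 5 c) ++ chain (digits 5 (c / 100000))

twoOk : ℕ → Bool
twoOk c = distinctBelow 10 (digits 5 c ++ digits 5 (c / 100000))

module Embedding {n} (G : Graph n) (free : Paths.No2P5 G) where

  open Paths G public

  module Refute {C : Set} (ok : C → Bool) (req lim : C → List Atom) (bnd : C → ℕ) where

    private
      ok′ : ℕ ⊎ C → Bool
      ok′ = [ twoOk , ok ]′
      req′ lim′ : ℕ ⊎ C → List Atom
      req′ = [ twoPaths , req ]′
      lim′ = [ (λ _ → []) , lim ]′
      bnd′ : ℕ ⊎ C → ℕ
      -- With no limited atoms the count is 0, so the bound 1 makes this part of the check true.
      bnd′ = [ (λ _ → 1) , bnd ]′

    open Cases ok′ req′ lim′ bnd′ public using (check)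

    -- Leaves `inj₁ c` exhibit two disjoint P₅ and contradict `free`; what survives are the leaves
    -- particular to the configuration at hand.
    refute : ∀ x xs → length xs ≡ 9 → Unique (x ∷ xs) → (T : List Atom) (t : Tree (ℕ ⊎ C)) →
             check T [] t ≡ true → (let open Labelled x xs) → Holds T →
             Cases.Outcome ok req lim bnd val
    refute x xs len u T t p h with Cases.sound ok′ req′ lim′ bnd′ (Labelled.val x xs) T t p h
    ... | inj₂ c , o , r , l = c , o , r , l
    ... | inj₁ c , o , r , _ = ⊥-elim (free (map at ds) (map at es) refl refl
        (subst Unique (map-++ at ds es) (distinct⇒Unique u 10 (≤-reflexive (cong suc (sym len))) (ds ++ es) o))
        (chain⇒Path ds (Allₚ.++⁻ˡ (chain ds) r)) (chain⇒Path es (Allₚ.++⁻ʳ (chain ds) r)))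
      where
      open Labelled x xs
      ds es : List ℕ
      ds = digits 5 c
      es = digits 5 (c / 100000)

  exhibit : ∀ x xs → length xs ≡ 9 → Unique (x ∷ xs) → (T : List Atom) (c : ℕ) →
            Refute.check {⊥} ⊥-elim ⊥-elim ⊥-elim ⊥-elim T [] (leaf (inj₁ c)) ≡ true → Labelled.Holds x xs T → ⊥
  exhibit x xs len u T c p h = proj₁ (Refute.refute ⊥-elim ⊥-elim ⊥-elim ⊥-elim x xs len u T (leaf (inj₁ c)) p h)

-- The Turán number of P₅

-- The recursion by four mirrors the removal of a K₄ component and lets `g (4 + m)` compute to
-- `6 + g m`, which later estimates use silently.
g : ℕ → ℕ
g 0 = 0
g 1 = 0
g 2 = 1
g 3 = 3
g (suc (suc (suc (suc m)))) = 6 + g m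

-- The increments of `g` run cyclically through 0, 1, 2, 3. The largest sums of one, two and three
-- consecutive increments are 3, 5 and 6, the constants here and in the next two lemmas.
g-1+ : ∀ m → g (1 + m) ≤ 3 + g m
g-1+ 0 = z≤n
g-1+ 1 = s≤s z≤n
g-1+ 2 = s≤s (s≤s (s≤s z≤n))
g-1+ 3 = ≤-refl
g-1+ (suc (suc (suc (suc m)))) = +-monoʳ-≤ 6 (g-1+ m)

g-2+ : ∀ m → g (2 + m) ≤ 5 + g m
g-2+ 0 = s≤s z≤n
g-2+ 1 = s≤s (s≤s (s≤s z≤n))
g-2+ 2 = ≤-refl
g-2+ 3 = m≤n+m 6 2
g-2+ (suc (suc (suc (suc m)))) = +-monoʳ-≤ 6 (g-2+ m)

g-3+ : ∀ m → g (3 + m) ≤ 6 + g m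
g-3+ 0 = m≤n+m 3 3
g-3+ 1 = ≤-refl
g-3+ 2 = m≤n+m 6 1
g-3+ 3 = m≤n+m 7 2
g-3+ (suc (suc (suc (suc m)))) = +-monoʳ-≤ 6 (g-3+ m)

-- Average degree at most three, as in disjoint copies of K₄. Thus `g` grows with only half the
-- slope of 3n - 5, which settles the comparisons with that value.
2g≤3* : ∀ m → 2 * g m ≤ 3 * m
2g≤3* 0 = z≤n
2g≤3* 1 = z≤n
2g≤3* 2 = m≤n+m 2 4
2g≤3* 3 = m≤n+m 6 3
2g≤3* (suc (suc (suc (suc m)))) = ≤-trans (≤-reflexive (*-distribˡ-+ 2 6 (g m)))
  (≤-trans (+-monoʳ-≤ 12 (2g≤3* m)) (≤-reflexive (sym (*-distribˡ-+ 3 4 m))))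

-- A graph without P₅ and C₄ has at most as many edges as vertices; from three vertices on that is
-- within `g`.
n≤g : ∀ m → 3 + m ≤ g (3 + m)
n≤g 0 = ≤-refl
n≤g 1 = m≤n+m 4 2
n≤g 2 = m≤n+m 5 1
n≤g 3 = m≤n+m 6 1
n≤g (suc (suc (suc (suc m)))) = ≤-trans (+-monoʳ-≤ 4 (n≤g m)) (m≤n+m _ 2)

g-formula : ∀ m → g m ≡ 6 * (m / 4) + (m % 4) Comb.C 2
g-formula 0 = refl
g-formula 1 = refl
g-formula 2 = refl
g-formula 3 = refl
g-formula (suc (suc (suc (suc m)))) = ≡.trans (cong (6 +_) (g-formula m)) (≡.trans (lemma (m / 4) ((m % 4) Comb.C 2))
    (cong₂ (λ q r → 6 * q + r Comb.C 2) (sym (m/n≡1+[m∸n]/n {4 + m} {4} (m≤m+n 4 m)))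
      (≡.trans (sym ([m+n]%n≡m%n m 4)) (cong (_% 4) (+-comm m 4)))))
  where
  lemma : ∀ q r → 6 + (6 * q + r) ≡ 6 * (1 + q) + r
  lemma = solve-∀

bracket≡ : ∀ m → bracket (9 + m) ≡ 36 + g m
bracket≡ m = ≡.trans (+-assoc 36 (6 * (m / 4)) ((m % 4) Comb.C 2)) (cong (36 +_) (sym (g-formula m)))

module P5Free {n} (G : Graph n) where

  open Paths G

  NoP5-⊆ : ∀ {L M} → (∀ {v} → v ∈ M → v ∈ L) → NoP5 L → NoP5 M
  NoP5-⊆ sub no5 p lp up p⊆M = no5 p lp up (All.map sub p⊆M)

  C4 : List V → Set
  C4 L = ∃ λ a → ∃ λ b → ∃ λ c → ∃ λ d → (a ∈ L × b ∈ L × c ∈ L × d ∈ L) × (a ~ b × b ~ c × c ~ d × d ~ a) × (a ≢ c × b ≢ d)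

  _∈?_ : (v : V) (L : List V) → Dec (v ∈ L)
  v ∈? L = Any.any? (v Finₚ.≟_) L

  _~?_ : (u v : V) → Dec (u ~ v)
  u ~? v = adj G u v Boolₚ.≟ true

  C4? : ∀ L → Dec (C4 L)
  C4? L = Finₚ.any? λ a → Finₚ.any? λ b → Finₚ.any? λ c → Finₚ.any? λ d →
    (a ∈? L ×-dec b ∈? L ×-dec c ∈? L ×-dec d ∈? L) ×-dec
    (a ~? b ×-dec b ~? c ×-dec c ~? d ×-dec d ~? a) ×-dec (¬? (a Finₚ.≟ c) ×-dec ¬? (b Finₚ.≟ d))

  ~⇒≢ : ∀ {u v} → u ~ v → u ≢ v
  ~⇒≢ p refl = ~-irrefl p

  -- A second neighbour of the end `s` lengthens the path to a P₅, closes a 4-cycle at `p`, or is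
  -- `q`. In the last case `q r s` is a triangle, and a second neighbour of `p` again yields a P₅ or
  -- a 4-cycle.
  noP4 : ∀ {L} → Unique L → NoP5 L → ¬ C4 L → (∀ {v} → v ∈ L → 1 < deg v L) →
         ∀ {p q r s} → p ∈ L → q ∈ L → r ∈ L → s ∈ L → p ~ q → q ~ r → r ~ s → p ≢ r → q ≢ s → p ≢ s → ⊥
  noP4 {L} u no5 no4 big {p} {q} {r} {s} p∈ q∈ r∈ s∈ pq qr rs p≢r q≢s p≢s
    with t , t∈ , t∉r , st ← fresh s [ r ] u (big s∈)
    with t Finₚ.≟ p | t Finₚ.≟ q
  ... | yes refl | _ = no4 (p , q , r , s , (p∈ , q∈ , r∈ , s∈) , (pq , qr , rs , st) , p≢r , q≢s)
  ... | no t≢p | no t≢q = no5 (p ∷ q ∷ r ∷ s ∷ t ∷ []) refl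
    ((~⇒≢ pq ∷ p≢r ∷ p≢s ∷ (λ e → t≢p (sym e)) ∷ []) ∷ (~⇒≢ qr ∷ q≢s ∷ (λ e → t≢q (sym e)) ∷ []) ∷
     (~⇒≢ rs ∷ (λ e → t∉r (here (sym e))) ∷ []) ∷ (~⇒≢ st ∷ []) ∷ [] ∷ [])
    (p∈ ∷ q∈ ∷ r∈ ∷ s∈ ∷ t∈ ∷ []) (pq ∷ qr ∷ rs ∷ st ∷ [-])
  ... | no t≢p | yes refl
    with w , w∈ , w∉q , pw ← fresh p [ q ] u (big p∈)
    with w Finₚ.≟ r | w Finₚ.≟ s
  ... | yes refl | _ = no4 (p , r , s , q , (p∈ , r∈ , s∈ , q∈) , (pw , rs , st , ~-sym pq) , p≢s , λ e → t∉r (here (sym e)))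
  ... | no _ | yes refl = no4 (p , s , r , q , (p∈ , s∈ , r∈ , q∈) , (pw , ~-sym rs , ~-sym qr , ~-sym pq) , p≢r , λ e → q≢s (sym e))
  ... | no w≢r | no w≢s = no5 (w ∷ p ∷ q ∷ r ∷ s ∷ []) refl
    (((λ e → ~⇒≢ pw (sym e)) ∷ (λ e → w∉q (here e)) ∷ w≢r ∷ w≢s ∷ []) ∷ (~⇒≢ pq ∷ p≢r ∷ p≢s ∷ []) ∷
     (~⇒≢ qr ∷ q≢s ∷ []) ∷ (~⇒≢ rs ∷ []) ∷ [] ∷ [])
    (w∈ ∷ p∈ ∷ q∈ ∷ r∈ ∷ s∈ ∷ []) (~-sym pw ∷ pq ∷ qr ∷ rs ∷ [-])

  pull : ∀ {L} A {B} → L ↭ A ++ B → cross A B ≡ 0 → size L ≡ size A + size B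
  pull A {B} p c = ≡.trans (size-↭ p) (≡.trans (size-++ A B) (cong (_+ size B) (≡.trans (cong (size A +_) c) (+-identityʳ _))))

  zero-cross : ∀ {A B} → (∀ {a b} → a ∈ A → b ∈ B → ¬ a ~ b) → cross A B ≡ 0
  zero-cross {A} {B} h with cross A B in eq
  ... | zero = refl
  ... | suc k with a , b , a∈ , b∈ , ab ← cross>0⇒ A B (≤-trans z<s (≤-reflexive (sym eq))) = ⊥-elim (h a∈ b∈ ab)

  -- A vertex of degree at most one is deleted at the cost of at most one edge. Once there is none,
  -- `noP4` makes the component of `a` a triangle, with as many edges as vertices. `k` is the
  -- termination measure.
  NoP5∧NoC4⇒ : ∀ k L → length L ≤ k → Unique L → NoP5 L → ¬ C4 L → size L ≤ length L
  NoP5∧NoC4⇒ k [] _ _ _ _ = z≤n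
  NoP5∧NoC4⇒ (suc k) L@(a ∷ L₀) (s≤s le) u no5 no4 with Any.any? (λ v → deg v L ≤? 1) L
  ... | yes low with v , v∈ , dv ← find low with M , p ← extract v∈ = begin
      size L               ≡⟨ size-↭ p ⟩
      deg v M + size M     ≤⟨ +-mono-≤ (≤-trans (≤-reflexive dM) dv)
                                (NoP5∧NoC4⇒ k M (≤-pred (≤-trans (≤-reflexive (sym (↭-length p))) (s≤s le)))
                                  (AllPairs.tail (Unique-↭ p u)) (NoP5-⊆ sub no5) λ (a , b , c , d , (x , y , z , w) , r) → no4 (a , b , c , d , (sub x , sub y , sub z , sub w) , r)) ⟩
      1 + length M         ≡⟨ ↭-length p ⟨
      length L             ∎
    where
    open ≤-Reasoning
    sub : ∀ {w} → w ∈ M → w ∈ L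
    sub w∈ = ∈-resp-↭ (↭-sym p) (there w∈)
    dM : deg v M ≡ deg v L
    dM = sym (≡.trans (deg-↭ v p) (cong (λ b → bit b + deg v M) (irrefl G v)))
  ... | no ¬low
    with b , b∈ , _ , ab ← fresh a [] u (≤-trans z<s (≰⇒> λ x → ¬low (here x)))
    with c , c∈ , c∉ , ac ← fresh a [ b ] u (≰⇒> λ x → ¬low (here x))
    with d , d∈ , d∉ , bd ← fresh b [ a ] u (≰⇒> λ x → ¬low (lose b∈ x))
    with d Finₚ.≟ c
  ... | no d≢c = ⊥-elim (noP4 u no5 no4 (λ v∈ → ≰⇒> λ x → ¬low (lose v∈ x)) d∈ b∈ (here refl) c∈ (~-sym bd) (~-sym ab) ac
                    (λ e → d∉ (here e)) (λ e → c∉ (here (sym e))) d≢c)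
  ... | yes refl with M , p ← split-off {xs = a ∷ b ∷ c ∷ []} ((~⇒≢ ab ∷ ~⇒≢ ac ∷ []) ∷ ((~⇒≢ bd) ∷ []) ∷ [] ∷ []) (here refl ∷ b∈ ∷ c∈ ∷ []) =
    ≤-trans (≤-reflexive (pull (a ∷ b ∷ c ∷ []) p iso))
      (≤-trans (+-mono-≤ (size≤triangle (a ∷ b ∷ c ∷ []))
        (NoP5∧NoC4⇒ k M (≤-trans (m≤n+m _ 2) (≤-pred (≤-trans (≤-reflexive (sym (↭-length p))) (s≤s le))))
          (Unique-++ʳ (a ∷ b ∷ c ∷ []) uM) (NoP5-⊆ sub no5)
          λ (a , b , c , d , (x , y , z , w) , r) → no4 (a , b , c , d , (sub x , sub y , sub z , sub w) , r)))
      (≤-reflexive (sym (↭-length p))))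
    where
    uM : Unique (a ∷ b ∷ c ∷ M)
    uM = Unique-↭ p u
    sub : ∀ {w} → w ∈ M → w ∈ L
    sub w∈ = ∈-resp-↭ (↭-sym p) (there (there (there w∈)))
    P4⇒⊥ : ∀ {w x y z} → w ∈ M → x ∈ L → y ∈ L → z ∈ L → w ~ x → x ~ y → y ~ z → x ≢ z → w ≢ y → w ≢ z → ⊥
    P4⇒⊥ w∈ x∈ y∈ z∈ wx xy yz x≢z w≢y w≢z =
      noP4 u no5 no4 (λ v∈ → ≰⇒> λ x → ¬low (lose v∈ x)) (sub w∈) x∈ y∈ z∈ wx xy yz w≢y x≢z w≢z
    ne : ∀ {w v} → w ∈ M → v ∈ a ∷ b ∷ c ∷ [] → w ≢ v
    ne w∈ v∈ refl = disjoint-++ (a ∷ b ∷ c ∷ []) uM v∈ w∈ refl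
    iso : cross (a ∷ b ∷ c ∷ []) M ≡ 0
    iso = zero-cross {a ∷ b ∷ c ∷ []} {M} λ where
      (here refl) w∈ e → P4⇒⊥ w∈ (here refl) b∈ c∈ (~-sym e) ab bd (~⇒≢ ac) (ne w∈ (there (here refl))) (ne w∈ (there (there (here refl))))
      (there (here refl)) w∈ e → P4⇒⊥ w∈ b∈ (here refl) c∈ (~-sym e) (~-sym ab) ac (~⇒≢ bd) (ne w∈ (here refl)) (ne w∈ (there (there (here refl))))
      (there (there (here refl))) w∈ e → P4⇒⊥ w∈ c∈ (here refl) b∈ (~-sym e) (~-sym ac) ab (λ e → ~⇒≢ bd (sym e)) (ne w∈ (here refl)) (ne w∈ (there (here refl)))

  private
    -- A 4-cycle is a component up to chords: an edge leaving it, continued once around, is a P₅.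
    -- Removing its four vertices therefore removes at most 6 edges, one step of the recursion of
    -- `g`. Without a 4-cycle, edges are at most as many as vertices.
    turán : ∀ k L → length L ≤ k → Unique L → NoP5 L → size L ≤ g (length L)
    turán′ : ∀ k L → length L ≤ k → Unique L → NoP5 L → Dec (C4 L) → size L ≤ g (length L)
    turán k L le u no5 = turán′ k L le u no5 (C4? L)
    turán′ k [] le u no5 (no no4) = z≤n
    turán′ k (_ ∷ []) le u no5 (no no4) = z≤n
    turán′ k L@(_ ∷ _ ∷ []) le u no5 (no no4) = size≤triangle L
    turán′ k L@(_ ∷ _ ∷ _ ∷ L′) le u no5 (no no4) = ≤-trans (NoP5∧NoC4⇒ k L le u no5 no4) (n≤g (length L′))
    turán′ zero [] le u no5 (yes (_ , _ , _ , _ , (() , _) , _))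
    turán′ (suc k) L le u no5 (yes (a , b , c , d , (a∈ , b∈ , c∈ , d∈) , (ab , bc , cd , da) , a≢c , b≢d))
      = cut (split-off ((~⇒≢ ab ∷ a≢c ∷ (λ e → ~⇒≢ da (sym e)) ∷ []) ∷ (~⇒≢ bc ∷ b≢d ∷ []) ∷ (~⇒≢ cd ∷ []) ∷ [] ∷ []) (a∈ ∷ b∈ ∷ c∈ ∷ d∈ ∷ []))
      where
      A₄ : List V
      A₄ = a ∷ b ∷ c ∷ d ∷ []
      cut : (∃ λ M → L ↭ A₄ ++ M) → size L ≤ g (length L)
      cut (M , p) =
        ≤-trans (≤-reflexive (pull A₄ p iso))
          (≤-trans (+-mono-≤ (size≤triangle A₄)
            (turán k M (≤-trans (m≤n+m _ 3) (≤-pred (≤-trans (≤-reflexive (sym (↭-length p))) le)))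
              (Unique-++ʳ A₄ uM) (NoP5-⊆ sub no5)))
            (≤-reflexive (cong g (sym (↭-length p)))))
        where
        uM : Unique (A₄ ++ M)
        uM = Unique-↭ p u
        sub : ∀ {w} → w ∈ M → w ∈ L
        sub w∈ = ∈-resp-↭ (↭-sym p) (∈-++⁺ʳ A₄ w∈)
        P5⇒⊥ : ∀ {w x y z t} → w ∈ M → x ∷ y ∷ z ∷ t ∷ [] ↭ A₄ → w ~ x → x ~ y → y ~ z → z ~ t → ⊥
        P5⇒⊥ {w} w∈ q wx xy yz zt = no5 (w ∷ _) refl
          (All.tabulate (λ x∈ e → disjoint-++ A₄ uM (∈-resp-↭ q x∈) w∈ (sym e)) ∷ Unique-↭ (↭-sym q) (Unique-++ˡ A₄ uM))
          (sub w∈ ∷ All.tabulate λ x∈ → ∈-resp-↭ (↭-sym p) (∈-++⁺ˡ (∈-resp-↭ q x∈))) (wx ∷ xy ∷ yz ∷ zt ∷ [-])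
        rot : ∀ {x y z t : V} → x ∷ y ∷ z ∷ t ∷ [] ↭ t ∷ x ∷ y ∷ z ∷ []
        rot {x} {y} {z} {t} = shift t (x ∷ y ∷ z ∷ []) []
        iso : cross A₄ M ≡ 0
        iso = zero-cross {A₄} {M} λ where
          (here refl) w∈ e → P5⇒⊥ w∈ ↭-refl (~-sym e) ab bc cd
          (there (here refl)) w∈ e → P5⇒⊥ w∈ rot (~-sym e) bc cd da
          (there (there (here refl))) w∈ e → P5⇒⊥ w∈ (↭-trans rot rot) (~-sym e) cd da ab
          (there (there (there (here refl)))) w∈ e → P5⇒⊥ w∈ (↭-sym rot) (~-sym e) da ab bc

  NoP5⇒size≤g : ∀ {L} → Unique L → NoP5 L → size L ≤ g (length L)
  NoP5⇒size≤g {L} = turán (length L) L ≤-refl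

-- Closing a non-extendable path to a cycle

data CycleLeaf : Set where
  cycle few : ℕ → CycleLeaf

module CycleCases (k : ℕ) where

  ok : CycleLeaf → Bool
  ok (cycle c) = distinctBelow k (digits k c)
  ok (few i) = (i ≡ᵇ 0) ∨ (suc i ≡ᵇ k)

  closed : List ℕ → List ℕ
  closed [] = []
  closed (i ∷ is) = i ∷ is ++ [ i ]

  req lim : CycleLeaf → List Atom
  req (cycle c) = chain (closed (digits k c))
  req (few i) = []
  lim (cycle c) = []
  lim (few i) = star i (upTo k)

  bnd : CycleLeaf → ℕ
  bnd (cycle c) = 1
  bnd (few i) = 4

  open Cases ok req lim bnd public

-- The trees certify Ore's crossing argument. If both ends of a path on k ≤ 8 vertices have four
-- neighbours on it, their degree sum is at least k, so the ends are adjacent or there are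
-- consecutive i, i + 1 with 0 adjacent to i + 1 and i to k - 1; either way all vertices lie on a
-- cycle.
cycleTree5 : Tree CycleLeaf
cycleTree5 =
  split 0 4 (leaf (cycle 43210)) (leaf (few 0))

cycleTree6 : Tree CycleLeaf
cycleTree6 =
  split 0 5 (leaf (cycle 543210)) (split 0 2 (split 1 5 (leaf (cycle 234510)) (leaf (few 5))) (leaf (few
  0)))

cycleTree7 : Tree CycleLeaf
cycleTree7 =
  split 0 6 (leaf (cycle 6543210)) (split 0 2 (split 1 6 (leaf (cycle 2345610)) (split 2 6 (split 0 3 (leaf
  (cycle 3456210)) (split 0 5 (split 3 6 (leaf (cycle 5436210)) (leaf (few 6))) (leaf (few 0)))) (leaf (few
  6)))) (split 0 3 (split 0 4 (split 1 6 (leaf (cycle 4561230)) (split 2 6 (leaf (cycle 3456210)) (leaf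
  (few 6)))) (leaf (few 0))) (leaf (few 0))))

cycleTree8 : Tree CycleLeaf
cycleTree8 =
  split 0 7 (leaf (cycle 76543210)) (split 0 2 (split 1 7 (leaf (cycle 23456710)) (split 2 7 (split 0 3
  (leaf (cycle 34567210)) (split 0 6 (split 3 7 (leaf (cycle 65437210)) (split 5 7 (leaf (cycle 67543210))
  (leaf (few 7)))) (split 0 4 (split 0 5 (split 3 7 (leaf (cycle 45673210)) (split 4 7 (leaf (cycle
  56743210)) (leaf (few 7)))) (leaf (few 0))) (leaf (few 0))))) (split 3 7 (split 4 7 (split 0 4 (leaf
  (cycle 45673210)) (split 0 5 (leaf (cycle 56743210)) (split 0 6 (leaf (cycle 65473210)) (leaf (few 0)))))
  (leaf (few 7))) (leaf (few 7))))) (split 0 3 (split 0 4 (split 1 7 (leaf (cycle 45671230)) (split 2 7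
  (leaf (cycle 34567210)) (split 3 7 (leaf (cycle 45673210)) (leaf (few 7))))) (split 0 5 (split 0 6 (split
  1 7 (leaf (cycle 67123450)) (split 2 7 (leaf (cycle 34567210)) (split 4 7 (leaf (cycle 56743210)) (leaf
  (few 7))))) (leaf (few 0))) (leaf (few 0)))) (split 0 4 (split 0 5 (split 1 7 (leaf (cycle 56712340))
  (split 3 7 (leaf (cycle 45673210)) (split 4 7 (leaf (cycle 56743210)) (leaf (few 7))))) (leaf (few 0)))
  (leaf (few 0)))))

module Cores {n} (G : Graph n) where

  open Paths G
  open P5Free G

  -- Deleting vertices of degree at most 3

  -- The head of the list is deleted first and its degree is taken in what then remains. The end of
  -- the list thus holds the vertices deleted last, the ones nearest to the core.
  data Peel (Q : List V) : List V → Set where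
    [] : Peel Q []
    _∷_ : ∀ {t T} → deg t (T ++ Q) ≤ 3 → Peel Q T → Peel Q (t ∷ T)

  Dense : List V → Set
  Dense Q = ∀ {v} → v ∈ Q → 4 ≤ deg v Q

  Core : List V → Set
  Core L = ∃ λ T → ∃ λ Q → L ↭ T ++ Q × Peel Q T × Dense Q

  core : ∀ k L → length L ≤ k → Core L
  core k L le with Any.any? (λ v → deg v L ≤? 3) L
  core k L le | no none = [] , L , ↭-refl , [] , λ v∈ → ≰⇒> λ x → none (lose v∈ x)
  core zero [] le | yes ()
  core (suc k) L le | yes low = step (find low)
    where
    extend : ∀ {v M} → deg v L ≤ 3 → L ↭ v ∷ M → Core M → Core L
    extend {v} {M} dv p (T , Q , q , pl , d) =
      v ∷ T , Q , ↭-trans p (prep v q) , ≤-trans (≤-reflexive eq) dv ∷ pl , d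
      where
      eq : deg v (T ++ Q) ≡ deg v L
      eq = sym (≡.trans (deg-↭ v (↭-trans p (prep v q))) (cong (λ b → bit b + deg v (T ++ Q)) (irrefl G v)))
    step : (∃ λ v → v ∈ L × deg v L ≤ 3) → Core L
    step (v , v∈ , dv) = let M , p = extract v∈ in
      extend dv p (core k M (≤-pred (≤-trans (≤-reflexive (sym (↭-length p))) le)))

  Peel-deg : ∀ {Q T} → Peel Q T → All (λ t → deg t Q ≤ 3) T
  Peel-deg [] = []
  Peel-deg {Q} {t ∷ T} (p ∷ ps) = ≤-trans (≤-trans (m≤n+m (deg t Q) (deg t T)) (≤-reflexive (sym (deg-++ t T Q)))) p ∷ Peel-deg ps

  Peel-size : ∀ {Q T} → Peel Q T → size (T ++ Q) ≤ length T * 3 + size Q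
  Peel-size [] = ≤-refl
  Peel-size {Q} {t ∷ T} (p ∷ ps) = ≤-trans (+-mono-≤ p (Peel-size ps)) (≤-reflexive (sym (+-assoc 3 (length T * 3) (size Q))))

  -- The three vertices deleted last span at most 3 edges where the general estimate allows 9; this
  -- is the 6 that is saved.
  Peel-[] : ∀ {T} → Peel [] T → 3 ≤ length T → size T + 6 ≤ length T * 3
  Peel-[] {_ ∷ []} _ (s≤s ())
  Peel-[] {_ ∷ _ ∷ []} _ (s≤s (s≤s ()))
  Peel-[] {T@(_ ∷ _ ∷ _ ∷ [])} _ _ = +-monoˡ-≤ 6 (size≤triangle T)
  Peel-[] {t ∷ T@(_ ∷ _ ∷ _ ∷ _)} (p ∷ ps) _ = ≤-trans (≤-reflexive (+-assoc (deg t T) (size T) 6))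
    (+-mono-≤ (≤-trans (≤-reflexive (cong (deg t) (sym (++-identityʳ T)))) p) (Peel-[] ps (s≤s (s≤s (s≤s z≤n)))))

  -- Paths as lists

  Path-++ˡ : ∀ A {B} → Path (A ++ B) → Path A
  Path-++ˡ [] p = []
  Path-++ˡ (a ∷ []) p = [-]
  Path-++ˡ (a ∷ b ∷ A) (e ∷ p) = e ∷ Path-++ˡ (b ∷ A) p

  Path-tail : ∀ {a A} → Path (a ∷ A) → Path A
  Path-tail [-] = []
  Path-tail (e ∷ p) = p

  Path-++ʳ : ∀ A {B} → Path (A ++ B) → Path B
  Path-++ʳ [] p = p
  Path-++ʳ (a ∷ A) p = Path-++ʳ A (Path-tail p)

  Path-glue : ∀ A {c B} → Path (A ++ [ c ]) → Path (c ∷ B) → Path (A ++ c ∷ B)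
  Path-glue [] p q = q
  Path-glue (a ∷ []) (e ∷ p) q = e ∷ q
  Path-glue (a ∷ b ∷ A) (e ∷ p) q = e ∷ Path-glue (b ∷ A) p q

  Path-snoc : ∀ x xs {u} → Path (x ∷ xs) → nth x xs (length xs) ~ u → Path (x ∷ xs ++ [ u ])
  Path-snoc x [] p e = e ∷ [-]
  Path-snoc x (y ∷ ys) (d ∷ p) e = d ∷ Path-snoc y ys p e

  Cycle : List V → Set
  Cycle [] = ⊥
  Cycle (c ∷ cs) = Path (c ∷ cs ++ [ c ])

  rotate : ∀ {C y} → Cycle C → y ∈ C → ∃ λ D → C ↭ y ∷ D × Cycle (y ∷ D)
  rotate {c ∷ cs} {y} cyc y∈ with ∈-∃++ y∈
  ... | [] , ys , refl = ys , ↭-refl , cyc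
  ... | .c ∷ xs , ys , refl = ys ++ c ∷ xs , ++-comm (c ∷ xs) (y ∷ ys) ,
    subst Path (cong (y ∷_) (sym (++-assoc ys (c ∷ xs) [ y ])))
      (Path-glue (y ∷ ys) (Path-++ʳ (c ∷ xs) whole) (Path-++ˡ ((c ∷ xs) ++ [ y ]) (subst Path (sym (++-assoc (c ∷ xs) [ y ] _)) whole)))
    where
    whole : Path ((c ∷ xs) ++ (y ∷ ys) ++ [ c ])
    whole = subst Path (++-assoc (c ∷ xs) (y ∷ ys) [ c ]) cyc

  PathIn : List V → ℕ → Set
  PathIn Q k = ∃ λ p → ∃ λ W → length p ≡ k × Path p × Q ↭ p ++ W

  prepend : ∀ {Q v p W} → Path (v ∷ p) → Q ↭ (v ∷ p) ++ W → 0 < deg v W → PathIn Q (suc (suc (length p)))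
  prepend {Q} {v} {p} {W} pp q pos =
    let u , u∈ , e = deg>0⇒ v W pos
        W′ , r = extract u∈
    in u ∷ v ∷ p , W′ , refl , ~-sym e ∷ pp , ↭-trans q (↭-trans (++⁺ˡ (v ∷ p) r) (shift u (v ∷ p) W′))

  append : ∀ {Q x xs W} → Path (x ∷ xs) → Q ↭ (x ∷ xs) ++ W → 0 < deg (nth x xs (length xs)) W → PathIn Q (suc (suc (length xs)))
  append {Q} {x} {xs} {W} pp q pos =
    let u , u∈ , e = deg>0⇒ (nth x xs (length xs)) W pos
        W′ , r = extract u∈
    in x ∷ xs ++ [ u ] , W′ , cong suc (≡.trans (length-++ xs) (+-comm (length xs) 1)) , Path-snoc x xs pp e ,
       ↭-trans q (↭-trans (++⁺ˡ (x ∷ xs) r) (↭-reflexive (sym (++-assoc (x ∷ xs) [ u ] W′))))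

  deg-split : ∀ p {Q W} v → Q ↭ p ++ W → deg v Q ≡ deg v p + deg v W
  deg-split p {W = W} v q = ≡.trans (deg-↭ v q) (deg-++ v p W)

  leaves-path : ∀ p {Q W v} → Dense Q → Q ↭ p ++ W → v ∈ p → deg v p < 4 → 0 < deg v W
  leaves-path p {Q} {W} {v} dense q v∈ lt with deg v W in eq
  ... | suc _ = z<s
  ... | zero = ⊥-elim (<⇒≱ lt (≤-trans (dense (∈-resp-↭ (↭-sym q) (∈-++⁺ˡ v∈)))
      (≤-reflexive (≡.trans (deg-split p v q) (≡.trans (cong (deg v p +_) eq) (+-identityʳ _))))))

  -- An end of a path on at most four vertices has at most three neighbours on it, hence one in `Q`
  -- off the path.
  lengthen : ∀ {Q k} → Dense Q → suc k ≤ 4 → PathIn Q (suc k) → PathIn Q (suc (suc k))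
  lengthen {Q} dense le (v ∷ p , W , refl , pp , q) =
    prepend pp q (leaves-path (v ∷ p) dense q (here refl)
      (≤-trans (s≤s (≤-reflexive (cong (λ b → bit b + deg v p) (irrefl G v)))) (≤-trans (s≤s (deg≤length v p)) le)))

  Dense⇒P5 : ∀ {Q v} → Dense Q → v ∈ Q → PathIn Q 5
  Dense⇒P5 {Q} {v} dense v∈ = let W , q = extract v∈ in
    lengthen dense (s≤s (s≤s (s≤s (s≤s z≤n)))) (lengthen dense (s≤s (s≤s (s≤s z≤n))) (lengthen dense (s≤s (s≤s z≤n))
      (lengthen dense (s≤s z≤n) (v ∷ [] , W , refl , [-] , q))))

  nth-upTo : ∀ x xs → map (nth x xs) (upTo (suc (length xs))) ≡ x ∷ xs
  nth-upTo x xs = ≡.trans (map-upTo (nth x xs) (suc (length xs))) (go x xs)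
    where
    go : ∀ x xs → applyUpTo (nth x xs) (suc (length xs)) ≡ x ∷ xs
    go x [] = refl
    go x (y ∷ ys) = cong (x ∷_) (go y ys)

  length-digits : ∀ k c → length (digits k c) ≡ k
  length-digits zero c = refl
  length-digits (suc k) c = cong suc (length-digits k (c / 10))

  ↭-exhaust : ∀ {xs ys : List V} → Unique xs → All (_∈ ys) xs → length xs ≡ length ys → ys ↭ xs
  ↭-exhaust {xs} {ys} u sub len with split-off u sub
  ... | [] , p = ↭-trans p (↭-reflexive (++-identityʳ xs))
  ... | z ∷ zs , p = ⊥-elim (<-irrefl len (≤-trans (m<m+n (length xs) z<s) (≤-reflexive (sym (≡.trans (↭-length p) (length-++ xs))))))

  close : ∀ x xs → Unique (x ∷ xs) → Path (x ∷ xs) → (let k = suc (length xs)) → (t : Tree CycleLeaf) →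
          CycleCases.check k (chain (upTo k)) [] t ≡ true →
          (∃ λ C → x ∷ xs ↭ C × Cycle C) ⊎ (deg x (x ∷ xs) < 4 ⊎ deg (nth x xs (length xs)) (x ∷ xs) < 4)
  close x xs u pp t chk = conclude (CycleCases.sound k val (chain (upTo k)) t chk (Path⇒chain k pp′))
    where
    open Labelled x xs
    k : ℕ
    k = suc (length xs)
    pp′ : Path (map at (upTo k))
    pp′ = subst Path (sym (nth-upTo x xs)) pp
    Path⇒chain : ∀ k → Path (map at (upTo k)) → Holds (chain (upTo k))
    Path⇒chain k p = go (upTo k) p
      where
      go : ∀ is → Path (map at is) → Holds (chain is)
      go [] _ = []
      go (i ∷ []) _ = []
      go (i ∷ j ∷ is) (e ∷ q) = ≡.trans (val-edge i j) e ∷ go (j ∷ is) q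
    few⇒ : ∀ i → count val (star i (upTo k)) < 4 → deg (at i) (x ∷ xs) < 4
    few⇒ i lt = ≤-trans (s≤s (≤-reflexive (sym (≡.trans (count-star i (upTo k)) (cong (deg (at i)) (nth-upTo x xs)))))) lt
    end : ∀ i → (i ≡ᵇ 0) ∨ (i ≡ᵇ length xs) ≡ true → i ≡ 0 ⊎ i ≡ length xs
    end zero o = inj₁ refl
    end (suc i) o = inj₂ (≡ᵇ-true (suc i) (length xs) o)
    conclude : CycleCases.Outcome k val → _
    conclude (few i , o , _ , lt) with end i o
    ... | inj₁ refl = inj₂ (inj₁ (few⇒ i lt))
    ... | inj₂ refl = inj₂ (inj₂ (few⇒ i lt))
    conclude (cycle c , o , h , _) = inj₁ (map at ds , perm , closes)
      where
      ds : List ℕ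
      ds = digits k c
      perm : x ∷ xs ↭ map at ds
      perm = ↭-exhaust (distinct⇒Unique u k ≤-refl ds o)
        (All.tabulate λ {v} v∈ → let i , _ , e = ∈-map⁻ at {xs = ds} v∈ in subst (_∈ x ∷ xs) (sym e) (nth-∈ x xs i))
        (≡.trans (length-map at ds) (length-digits k c))
      open CycleCases k using (closed)
      closes : Cycle (map at ds)
      closes = subst Path (cong (at (c % 10) ∷_) (map-++ at (digits (length xs) (c / 10)) [ c % 10 ])) (chain⇒Path (closed ds) h)

  module _ (free : No2P5) where

    Grown : List V → ℕ → Set
    Grown Q k = PathIn Q (suc k) ⊎ (∃ λ C → Q ↭ C × Cycle C)

    -- A cycle on at least five vertices that misses part of Q has an edge to the rest of Q,
    -- which would otherwise contain a disjoint P₅.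
    attach : ∀ {Q C W} → Unique Q → Dense Q → 5 ≤ length C → Cycle C → Q ↭ C ++ W → Grown Q (length C)
    attach {Q} {C} {W} u dense le cyc q with cross C W in eq
    ... | suc _ = let c , w , c∈ , w∈ , e = cross>0⇒ C W (≤-trans z<s (≤-reflexive (sym eq)))
                      D , r , cyc′ = rotate cyc c∈
                      m , W′ , len , path = prepend (Path-++ˡ (c ∷ D) cyc′) (↭-trans q (++⁺ʳ W r)) (~⇒deg>0 w∈ e)
                  in inj₁ (m , W′ , ≡.trans len (cong suc (sym (↭-length r))) , path)
    attach {Q} {C} {[]} u dense le cyc q | zero = inj₂ (C , ↭-trans q (↭-reflexive (++-identityʳ C)) , cyc)
    attach {Q} {C} {W@(w ∷ _)} u dense le cyc q | zero = ⊥-elim (far C cyc le uq (Dense⇒P5 denseW (here refl)))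
      where
      uq : Unique (C ++ W)
      uq = Unique-↭ q u
      denseW : Dense W
      denseW {v} v∈ = ≤-trans (dense (∈-resp-↭ (↭-sym q) (∈-++⁺ʳ C v∈)))
        (≤-reflexive (≡.trans (deg-split C v q) (cong (_+ deg v W) (cross≡0⇒deg C (≡.trans (cross-sym W C) eq) v∈))))
      far : ∀ C → Cycle C → 5 ≤ length C → Unique (C ++ W) → PathIn W 5 → ⊥
      far (c ∷ cs) cyc le uCW (p , S , lp , pp , r) = free (take 5 (c ∷ cs)) p
        (≡.trans (length-take 5 (c ∷ cs)) (m≤n⇒m⊓n≡m le)) lp
        (Unique-sub (take 5 (c ∷ cs)) uTW (Unique-++ˡ p (Unique-↭ r (Unique-++ʳ (c ∷ cs) uCW)))
          (All.tabulate λ v∈ → ∈-++⁺ʳ (drop 5 (c ∷ cs)) (∈-resp-↭ (↭-sym r) (∈-++⁺ˡ v∈))))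
        (Path-++ˡ (take 5 (c ∷ cs)) (subst Path (sym (take++drop≡id 5 (c ∷ cs))) (Path-++ˡ (c ∷ cs) cyc))) pp
        where
        uTW : Unique (take 5 (c ∷ cs) ++ (drop 5 (c ∷ cs) ++ W))
        uTW = subst Unique (≡.trans (cong (_++ W) (sym (take++drop≡id 5 (c ∷ cs)))) (++-assoc (take 5 (c ∷ cs)) (drop 5 (c ∷ cs)) W)) uCW

    grow : ∀ {Q} k (t : Tree CycleLeaf) → 5 ≤ k → CycleCases.check k (chain (upTo k)) [] t ≡ true →
           Unique Q → Dense Q → PathIn Q k → Grown Q k
    grow (suc k) t (s≤s le) chk u dense (x ∷ xs , W , refl , pp , q)
      with close x xs (Unique-++ˡ (x ∷ xs) (Unique-↭ q u)) pp t chk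
    ... | inj₂ (inj₁ lt) = inj₁ (prepend pp q (leaves-path (x ∷ xs) dense q (here refl) lt))
    ... | inj₂ (inj₂ lt) = inj₁ (append pp q (leaves-path (x ∷ xs) dense q (nth-∈ x xs (length xs)) lt))
    ... | inj₁ (C , r , cyc) = subst (Grown _) (sym (↭-length r))
      (attach u dense (≤-trans (s≤s le) (≤-reflexive (↭-length r))) cyc (↭-trans q (++⁺ʳ W r)))

    longPath : ∀ {Q v} → Unique Q → Dense Q → v ∈ Q → PathIn Q 9 ⊎ (∃ λ C → Q ↭ C × Cycle C)
    longPath {Q} u dense v∈ = next 8 cycleTree8 (m≤n+m 5 3) refl (next 7 cycleTree7 (m≤n+m 5 2) refl
        (next 6 cycleTree6 (m≤n+m 5 1) refl (next 5 cycleTree5 ≤-refl refl (inj₁ (Dense⇒P5 dense v∈)))))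
      where
      next : ∀ k (t : Tree CycleLeaf) → 5 ≤ k → CycleCases.check k (chain (upTo k)) [] t ≡ true →
             PathIn Q k ⊎ (∃ λ C → Q ↭ C × Cycle C) → Grown Q k
      next k t le chk (inj₁ p) = grow k t le chk u dense p
      next k t le chk (inj₂ c) = inj₂ c

-- Paths on nine vertices

-- `ham c` reroutes the nine vertices along another Hamiltonian path whose first vertex has fewer
-- than four neighbours among them. It therefore has one elsewhere in the core, and the resulting
-- path on ten vertices falls into two P₅. `bowtie`, two K₅ sharing vertex 4, is the one
-- configuration that escapes.
data NineLeaf : Set where
  bowtie : NineLeaf
  ham    : ℕ → NineLeaf

clique : List ℕ → List Atom
clique [] = []
clique (i ∷ is) = map (edge i) is ++ clique is

bowtieAtoms : List Atom
bowtieAtoms = clique (upTo 5) ++ clique (4 ∷ 5 ∷ 6 ∷ 7 ∷ 8 ∷ [])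

nineOk : NineLeaf → Bool
nineOk bowtie = true
nineOk (ham c) = distinctBelow 9 (digits 9 c)

nineReq nineLim : NineLeaf → List Atom
nineReq bowtie = (4 , 9) ∷ bowtieAtoms
nineReq (ham c) = chain (digits 9 c)
nineLim bowtie = []
nineLim (ham c) = star (c % 10) (upTo 9)

nineBnd : NineLeaf → ℕ
nineBnd bowtie = 1
nineBnd (ham c) = 4

-- Position 9 is a vertex off the path 0 … 8 that is adjacent to vertex i of the path.
nineTree : ℕ → Tree (ℕ ⊎ NineLeaf)
nineTree 0 =
  leaf (inj₁ 8765490123)
nineTree 1 =
  split 0 2 (leaf (inj₁ 8765432019)) (split 0 3 (leaf (inj₁ 8765491230)) (split 0 5 (leaf (inj₁
  9123487650)) (split 0 7 (leaf (inj₁ 6543287019)) (split 0 8 (leaf (inj₁ 9123456780)) (leaf (inj₂ (ham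
  876543210)))))))
nineTree 2 =
  split 0 3 (leaf (inj₁ 8765492301)) (split 0 6 (leaf (inj₁ 9234587601)) (split 0 8 (leaf (inj₁
  9234567801)) (split 0 4 (split 1 3 (leaf (inj₁ 8765492310)) (split 3 5 (leaf (inj₁ 9210487653)) (split 3
  7 (leaf (inj₁ 6540187329)) (split 3 8 (leaf (inj₁ 9210456783)) (leaf (inj₂ (ham 876540123))))))) (split 0
  5 (split 1 8 (leaf (inj₁ 9234567810)) (split 2 8 (leaf (inj₁ 3450167829)) (split 3 8 (leaf (inj₁
  9210567834)) (split 4 8 (leaf (inj₁ 9210567843)) (leaf (inj₂ (ham 432105678))))))) (leaf (inj₂ (ham
  876543210)))))))
nineTree 3 =
  leaf (inj₁ 8765493210)
nineTree 4 =
  split 0 5 (leaf (inj₁ 9432187650)) (split 0 8 (leaf (inj₁ 9432156780)) (split 0 6 (split 2 5 (leaf (inj₁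
  8760194523)) (split 3 5 (leaf (inj₁ 8760194532)) (split 5 7 (leaf (inj₁ 6012387549)) (split 5 8 (leaf
  (inj₁ 9432106785)) (leaf (inj₂ (ham 876012345))))))) (split 0 7 (split 2 8 (leaf (inj₁ 5670182349))
  (split 3 8 (leaf (inj₁ 9456783210)) (split 5 8 (leaf (inj₁ 9432107856)) (split 6 8 (leaf (inj₁
  9432107865)) (leaf (inj₂ (ham 654321078))))))) (split 0 3 (split 0 2 (split 0 4 (split 1 8 (leaf (inj₁
  9456781032)) (split 2 8 (leaf (inj₁ 9430156782)) (split 3 8 (leaf (inj₁ 9456783210)) (split 4 8 (split 1
  5 (leaf (inj₁ 9432087651)) (split 2 5 (leaf (inj₁ 9430187652)) (split 3 5 (leaf (inj₁ 9402187653)) (split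
  5 7 (split 5 8 (split 2 6 (leaf (inj₁ 9430187562)) (split 2 7 (leaf (inj₁ 9430185672)) (split 2 4 (split
  3 6 (leaf (inj₁ 9402187563)) (split 3 7 (leaf (inj₁ 9402185673)) (split 1 3 (split 1 6 (leaf (inj₁
  9432087561)) (split 1 7 (leaf (inj₁ 9432085671)) (split 1 4 (split 4 7 (split 6 8 (split 4 6 (leaf (inj₂
  bowtie)) (leaf (inj₂ (ham 321048756)))) (leaf (inj₂ (ham 321048756)))) (leaf (inj₂ (ham 321048567))))
  (leaf (inj₂ (ham 876543201)))))) (leaf (inj₂ (ham 876542103)))))) (leaf (inj₂ (ham 876543012)))))) (leaf
  (inj₂ (ham 321048765)))) (leaf (inj₂ (ham 321048765))))))) (leaf (inj₂ (ham 321045678))))))) (leaf (inj₂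
  (ham 876543210)))) (leaf (inj₂ (ham 876543210)))) (leaf (inj₂ (ham 876543210)))))))
nineTree 5 =
  leaf (inj₁ 9567843210)
nineTree 6 =
  split 0 8 (leaf (inj₁ 5432196780)) (split 2 8 (leaf (inj₁ 9654378210)) (split 5 8 (leaf (inj₁
  4321096785)) (split 1 8 (split 0 2 (leaf (inj₁ 9654378120)) (split 0 4 (leaf (inj₁ 7812396540)) (split 0
  5 (leaf (inj₁ 9678123450)) (split 0 7 (leaf (inj₁ 9654387012)) (leaf (inj₂ (ham 876543210))))))) (split 3
  8 (split 0 4 (leaf (inj₁ 7832196540)) (split 0 5 (leaf (inj₁ 9678345012)) (split 0 6 (leaf (inj₁
  7834596012)) (split 0 7 (leaf (inj₁ 9654387012)) (leaf (inj₂ (ham 876543210))))))) (leaf (inj₂ (ham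
  12345678)))))))
nineTree 7 =
  split 0 8 (leaf (inj₁ 6543297801)) (split 1 8 (leaf (inj₁ 6543297810)) (split 3 8 (leaf (inj₁
  9765483210)) (split 5 8 (leaf (inj₁ 4321097856)) (split 6 8 (leaf (inj₁ 4321097865)) (leaf (inj₂ (ham
  12345678)))))))
nineTree 8 =
  leaf (inj₁ 9876543210)
-- A default for indices beyond the path; only the trees 0 to 8 are run.
nineTree _ = leaf (inj₂ bowtie)

module NinePath {n} (G : Graph n) (free : Paths.No2P5 G) where

  open Embedding G free
  open P5Free G
  open Cores G

  distinctBelow⇒< : ∀ m is → distinctBelow m is ≡ true → All (_< m) is
  distinctBelow⇒< m [] p = []
  distinctBelow⇒< m (i ∷ is) p with p₁ , p₂ ← ∧-split {i <ᵇ m} p with _ , p₄ ← ∧-split {notIn i is} p₂ =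
    <ᵇ-true i m p₁ ∷ distinctBelow⇒< m is p₄

  nth-∈-++ˡ : ∀ x xs {ys} i → i < suc (length xs) → nth x (xs ++ ys) i ∈ x ∷ xs
  nth-∈-++ˡ x xs zero lt = here refl
  nth-∈-++ˡ x [] (suc i) (s≤s ())
  nth-∈-++ˡ x (y ∷ ys) (suc i) (s≤s lt) = there (nth-∈-++ˡ y ys i lt)

  module Bowtie {S : List V} {v₀ v₁ v₂ v₃ v₄ v₅ v₆ v₇ v₈ w : V} (upS : Unique (v₀ ∷ v₁ ∷ v₂ ∷ v₃ ∷ v₄ ∷ v₅ ∷ v₆ ∷ v₇ ∷ v₈ ∷ S))
      (w∈ : w ∈ S) (vw : v₄ ~ w) (h₁ : Labelled.Holds v₀ (v₁ ∷ v₂ ∷ v₃ ∷ v₄ ∷ v₅ ∷ v₆ ∷ v₇ ∷ v₈ ∷ w ∷ []) bowtieAtoms) where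
    p left right : List V
    p = v₀ ∷ v₁ ∷ v₂ ∷ v₃ ∷ v₄ ∷ v₅ ∷ v₆ ∷ v₇ ∷ v₈ ∷ []
    left = v₀ ∷ v₁ ∷ v₂ ∷ v₃ ∷ []
    right = v₅ ∷ v₆ ∷ v₇ ∷ v₈ ∷ []

    uS : ∀ {w} → w ∈ S → Unique (p ++ [ w ])
    uS w∈ = Unique-sub p upS ([] ∷ []) (w∈ ∷ [])

    -- No atom of `bowtieAtoms` mentions position 9, so the same edges serve with any tenth vertex
    -- `u`.
    h : ∀ {u} → Labelled.Holds v₀ (v₁ ∷ v₂ ∷ v₃ ∷ v₄ ∷ v₅ ∷ v₆ ∷ v₇ ∷ v₈ ∷ u ∷ []) bowtieAtoms
    h = copy h₁
      where
      copy : ∀ {u} → Labelled.Holds v₀ (v₁ ∷ v₂ ∷ v₃ ∷ v₄ ∷ v₅ ∷ v₆ ∷ v₇ ∷ v₈ ∷ w ∷ []) bowtieAtoms →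
             Labelled.Holds v₀ (v₁ ∷ v₂ ∷ v₃ ∷ v₄ ∷ v₅ ∷ v₆ ∷ v₇ ∷ v₈ ∷ u ∷ []) bowtieAtoms
      copy (a0 ∷ a1 ∷ a2 ∷ a3 ∷ a4 ∷ a5 ∷ a6 ∷ a7 ∷ a8 ∷ a9 ∷ a10 ∷ a11 ∷ a12 ∷ a13 ∷ a14 ∷ a15 ∷ a16 ∷ a17 ∷ a18 ∷ a19 ∷ []) =
        a0 ∷ a1 ∷ a2 ∷ a3 ∷ a4 ∷ a5 ∷ a6 ∷ a7 ∷ a8 ∷ a9 ∷ a10 ∷ a11 ∷ a12 ∷ a13 ∷ a14 ∷ a15 ∷ a16 ∷ a17 ∷ a18 ∷ a19 ∷ []

    -- `u` and the four vertices on the side of `l` would form a P₅, while the K₅ on the other side,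
    -- centre included, contains a second one.
    outside : ∀ {l u} → l ∈ left ++ right → u ∈ S → ¬ l ~ u
    outside {l} {u} l∈ u∈ = go l∈
      where
      go : l ∈ left ++ right → l ~ u → ⊥
      go = λ where
        (here refl) e → exhibit _ _ refl (uS u∈) ((0 , 9) ∷ bowtieAtoms) 8765432109 refl (e ∷ h)
        (there (here refl)) e → exhibit _ _ refl (uS u∈) ((1 , 9) ∷ bowtieAtoms) 8765432019 refl (e ∷ h)
        (there (there (here refl))) e → exhibit _ _ refl (uS u∈) ((2 , 9) ∷ bowtieAtoms) 8765431029 refl (e ∷ h)
        (there (there (there (here refl)))) e → exhibit _ _ refl (uS u∈) ((3 , 9) ∷ bowtieAtoms) 8765421039 refl (e ∷ h)
        (there (there (there (there (here refl))))) e → exhibit _ _ refl (uS u∈) ((5 , 9) ∷ bowtieAtoms) 3210487659 refl (e ∷ h)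
        (there (there (there (there (there (here refl)))))) e → exhibit _ _ refl (uS u∈) ((6 , 9) ∷ bowtieAtoms) 3210487569 refl (e ∷ h)
        (there (there (there (there (there (there (here refl))))))) e → exhibit _ _ refl (uS u∈) ((7 , 9) ∷ bowtieAtoms) 3210486579 refl (e ∷ h)
        (there (there (there (there (there (there (there (here refl)))))))) e → exhibit _ _ refl (uS u∈) ((8 , 9) ∷ bowtieAtoms) 3210476589 refl (e ∷ h)

    -- Together with such an edge, `l` and all of `right` would form a P₅, and `w`, the centre and
    -- the rest of `left` another.
    apart : ∀ {l r} → l ∈ left → r ∈ right → ¬ l ~ r
    apart = λ where
      (here refl) (here refl) e → exhibit _ _ refl (uS w∈) ((0 , 5) ∷ (4 , 9) ∷ bowtieAtoms) 8765032149 refl (e ∷ vw ∷ h)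
      (here refl) (there (here refl)) e → exhibit _ _ refl (uS w∈) ((0 , 6) ∷ (4 , 9) ∷ bowtieAtoms) 8756032149 refl (e ∷ vw ∷ h)
      (here refl) (there (there (here refl))) e → exhibit _ _ refl (uS w∈) ((0 , 7) ∷ (4 , 9) ∷ bowtieAtoms) 8657032149 refl (e ∷ vw ∷ h)
      (here refl) (there (there (there (here refl)))) e → exhibit _ _ refl (uS w∈) ((0 , 8) ∷ (4 , 9) ∷ bowtieAtoms) 7658032149 refl (e ∷ vw ∷ h)
      (there (here refl)) (here refl) e → exhibit _ _ refl (uS w∈) ((1 , 5) ∷ (4 , 9) ∷ bowtieAtoms) 8765132049 refl (e ∷ vw ∷ h)
      (there (here refl)) (there (here refl)) e → exhibit _ _ refl (uS w∈) ((1 , 6) ∷ (4 , 9) ∷ bowtieAtoms) 8756132049 refl (e ∷ vw ∷ h)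
      (there (here refl)) (there (there (here refl))) e → exhibit _ _ refl (uS w∈) ((1 , 7) ∷ (4 , 9) ∷ bowtieAtoms) 8657132049 refl (e ∷ vw ∷ h)
      (there (here refl)) (there (there (there (here refl)))) e → exhibit _ _ refl (uS w∈) ((1 , 8) ∷ (4 , 9) ∷ bowtieAtoms) 7658132049 refl (e ∷ vw ∷ h)
      (there (there (here refl))) (here refl) e → exhibit _ _ refl (uS w∈) ((2 , 5) ∷ (4 , 9) ∷ bowtieAtoms) 8765231049 refl (e ∷ vw ∷ h)
      (there (there (here refl))) (there (here refl)) e → exhibit _ _ refl (uS w∈) ((2 , 6) ∷ (4 , 9) ∷ bowtieAtoms) 8756231049 refl (e ∷ vw ∷ h)
      (there (there (here refl))) (there (there (here refl))) e → exhibit _ _ refl (uS w∈) ((2 , 7) ∷ (4 , 9) ∷ bowtieAtoms) 8657231049 refl (e ∷ vw ∷ h)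
      (there (there (here refl))) (there (there (there (here refl)))) e → exhibit _ _ refl (uS w∈) ((2 , 8) ∷ (4 , 9) ∷ bowtieAtoms) 7658231049 refl (e ∷ vw ∷ h)
      (there (there (there (here refl)))) (here refl) e → exhibit _ _ refl (uS w∈) ((3 , 5) ∷ (4 , 9) ∷ bowtieAtoms) 8765321049 refl (e ∷ vw ∷ h)
      (there (there (there (here refl)))) (there (here refl)) e → exhibit _ _ refl (uS w∈) ((3 , 6) ∷ (4 , 9) ∷ bowtieAtoms) 8756321049 refl (e ∷ vw ∷ h)
      (there (there (there (here refl)))) (there (there (here refl))) e → exhibit _ _ refl (uS w∈) ((3 , 7) ∷ (4 , 9) ∷ bowtieAtoms) 8657321049 refl (e ∷ vw ∷ h)
      (there (there (there (here refl)))) (there (there (there (here refl)))) e → exhibit _ _ refl (uS w∈) ((3 , 8) ∷ (4 , 9) ∷ bowtieAtoms) 7658321049 refl (e ∷ vw ∷ h)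

    -- Two K₅ sharing a vertex have 20 edges, and only the shared vertex can have neighbours in `S`.
    bowtie-size : size (p ++ S) ≤ 20 + length S + size S
    bowtie-size = ≤-trans (≤-reflexive (size-++ p S)) (+-monoˡ-≤ (size S) (+-mono-≤ inner outer))
      where
      inner : size p ≤ 20
      inner = ≤-trans (≤-reflexive (size-++ left (v₄ ∷ right))) (+-mono-≤ (+-mono-≤ (size≤triangle left)
        (≤-trans (≤-reflexive (≡.trans (cross-∷ʳ left v₄ right) (≡.trans (cong (deg v₄ left +_) (zero-cross {left} {right} apart)) (+-identityʳ _))))
          (deg≤length v₄ left))) (size≤triangle (v₄ ∷ right)))
      outer : cross p S ≤ length S
      outer = ≤-trans (≤-reflexive (≡.trans (cross-++ˡ left (v₄ ∷ right) S)
        (cong₂ _+_ (zero-cross {left} {S} λ l∈ → outside (∈-++⁺ˡ l∈))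
          (≡.trans (cong (deg v₄ S +_) (zero-cross {right} {S} λ r∈ → outside (∈-++⁺ʳ left r∈))) (+-identityʳ _)))))
        (deg≤length v₄ S)

  -- An outside neighbour, tried at each of the nine positions, forces two disjoint P₅ or the
  -- bowtie. Minimum degree four is known only inside `Q`, so a rerouted path is lengthened into
  -- `W`, whereas the attached vertex may be any vertex of `S`.
  ninePath : ∀ {L Q p S W} → Unique L → Dense Q → length p ≡ 9 → Path p → L ↭ p ++ S → Q ↭ p ++ W →
             (∀ {v} → v ∈ W → v ∈ S) →
             cross p S ≡ 0 ⊎ size L ≤ 20 + length S + size S
  ninePath {L} {Q} {p@(v₀ ∷ v₁ ∷ v₂ ∷ v₃ ∷ v₄ ∷ v₅ ∷ v₆ ∷ v₇ ∷ v₈ ∷ [])} {S} {W} u dense refl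
    (e₀ ∷ e₁ ∷ e₂ ∷ e₃ ∷ e₄ ∷ e₅ ∷ e₆ ∷ e₇ ∷ [-]) pS pW W⊆S with cross p S in eq
  ... | zero = inj₁ refl
  ... | suc _ = let v , w , v∈ , w∈ , e = cross>0⇒ p S (≤-trans z<s (≤-reflexive (sym eq)))
                in inj₂ (attached w∈ v∈ e)
    where
    upS : Unique (p ++ S)
    upS = Unique-↭ pS u
    uS : ∀ {w} → w ∈ S → Unique (p ++ [ w ])
    uS w∈ = Unique-sub p upS ([] ∷ []) (w∈ ∷ [])

    attached : ∀ {w v} → w ∈ S → v ∈ p → v ~ w → size L ≤ 20 + length S + size S
    attached {w} w∈ v∈ e = go v∈ e
      where
      xs : List V
      xs = v₁ ∷ v₂ ∷ v₃ ∷ v₄ ∷ v₅ ∷ v₆ ∷ v₇ ∷ v₈ ∷ w ∷ []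
      open Labelled v₀ xs
      open Refute nineOk nineReq nineLim nineBnd
      h₀ : Holds (chain (upTo 9))
      h₀ = e₀ ∷ e₁ ∷ e₂ ∷ e₃ ∷ e₄ ∷ e₅ ∷ e₆ ∷ e₇ ∷ []

      conclude : Cases.Outcome nineOk nineReq nineLim nineBnd val → size L ≤ 20 + length S + size S
      conclude (bowtie , _ , vw ∷ h , _) = ≤-trans (≤-reflexive (size-↭ pS)) (Bowtie.bowtie-size upS w∈ vw h)
      conclude (ham c , o , h , lt) = ⊥-elim (escape (deg>0⇒ (at d) W
          (leaves-path p dense pW d∈ (≤-trans (s≤s (≤-reflexive (sym (count-star d (upTo 9))))) lt))))
        where
        d : ℕ
        d = c % 10
        ds : List ℕ
        ds = digits 9 c
        ds⊆p : All (_∈ p) (map at ds)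
        ds⊆p = Allₚ.map⁺ (All.map (λ {i} → nth-∈-++ˡ v₀ (v₁ ∷ v₂ ∷ v₃ ∷ v₄ ∷ v₅ ∷ v₆ ∷ v₇ ∷ v₈ ∷ []) {[ w ]} i) (distinctBelow⇒< 9 ds o))
        d∈ : at d ∈ p
        d∈ = All.head ds⊆p
        escape : (∃ λ u → u ∈ W × at d ~ u) → ⊥
        escape (u , u∈ , e) = free (u ∷ map at (take 4 ds)) (map at (drop 4 ds)) refl refl
          (All.tabulate (λ v∈ u≡v → disjoint-++ p upS (All.lookup ds⊆p v∈) (W⊆S u∈) (sym u≡v))
            ∷ distinct⇒Unique (uS w∈) 9 (n≤1+n 9) ds o)
          (~-sym e ∷ Path-++ˡ (map at (take 4 ds)) (chain⇒Path ds h))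
          (Path-++ʳ (map at (take 4 ds)) (chain⇒Path ds h))

      run : (t : Tree (ℕ ⊎ NineLeaf)) (T : List Atom) → check T [] t ≡ true → Holds T → size L ≤ 20 + length S + size S
      run t T chk hT = conclude (refute v₀ xs refl (uS w∈) T t chk hT)

      go : ∀ {v} → v ∈ p → v ~ w → size L ≤ 20 + length S + size S
      go = λ where
        (here refl) e → run (nineTree 0) ((0 , 9) ∷ chain (upTo 9)) refl (e ∷ h₀)
        (there (here refl)) e → run (nineTree 1) ((1 , 9) ∷ chain (upTo 9)) refl (e ∷ h₀)
        (there (there (here refl))) e → run (nineTree 2) ((2 , 9) ∷ chain (upTo 9)) refl (e ∷ h₀)
        (there (there (there (here refl)))) e → run (nineTree 3) ((3 , 9) ∷ chain (upTo 9)) refl (e ∷ h₀)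
        (there (there (there (there (here refl))))) e → run (nineTree 4) ((4 , 9) ∷ chain (upTo 9)) refl (e ∷ h₀)
        (there (there (there (there (there (here refl)))))) e → run (nineTree 5) ((5 , 9) ∷ chain (upTo 9)) refl (e ∷ h₀)
        (there (there (there (there (there (there (here refl))))))) e → run (nineTree 6) ((6 , 9) ∷ chain (upTo 9)) refl (e ∷ h₀)
        (there (there (there (there (there (there (there (here refl)))))))) e → run (nineTree 7) ((7 , 9) ∷ chain (upTo 9)) refl (e ∷ h₀)
        (there (there (there (there (there (there (there (there (here refl))))))))) e → run (nineTree 8) ((8 , 9) ∷ chain (upTo 9)) refl (e ∷ h₀)

-- A leaf "miss i" says that vertex i has fewer than four neighbours among the first k.
pattern hit c = leaf (inj₁ c)
pattern miss i = leaf (inj₂ i)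

module Few (k : ℕ) where

  ok : ℕ → Bool
  ok i = i <ᵇ k

  req lim : ℕ → List Atom
  req i = []
  lim i = star i (upTo k)

  bnd : ℕ → ℕ
  bnd i = 4

-- Here `hit c` names a single P₅, on positions 2 to 6. Degree at least 4 among seven vertices
-- leaves degree at least 2 among these five, enough for a Hamiltonian path.
p5Tree : Tree (ℕ ⊎ ℕ)
p5Tree =
  split 2 3 (split 2 4 (split 3 5 (split 4 6 (hit 64235) (split 5 6 (hit 65324) (split 2 6 (split 3 4 (hit
  62435) (split 4 5 (hit 62453) (miss 4))) (miss 6)))) (split 3 6 (split 4 5 (hit 63245) (split 5 6 (hit
  56324) (miss 5))) (split 3 4 (split 2 5 (split 4 6 (hit 64325) (split 5 6 (hit 65243) (miss 6))) (split 4
  5 (split 5 6 (hit 65432) (miss 5)) (miss 5))) (miss 3)))) (split 2 5 (split 4 6 (split 3 4 (hit 64325)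
  (split 4 5 (hit 64523) (miss 4))) (split 3 4 (split 4 5 (split 2 6 (hit 62543) (split 3 6 (hit 63452)
  (miss 6))) (miss 4)) (miss 4))) (split 2 6 (split 3 4 (split 4 5 (hit 62345) (split 5 6 (hit 56234) (miss
  5))) (split 4 5 (split 4 6 (hit 54623) (miss 4)) (miss 4))) (miss 2)))) (split 2 4 (split 2 5 (split 3 6
  (split 3 4 (hit 63425) (split 3 5 (hit 63524) (miss 3))) (split 3 4 (split 3 5 (split 2 6 (hit 62534)
  (split 4 6 (hit 64352) (miss 6))) (miss 3)) (miss 3))) (split 2 6 (split 3 4 (split 3 5 (hit 62435)
  (split 5 6 (hit 56243) (miss 5))) (split 3 5 (split 3 6 (hit 53624) (miss 3)) (miss 3))) (miss 2)))
  (split 2 5 (split 2 6 (split 3 4 (split 3 5 (hit 62534) (split 3 6 (hit 52634) (miss 3))) (split 3 5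
  (split 4 6 (hit 46253) (miss 4)) (miss 3))) (miss 2)) (miss 2)))

-- Positions 0 to 7 are a Hamiltonian cycle of the core in cyclic order; vertex 8 is attached to 0
-- and vertex 9 to the argument.
eightTree : ℕ → Tree (ℕ ⊎ ℕ)
eightTree 1 =
  hit 8076591234
eightTree 2 =
  hit 9210876543
eightTree 3 =
  split 1 4 (hit 8076593412) (split 1 7 (hit 9345680712) (split 1 6 (split 2 7 (hit 9345680721) (split 3 7
  (hit 4561280739) (split 4 7 (hit 9321680745) (miss 7)))) (split 1 5 (split 0 4 (hit 7651293408) (split 2
  4 (hit 8076593421) (split 4 6 (hit 9321580764) (miss 4)))) (miss 1))))
eightTree 4 =
  hit 8076594321
eightTree 5 =
  split 1 6 (hit 9543280761) (split 1 7 (hit 9543267108) (split 1 3 (split 2 6 (hit 9543180762) (split 4 6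
  (hit 8012376459) (split 3 6 (split 0 4 (hit 7632195408) (split 1 4 (hit 8076395412) (split 2 4 (hit
  8076395421) (miss 4)))) (miss 6)))) (split 1 4 (split 1 5 (split 2 6 (hit 9514380762) (split 3 6 (hit
  9541280763) (split 4 6 (hit 8012376459) (miss 6)))) (miss 1)) (miss 1))))
eightTree 6 =
  hit 9670854321
eightTree 7 =
  hit 9765480123
eightTree _ = miss 0

data Pairing : Set where
  p₃₄ p₃₅ p₃₆ : Pairing

pattern few₇ i = leaf (inj₂ (inj₁ i))
pattern paired π = leaf (inj₂ (inj₂ π))

hubAtoms : ℕ → ℕ → ℕ → ℕ → List Atom
hubAtoms a b c d = (a , b) ∷ (c , d) ∷ (0 , a) ∷ (0 , b) ∷ (0 , c) ∷ (0 , d) ∷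
  (1 , a) ∷ (1 , b) ∷ (1 , c) ∷ (1 , d) ∷ (2 , a) ∷ (2 , b) ∷ (2 , c) ∷ (2 , d) ∷ []

pairAtoms : Pairing → List Atom
pairAtoms p₃₄ = hubAtoms 3 4 5 6
pairAtoms p₃₅ = hubAtoms 3 5 4 6
pairAtoms p₃₆ = hubAtoms 3 6 4 5

-- Vertices 7, 8, 9 are matched to 0, 1, 2; the exceptional leaves say that 0, 1, 2 are joined
-- to two disjoint edges on 3, 4, 5, 6.
sevenTree : Tree (ℕ ⊎ (ℕ ⊎ Pairing))
sevenTree =
  split 0 4 (split 4 6 (split 4 5 (split 1 4 (split 5 6 (split 3 6 (split 2 3 (hit 8140756329) (split 2 5
  (hit 8140736529) (split 2 4 (split 1 5 (hit 9240736518) (split 0 5 (hit 9241836507) (few₇ 5))) (few₇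
  2)))) (split 2 6 (split 3 5 (hit 8140792653) (split 2 3 (split 1 3 (hit 7046592318) (few₇ 3)) (few₇ 3)))
  (split 1 6 (split 0 6 (split 2 3 (split 3 4 (hit 8160754329) (split 3 5 (hit 8160745329) (few₇ 3)))
  (split 3 4 (split 2 5 (hit 8160734529) (few₇ 2)) (few₇ 3))) (few₇ 6)) (few₇ 6)))) (split 3 6 (split 2 6
  (split 3 5 (hit 8140753629) (split 2 5 (split 1 5 (hit 7046392518) (few₇ 5)) (few₇ 5))) (split 1 6 (split
  2 5 (split 1 5 (hit 7046392518) (split 3 5 (hit 8140792536) (few₇ 5))) (split 3 5 (split 2 4 (hit
  8163570429) (few₇ 2)) (few₇ 5))) (few₇ 6))) (split 2 6 (split 0 6 (split 1 6 (split 3 5 (hit 9260781453)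
  (split 0 5 (split 3 4 (hit 9261870543) (few₇ 3)) (few₇ 5))) (few₇ 6)) (few₇ 6)) (few₇ 6)))) (split 3 4
  (split 1 3 (split 1 6 (split 2 6 (split 0 6 (hit 8134592607) (split 0 5 (hit 9261834507) (split 0 3 (hit
  9264581307) (few₇ 0)))) (split 0 6 (split 2 3 (hit 7064581329) (split 2 5 (hit 8160734529) (few₇ 2)))
  (split 5 6 (split 3 6 (split 2 4 (hit 8136570429) (split 2 3 (hit 7046581329) (few₇ 2))) (few₇ 6)) (few₇
  6)))) (split 1 5 (split 0 6 (split 2 3 (hit 7064581329) (split 2 6 (hit 8154370629) (split 2 5 (hit
  7064381529) (few₇ 2)))) (split 2 6 (split 0 5 (hit 9264381507) (split 0 3 (hit 9264581307) (few₇ 0)))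
  (few₇ 6))) (few₇ 1))) (split 1 5 (split 1 6 (split 2 3 (split 0 6 (hit 9234581607) (split 0 5 (hit
  9234681507) (split 0 3 (hit 8164592307) (few₇ 0)))) (split 0 3 (split 2 6 (hit 7034581629) (split 2 5
  (hit 7034681529) (few₇ 2))) (few₇ 3))) (few₇ 1)) (few₇ 1))) (split 1 3 (split 2 3 (split 5 6 (hit
  9231870465) (split 0 6 (hit 9231854607) (split 2 6 (split 0 5 (hit 9231864507) (split 0 3 (hit
  9264581307) (few₇ 0))) (few₇ 6)))) (split 0 3 (split 2 6 (hit 8130754629) (split 2 5 (hit 8130764529)
  (few₇ 2))) (few₇ 3))) (split 2 3 (split 0 3 (split 1 6 (hit 9230754618) (few₇ 1)) (few₇ 3)) (few₇ 3)))))
  (split 3 4 (split 0 5 (split 1 5 (split 2 3 (hit 8150764329) (split 2 6 (hit 8150734629) (split 2 5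
  (split 1 6 (hit 9250734618) (split 3 6 (hit 9251870463) (few₇ 6))) (few₇ 2)))) (split 2 5 (split 1 6 (hit
  9250734618) (split 1 3 (hit 9250764318) (few₇ 1))) (few₇ 5))) (split 1 5 (split 2 5 (split 0 6 (hit
  9251834607) (split 0 3 (hit 9251864307) (few₇ 0))) (few₇ 5)) (few₇ 5))) (split 2 4 (split 1 4 (split 3 5
  (split 3 6 (split 1 6 (hit 9240753618) (split 2 6 (hit 8140753629) (split 0 6 (hit 9241853607) (few₇
  6)))) (split 0 3 (split 1 3 (split 2 3 (split 5 6 (hit 9241865307) (split 1 6 (split 0 6 (split 2 6
  (split 1 5 (split 0 5 (split 2 5 (paired p₃₅) (few₇ 5)) (few₇ 5)) (few₇ 5)) (few₇ 6)) (few₇ 6)) (few₇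
  6))) (few₇ 3)) (few₇ 3)) (few₇ 3))) (split 0 3 (split 2 3 (split 5 6 (hit 9230781465) (few₇ 5)) (few₇ 3))
  (few₇ 3))) (few₇ 4)) (few₇ 4)))) (split 3 4 (split 4 5 (split 2 6 (split 1 6 (split 3 5 (hit 9261870453)
  (split 0 3 (hit 9261854307) (split 2 3 (split 0 6 (hit 9234581607) (split 0 5 (hit 9261834507) (few₇ 0)))
  (few₇ 3)))) (split 0 6 (split 1 5 (hit 9260734518) (split 1 3 (hit 9260754318) (few₇ 1))) (few₇ 6)))
  (split 0 6 (split 1 6 (split 2 3 (hit 8160754329) (split 2 5 (hit 8160734529) (few₇ 2))) (few₇ 6)) (few₇
  6))) (split 1 4 (split 2 4 (split 3 6 (split 5 6 (split 1 3 (hit 9240756318) (split 2 3 (hit 8140756329)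
  (split 0 3 (hit 9241856307) (few₇ 3)))) (split 1 6 (split 3 5 (hit 9240753618) (few₇ 5)) (few₇ 6)))
  (split 1 6 (split 2 6 (split 0 6 (split 5 6 (split 3 5 (hit 9261853407) (split 0 3 (split 2 3 (split 1 3
  (split 2 5 (split 0 5 (split 1 5 (paired p₃₄) (few₇ 5)) (few₇ 5)) (few₇ 5)) (few₇ 3)) (few₇ 3)) (few₇
  3))) (few₇ 6)) (few₇ 6)) (few₇ 6)) (few₇ 6))) (few₇ 4)) (few₇ 4))) (split 4 5 (split 2 4 (split 1 4
  (split 1 6 (split 3 6 (split 3 5 (hit 9240753618) (split 2 3 (split 5 6 (hit 8140792365) (split 0 6
  (split 2 6 (split 0 3 (split 1 3 (split 1 5 (split 0 5 (split 2 5 (paired p₃₆) (few₇ 5)) (few₇ 5)) (few₇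
  5)) (few₇ 3)) (few₇ 3)) (few₇ 6)) (few₇ 6))) (few₇ 3))) (split 2 6 (split 3 5 (hit 9261870453) (few₇ 3))
  (few₇ 6))) (split 5 6 (split 3 6 (split 1 3 (hit 9240756318) (split 2 3 (hit 8140756329) (few₇ 3))) (few₇
  6)) (few₇ 6))) (few₇ 4)) (few₇ 4)) (few₇ 4)))) (split 4 6 (split 2 4 (split 4 5 (split 3 4 (split 0 3
  (split 0 5 (split 1 3 (split 2 3 (hit 7054681329) (split 2 6 (hit 8130754629) (split 2 5 (hit 8134670529)
  (few₇ 2)))) (split 2 3 (split 1 6 (hit 9230754618) (split 1 5 (hit 9234670518) (few₇ 1))) (split 3 6
  (split 3 5 (split 1 4 (hit 7053692418) (split 1 5 (hit 9246370518) (few₇ 1))) (few₇ 3)) (few₇ 3))))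
  (split 0 6 (split 1 5 (split 2 3 (hit 8154670329) (split 2 6 (hit 8154370629) (split 2 5 (hit 7064381529)
  (few₇ 2)))) (split 2 5 (split 1 6 (hit 9254370618) (split 1 3 (hit 9254670318) (few₇ 1))) (few₇ 5)))
  (few₇ 0))) (split 0 6 (split 0 5 (split 1 3 (split 2 3 (hit 7064581329) (split 2 6 (hit 8134570629)
  (split 2 5 (hit 8134670529) (few₇ 2)))) (split 2 3 (split 1 6 (hit 9234570618) (split 1 5 (hit
  9234670518) (few₇ 1))) (few₇ 3))) (few₇ 0)) (few₇ 0))) (split 1 4 (split 1 3 (split 2 3 (split 0 6 (hit
  9231854607) (split 0 5 (hit 9231864507) (few₇ 0))) (split 0 3 (split 2 6 (hit 8130754629) (split 2 5 (hit
  8130764529) (few₇ 2))) (few₇ 3))) (split 3 5 (split 3 6 (split 0 6 (hit 9241853607) (split 0 5 (hit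
  9241863507) (few₇ 0))) (few₇ 3)) (few₇ 3))) (few₇ 4))) (split 3 4 (split 1 4 (split 0 3 (split 0 5 (split
  1 5 (split 2 3 (hit 8150764329) (split 2 6 (hit 8150734629) (split 2 5 (hit 7034681529) (few₇ 2))))
  (split 5 6 (split 3 5 (hit 9241865307) (few₇ 5)) (few₇ 5))) (split 0 6 (split 5 6 (split 3 5 (hit
  9241870653) (few₇ 5)) (few₇ 5)) (few₇ 0))) (split 0 5 (split 0 6 (split 3 5 (split 1 6 (hit 9243570618)
  (split 3 6 (hit 9241870635) (split 5 6 (hit 9241870653) (few₇ 6)))) (split 3 6 (split 2 5 (hit
  8146370529) (few₇ 5)) (few₇ 3))) (few₇ 0)) (few₇ 0))) (few₇ 4)) (few₇ 4))) (split 3 4 (split 4 5 (split 2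
  6 (split 2 3 (split 0 5 (split 1 6 (hit 7054392618) (split 1 5 (hit 9264370518) (split 1 3 (hit
  7054692318) (few₇ 1)))) (split 0 3 (split 1 6 (hit 7034592618) (split 1 5 (hit 9230764518) (split 1 3
  (hit 9264570318) (few₇ 1)))) (few₇ 0))) (split 2 5 (split 1 3 (split 0 6 (hit 8134592607) (split 0 5 (hit
  8134692507) (few₇ 0))) (split 0 3 (split 1 6 (hit 7034592618) (split 1 5 (hit 7034692518) (few₇ 1)))
  (few₇ 3))) (few₇ 2))) (split 2 3 (split 2 5 (split 1 6 (split 0 6 (hit 9254381607) (split 0 5 (hit
  8164392507) (few₇ 0))) (split 0 6 (split 1 5 (hit 7064392518) (split 1 3 (hit 7064592318) (few₇ 1)))
  (few₇ 6))) (few₇ 2)) (few₇ 2))) (few₇ 4)) (few₇ 4))) (split 4 5 (split 3 4 (split 1 6 (split 2 6 (split 0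
  5 (hit 9261834507) (split 0 3 (hit 9261854307) (few₇ 0))) (split 0 6 (split 2 3 (hit 8160754329) (split 2
  5 (hit 8160734529) (few₇ 2))) (few₇ 6))) (split 2 6 (split 0 6 (split 1 5 (hit 9260734518) (split 1 3
  (hit 9260754318) (few₇ 1))) (few₇ 6)) (few₇ 6))) (few₇ 4)) (few₇ 4)))

-- Matchings between the core and the peeled vertices

module Matchings {n} (G : Graph n) (free : Paths.No2P5 G) where

  open Embedding G free
  open P5Free G
  open Cores G

  few-contra : ∀ {x xs Q k i} → Dense Q → (let open Labelled x xs) → map at (upTo k) ≡ Q → at i ∈ Q →
               count val (star i (upTo k)) < 4 → ⊥
  few-contra {x} {xs} {Q} {k} {i} dense eq i∈ lt = <⇒≱ lt (≤-trans (dense i∈)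
    (≤-reflexive (sym (≡.trans (Labelled.count-star x xs i (upTo k)) (cong (deg _) eq)))))

  at-∈ : ∀ x xs k i → i < k → nth x xs i ∈ map (nth x xs) (upTo k)
  at-∈ x xs k i lt = ∈-map⁺ (nth x xs) (∈-upTo⁺ lt)

  denseRefute : ∀ {Q} k x xs → length xs ≡ 9 → Unique (x ∷ xs) → Dense Q → (let open Labelled x xs) → map at (upTo k) ≡ Q →
                (T : List Atom) (t : Tree (ℕ ⊎ ℕ)) → (let open Few k) →
                Refute.check ok req lim bnd T [] t ≡ true → Holds T → ⊥
  denseRefute k x xs len u dense refl T t chk h =
    let open Few k
        i , o , _ , lt = Refute.refute ok req lim bnd x xs len u T t chk h
    in few-contra {x} {xs} {k = k} dense refl (at-∈ x xs k i (<ᵇ-true i k o)) lt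

  -- M and X are the two sides of a maximal matching between T and Q = X ++ Y.
  coverBound : ∀ {L T Q X Y M T′} → L ↭ T ++ Q → Unique L → Q ↭ X ++ Y → T ↭ M ++ T′ → cross T′ Y ≡ 0 →
               All (λ t → deg t Y ≤ 2) M → PathIn Y 5 → size L ≤ size Q + (length M * 2 + g (length X + length T))
  coverBound {L} {T} {Q} {X} {Y} {M} {T′} pL u pQ pT none low (p , Z , lp , pp , pY) = begin
    size L                                                       ≡⟨ ≡.trans (size-↭ pL) (size-++ T Q) ⟩
    size T + cross T Q + size Q                                  ≡⟨ cong (λ c → size T + c + size Q) eq ⟩
    size T + (cross X T + cross M Y) + size Q                    ≡⟨ rearrange (size T) (cross X T) (cross M Y) (size Q) ⟩
    size Q + (cross M Y + (cross X T + size T))                  ≤⟨ +-monoʳ-≤ (size Q) (+-mono-≤ (cross≤ 2 M Y low) most) ⟩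
    size Q + (length M * 2 + g (length X + length T))            ∎
    where
    open ≤-Reasoning
    rearrange : ∀ a b c d → a + (b + c) + d ≡ d + (c + (b + a))
    rearrange = solve-∀
    eq : cross T Q ≡ cross X T + cross M Y
    eq = ≡.trans (cross-↭ʳ T pQ) (≡.trans (cross-++ʳ T X Y) (cong₂ _+_ (cross-sym T X)
      (≡.trans (cross-↭ˡ Y pT) (≡.trans (cross-++ˡ M T′ Y) (≡.trans (cong (cross M Y +_) none) (+-identityʳ _))))))
    uYXT : Unique (p ++ (Z ++ X ++ T))
    uYXT = subst Unique (++-assoc p Z (X ++ T)) (Unique-↭ (↭-trans pL (↭-trans (++-comm T Q)
      (↭-trans (++⁺ʳ T (↭-trans pQ (↭-trans (++-comm X Y) (++⁺ʳ X pY)))) (↭-reflexive (++-assoc (p ++ Z) X T))))) u)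
    -- `Y` contains a P₅, so `X ++ T` is P₅-free, and one application of `g` covers the edges inside
    -- `T` and those from `T` to `X` together.
    most : cross X T + size T ≤ g (length X + length T)
    most = ≤-trans (≤-trans (m≤n+m _ (size X)) (≤-reflexive (sym (≡.trans (size-++ X T) (+-assoc (size X) _ _)))))
      (≤-trans (NoP5⇒size≤g (Unique-++ʳ Z (Unique-++ʳ p uYXT))
        (NoP5-⊆ (∈-++⁺ʳ Z) (No2P5⇒NoP5 free {p} lp pp uYXT))) (≤-reflexive (cong g (length-++ X))))

  deg-∷-≤ : ∀ {t x Y k} → t ~ x → deg t (x ∷ Y) ≤ suc k → deg t Y ≤ k
  deg-∷-≤ {t} {x} {Y} e le rewrite e = ≤-pred le

  -- Core on eight vertices

  -- Two disjoint edges leaving the core are refuted by `eightTree`. With a maximal matching of one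
  -- edge there are at most 28 edges in the core, 2 more from the matched vertex, and
  -- `g (2 + m) ≤ 5 + g m` for the rest: 35, one fewer than K₉ contributes.
  eight : ∀ {L T Q C m} → L ↭ T ++ Q → Unique L → Peel Q T → Dense Q → Q ↭ C → Cycle C → length C ≡ 8 →
          length T ≡ 1 + m → size L ≤ 35 + g m
  eight {L} {T} {Q} {C} {m} pL u peel dense pC cyc lC lT = first (cross T C) refl
    where
    sizeQ : size Q ≤ 28
    sizeQ = ≤-trans (size≤triangle Q) (≤-reflexive (cong triangle (≡.trans (↭-length pC) lC)))
    uQ : Unique (T ++ Q)
    uQ = Unique-↭ pL u
    second : ∀ {t x D T′} → T ↭ t ∷ T′ → C ↭ x ∷ D → Cycle (x ∷ D) → t ~ x → length D ≡ 7 → ∀ c → cross T′ D ≡ c → size L ≤ 35 + g m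
    second {t} {x} {D@(d₁ ∷ d₂ ∷ d₃ ∷ d₄ ∷ d₅ ∷ d₆ ∷ d₇ ∷ [])} {T′} pT pD cyc′ e refl zero none = begin
      size L                               ≤⟨ coverBound {X = [ x ]} pL u (↭-trans pC pD) pT none
                                                (deg-∷-≤ {Y = D} e (≤-trans (≤-reflexive (sym (deg-↭ t (↭-trans pC pD)))) (All.head (All-resp-↭ pT (Peel-deg peel)))) ∷ [])
                                                (take 5 D , drop 5 D , refl , Path-++ˡ (take 5 D) (Path-tail (Path-++ˡ (x ∷ D) cyc′)) , ↭-refl) ⟩
      size Q + (2 + g (1 + length T))      ≡⟨ cong (λ l → size Q + (2 + g (1 + l))) lT ⟩
      size Q + (2 + g (2 + m))             ≤⟨ +-mono-≤ sizeQ (+-monoʳ-≤ 2 (g-2+ m)) ⟩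
      35 + g m                             ∎
      where open ≤-Reasoning
    second {t} {x} {D@(d₁ ∷ d₂ ∷ d₃ ∷ d₄ ∷ d₅ ∷ d₆ ∷ d₇ ∷ [])} {T′} pT pD (c₀ ∷ c₁ ∷ c₂ ∷ c₃ ∷ c₄ ∷ c₅ ∷ c₆ ∷ c₇ ∷ [-]) e refl (suc c) some =
      let t′ , y , t′∈ , y∈ , e′ = cross>0⇒ T′ D (≤-trans z<s (≤-reflexive (sym some))) in ⊥-elim (third t′∈ y∈ e′)
      where
      denseC : Dense (x ∷ D)
      denseC {v} v∈ = ≤-trans (dense (∈-resp-↭ (↭-sym (↭-trans pC pD)) v∈)) (≤-reflexive (deg-↭ v (↭-trans pC pD)))
      uu : Unique ((x ∷ D) ++ (t ∷ T′))
      uu = Unique-↭ (↭-trans (++-comm T Q) (++⁺ (↭-trans pC pD) pT)) uQ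
      third : ∀ {t′ y} → t′ ∈ T′ → y ∈ D → t′ ~ y → ⊥
      third {t′} t′∈ y∈ e′ = go y∈ e′
        where
        xs : List V
        xs = D ++ t ∷ t′ ∷ []
        open Labelled x xs
        uxs : Unique (x ∷ xs)
        uxs = Unique-sub (x ∷ D) uu (All.tabulate (λ { (here refl) refl → Unique-head (Unique-++ʳ (x ∷ D) uu) t′∈ }) ∷ [] ∷ []) (here refl ∷ there t′∈ ∷ [])
        run : ∀ i → (let T₀ = (i , 9) ∷ (0 , 8) ∷ (0 , 7) ∷ chain (upTo 8)) →
              Refute.check (Few.ok 8) (Few.req 8) (Few.lim 8) (Few.bnd 8) T₀ [] (eightTree i) ≡ true →
              at i ~ t′ → ⊥
        run i chk e′ = denseRefute 8 x xs refl uxs denseC refl _ (eightTree i) chk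
          (e′ ∷ ~-sym e ∷ ~-sym c₇ ∷ c₀ ∷ c₁ ∷ c₂ ∷ c₃ ∷ c₄ ∷ c₅ ∷ c₆ ∷ [])
        go : ∀ {y} → y ∈ D → t′ ~ y → ⊥
        go (here refl) e = run 1 refl (~-sym e)
        go (there (here refl)) e = run 2 refl (~-sym e)
        go (there (there (here refl))) e = run 3 refl (~-sym e)
        go (there (there (there (here refl)))) e = run 4 refl (~-sym e)
        go (there (there (there (there (here refl))))) e = run 5 refl (~-sym e)
        go (there (there (there (there (there (here refl)))))) e = run 6 refl (~-sym e)
        go (there (there (there (there (there (there (here refl))))))) e = run 7 refl (~-sym e)

    first : ∀ c → cross T C ≡ c → size L ≤ 35 + g m
    first zero none = begin
      size L                               ≤⟨ coverBound {X = []} {M = []} pL u pC ↭-refl none [] (P5 C lC cyc) ⟩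
      size Q + g (length T)                ≡⟨ cong (λ l → size Q + g l) lT ⟩
      size Q + g (1 + m)                   ≤⟨ +-mono-≤ sizeQ (g-1+ m) ⟩
      31 + g m                             ≤⟨ m≤n+m _ 4 ⟩
      35 + g m                             ∎
      where
      open ≤-Reasoning
      P5 : ∀ C → length C ≡ 8 → Cycle C → PathIn C 5
      P5 C@(_ ∷ _ ∷ _ ∷ _ ∷ _ ∷ _ ∷ _ ∷ _ ∷ []) refl cyc = take 5 C , drop 5 C , refl , Path-++ˡ (take 5 C) (Path-++ˡ C cyc) , ↭-refl
    first (suc c) some =
      let t , x , t∈ , x∈ , e = cross>0⇒ T C (≤-trans z<s (≤-reflexive (sym some)))
          T′ , pT = extract t∈
          D , pD , cyc′ = rotate cyc x∈
      in second pT pD cyc′ e (suc-injective (≡.trans (sym (↭-length pD)) lC)) (cross T′ D) refl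

module P5Leaf where

  ok : ℕ ⊎ ℕ → Bool
  ok (inj₁ c) = distinctBelow 7 (0 ∷ 1 ∷ digits 5 c)
  ok (inj₂ i) = Few.ok 7 i

  req lim : ℕ ⊎ ℕ → List Atom
  req (inj₁ c) = chain (digits 5 c)
  req (inj₂ i) = []
  lim (inj₁ c) = []
  lim (inj₂ i) = Few.lim 7 i

  bnd : ℕ ⊎ ℕ → ℕ
  bnd (inj₁ c) = 1
  bnd (inj₂ i) = 4

module SevenLeaf where

  ok : ℕ ⊎ Pairing → Bool
  ok = [ Few.ok 7 , (λ _ → true) ]′

  req lim : ℕ ⊎ Pairing → List Atom
  req = [ (λ _ → []) , pairAtoms ]′
  lim = [ Few.lim 7 , (λ _ → []) ]′

  bnd : ℕ ⊎ Pairing → ℕ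
  bnd = [ (λ _ → 4) , (λ _ → 1) ]′

module Seven {n} (G : Graph n) (free : Paths.No2P5 G) where

  open Embedding G free
  open P5Free G
  open Cores G
  open Matchings G free

  denseP5 : ∀ {Q x y Y} → Unique Q → Dense Q → Q ↭ x ∷ y ∷ Y → length Y ≡ 5 → PathIn Y 5
  denseP5 {Q} {x} {y} {Y@(_ ∷ _ ∷ _ ∷ _ ∷ _ ∷ [])} u dense q refl =
      conclude (Cases.sound ok req lim bnd val [] p5Tree refl [])
    where
    open P5Leaf
    open Labelled x (y ∷ Y)
    dense′ : Dense (x ∷ y ∷ Y)
    dense′ {v} v∈ = ≤-trans (dense (∈-resp-↭ (↭-sym q) v∈)) (≤-reflexive (deg-↭ v q))
    conclude : Cases.Outcome ok req lim bnd val → PathIn Y 5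
    conclude (inj₂ i , o , _ , lt) =
      ⊥-elim (few-contra {x} {y ∷ Y} {k = 7} {i} dense′ refl (at-∈ x (y ∷ Y) 7 i (<ᵇ-true i 7 o)) lt)
    conclude (inj₁ c , o , h , _) = map at (digits 5 c) , [] , refl , chain⇒Path (digits 5 c) h ,
      drop-∷ (drop-∷ (↭-exhaust {map at (0 ∷ 1 ∷ digits 5 c)} (distinct⇒Unique (Unique-↭ q u) 7 ≤-refl (0 ∷ 1 ∷ digits 5 c) o)
        (Allₚ.map⁺ (All.universal (nth-∈ x (y ∷ Y)) (0 ∷ 1 ∷ digits 5 c))) refl))

  module Hubs {T : List V} (h₁ h₂ h₃ a a′ b b′ : V) (u : Unique ((h₁ ∷ h₂ ∷ h₃ ∷ a ∷ a′ ∷ b ∷ b′ ∷ []) ++ T))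
      (holds : ∀ {ys} → Labelled.Holds h₁ (h₂ ∷ h₃ ∷ a ∷ a′ ∷ b ∷ b′ ∷ ys) (hubAtoms 3 4 5 6))
      {w₁ w₂ w₃ : V} (w₁∈ : w₁ ∈ T) (w₂∈ : w₂ ∈ T) (w₃∈ : w₃ ∈ T)
      (e₁ : w₁ ~ h₁) (e₂ : w₂ ~ h₂) (e₃ : w₃ ~ h₃) (w₁≢w₂ : w₁ ≢ w₂) (w₁≢w₃ : w₁ ≢ w₃) (w₂≢w₃ : w₂ ≢ w₃) where

    hubs pairs′ Q : List V
    hubs = h₁ ∷ h₂ ∷ h₃ ∷ []
    pairs′ = a ∷ a′ ∷ b ∷ b′ ∷ []
    Q = hubs ++ pairs′

    uniq : ∀ {x y z} → x ∈ T → y ∈ T → z ∈ T → x ≢ y → x ≢ z → y ≢ z → Unique (Q ++ x ∷ y ∷ z ∷ [])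
    uniq x∈ y∈ z∈ x≢y x≢z y≢z = Unique-sub Q u ((x≢y ∷ x≢z ∷ []) ∷ (y≢z ∷ []) ∷ [] ∷ []) (x∈ ∷ y∈ ∷ z∈ ∷ [])

    -- Such an edge together with two matching edges at hubs gives two disjoint P₅. The case split
    -- only selects two of `w₁`, `w₂`, `w₃` that differ from `s`.
    stray : ∀ {s y} → s ∈ T → y ∈ pairs′ → ¬ y ~ s
    stray {s} {y} s∈ y∈ e with s Finₚ.≟ w₂ | s Finₚ.≟ w₃
    ... | yes refl | _ = go y∈ e
      where
      U : Unique (Q ++ s ∷ w₁ ∷ w₃ ∷ [])
      U = uniq s∈ w₁∈ w₃∈ (λ eq → w₁≢w₂ (sym eq)) w₂≢w₃ w₁≢w₃
      go : ∀ {y} → y ∈ pairs′ → ¬ y ~ s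
      go = λ where
        (here refl) e → exhibit _ _ refl U ((3 , 7) ∷ (0 , 8) ∷ (2 , 9) ∷ hubAtoms 3 4 5 6) 9260851437 refl (e ∷ ~-sym e₁ ∷ ~-sym e₃ ∷ holds)
        (there (here refl)) e → exhibit _ _ refl U ((4 , 7) ∷ (0 , 8) ∷ (2 , 9) ∷ hubAtoms 3 4 5 6) 9260851347 refl (e ∷ ~-sym e₁ ∷ ~-sym e₃ ∷ holds)
        (there (there (here refl))) e → exhibit _ _ refl U ((5 , 7) ∷ (0 , 8) ∷ (2 , 9) ∷ hubAtoms 3 4 5 6) 9240831657 refl (e ∷ ~-sym e₁ ∷ ~-sym e₃ ∷ holds)
        (there (there (there (here refl)))) e → exhibit _ _ refl U ((6 , 7) ∷ (0 , 8) ∷ (2 , 9) ∷ hubAtoms 3 4 5 6) 9240831567 refl (e ∷ ~-sym e₁ ∷ ~-sym e₃ ∷ holds)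
    ... | no _ | yes refl = go y∈ e
      where
      U : Unique (Q ++ s ∷ w₁ ∷ w₂ ∷ [])
      U = uniq s∈ w₁∈ w₂∈ (λ eq → w₁≢w₃ (sym eq)) (λ eq → w₂≢w₃ (sym eq)) w₁≢w₂
      go : ∀ {y} → y ∈ pairs′ → ¬ y ~ s
      go = λ where
        (here refl) e → exhibit _ _ refl U ((3 , 7) ∷ (0 , 8) ∷ (1 , 9) ∷ hubAtoms 3 4 5 6) 9160852437 refl (e ∷ ~-sym e₁ ∷ ~-sym e₂ ∷ holds)
        (there (here refl)) e → exhibit _ _ refl U ((4 , 7) ∷ (0 , 8) ∷ (1 , 9) ∷ hubAtoms 3 4 5 6) 9160852347 refl (e ∷ ~-sym e₁ ∷ ~-sym e₂ ∷ holds)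
        (there (there (here refl))) e → exhibit _ _ refl U ((5 , 7) ∷ (0 , 8) ∷ (1 , 9) ∷ hubAtoms 3 4 5 6) 9140832657 refl (e ∷ ~-sym e₁ ∷ ~-sym e₂ ∷ holds)
        (there (there (there (here refl)))) e → exhibit _ _ refl U ((6 , 7) ∷ (0 , 8) ∷ (1 , 9) ∷ hubAtoms 3 4 5 6) 9140832567 refl (e ∷ ~-sym e₁ ∷ ~-sym e₂ ∷ holds)
    ... | no s≢w₂ | no s≢w₃ = go y∈ e
      where
      U : Unique (Q ++ s ∷ w₂ ∷ w₃ ∷ [])
      U = uniq s∈ w₂∈ w₃∈ s≢w₂ s≢w₃ w₂≢w₃
      go : ∀ {y} → y ∈ pairs′ → ¬ y ~ s
      go = λ where
        (here refl) e → exhibit _ _ refl U ((3 , 7) ∷ (1 , 8) ∷ (2 , 9) ∷ hubAtoms 3 4 5 6) 9261850437 refl (e ∷ ~-sym e₂ ∷ ~-sym e₃ ∷ holds)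
        (there (here refl)) e → exhibit _ _ refl U ((4 , 7) ∷ (1 , 8) ∷ (2 , 9) ∷ hubAtoms 3 4 5 6) 9261850347 refl (e ∷ ~-sym e₂ ∷ ~-sym e₃ ∷ holds)
        (there (there (here refl))) e → exhibit _ _ refl U ((5 , 7) ∷ (1 , 8) ∷ (2 , 9) ∷ hubAtoms 3 4 5 6) 9241830657 refl (e ∷ ~-sym e₂ ∷ ~-sym e₃ ∷ holds)
        (there (there (there (here refl)))) e → exhibit _ _ refl U ((6 , 7) ∷ (1 , 8) ∷ (2 , 9) ∷ hubAtoms 3 4 5 6) 9241830567 refl (e ∷ ~-sym e₂ ∷ ~-sym e₃ ∷ holds)

    U : Unique (Q ++ w₁ ∷ w₂ ∷ w₃ ∷ [])
    U = uniq w₁∈ w₂∈ w₃∈ w₁≢w₂ w₁≢w₃ w₂≢w₃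

    unlinked : ∀ {y z} → y ∈ a ∷ a′ ∷ [] → z ∈ b ∷ b′ ∷ [] → ¬ y ~ z
    unlinked = λ where
      (here refl) (here refl) e → exhibit _ _ refl U ((3 , 5) ∷ (0 , 7) ∷ (1 , 8) ∷ (2 , 9) ∷ hubAtoms 3 4 5 6) 9261853407 refl (e ∷ ~-sym e₁ ∷ ~-sym e₂ ∷ ~-sym e₃ ∷ holds)
      (here refl) (there (here refl)) e → exhibit _ _ refl U ((3 , 6) ∷ (0 , 7) ∷ (1 , 8) ∷ (2 , 9) ∷ hubAtoms 3 4 5 6) 9251863407 refl (e ∷ ~-sym e₁ ∷ ~-sym e₂ ∷ ~-sym e₃ ∷ holds)
      (there (here refl)) (here refl) e → exhibit _ _ refl U ((4 , 5) ∷ (0 , 7) ∷ (1 , 8) ∷ (2 , 9) ∷ hubAtoms 3 4 5 6) 9261854307 refl (e ∷ ~-sym e₁ ∷ ~-sym e₂ ∷ ~-sym e₃ ∷ holds)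
      (there (here refl)) (there (here refl)) e → exhibit _ _ refl U ((4 , 6) ∷ (0 , 7) ∷ (1 , 8) ∷ (2 , 9) ∷ hubAtoms 3 4 5 6) 9251864307 refl (e ∷ ~-sym e₁ ∷ ~-sym e₂ ∷ ~-sym e₃ ∷ holds)

    size-Q : size Q ≤ 17
    size-Q = ≤-trans (≤-reflexive (size-++ hubs pairs′)) (+-mono-≤ (+-mono-≤ (size≤triangle hubs)
      (cross≤ 4 hubs pairs′ (All.universal (λ h → deg≤length h pairs′) hubs)))
      (≤-trans (≤-reflexive (size-++ (a ∷ a′ ∷ []) (b ∷ b′ ∷ []))) (+-mono-≤ (+-mono-≤ (size≤triangle (a ∷ a′ ∷ []))
        (≤-reflexive (zero-cross {a ∷ a′ ∷ []} {b ∷ b′ ∷ []} unlinked))) (size≤triangle (b ∷ b′ ∷ [])))))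

    -- The path `a a′ k b b′` through one hub is a P₅, so the other two hubs together with `T` are
    -- P₅-free.
    twoHubs : ∀ {i j k} → i ∷ j ∷ k ∷ [] ↭ hubs → a′ ~ k → k ~ b → a ~ a′ → b ~ b′ →
              deg i T + (deg j T + size T) ≤ g (2 + length T)
    twoHubs {i} {j} {k} p e e′ e″ e‴ = ≤-trans (+-mono-≤ (m≤n+m (deg i T) (bit (adj G i j))) ≤-refl)
        (NoP5⇒size≤g (Unique-++ʳ q uq) (No2P5⇒NoP5 free {q} refl (e″ ∷ e ∷ e′ ∷ e‴ ∷ [-]) uq))
      where
      q : List V
      q = a ∷ a′ ∷ k ∷ b ∷ b′ ∷ []
      uq : Unique (q ++ i ∷ j ∷ T)
      uq = Unique-↭ (↭-trans (++⁺ʳ (pairs′ ++ T) (↭-sym p))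
        (↭-trans (++-comm (i ∷ j ∷ k ∷ []) (pairs′ ++ T)) (↭-trans (↭-reflexive (++-assoc pairs′ T (i ∷ j ∷ k ∷ []))) (↭-trans (++⁺ˡ pairs′ (++-comm T (i ∷ j ∷ k ∷ [])))
          shift₃)))) u
        where
        shift₃ : pairs′ ++ i ∷ j ∷ k ∷ T ↭ q ++ i ∷ j ∷ T
        shift₃ = prep a (prep a′ (shift k (b ∷ b′ ∷ i ∷ j ∷ []) T))

    -- Summing `twoHubs` over the three pairs of hubs counts each hub degree twice and `size T`
    -- three times, whence the factor 2. Each right-hand side is `g (4 + m)`, that is `6 + g m`, and
    -- the core has at most 17 edges, so the constant is 3 · 6 + 2 · 17 = 52.
    bound : ∀ {m} → length T ≡ 2 + m → 2 * (size T + cross T Q + size Q) ≤ 52 + 3 * g m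
    bound {m} lT = conclude holds
      where
      D₁ = deg h₁ T
      D₂ = deg h₂ T
      D₃ = deg h₃ T
      crossQ : cross T Q ≡ D₁ + (D₂ + (D₃ + 0))
      crossQ = ≡.trans (cross-sym T Q) (≡.trans (cross-++ˡ hubs pairs′ T)
        (≡.trans (cong (cross hubs T +_) (zero-cross {pairs′} {T} λ y∈ s∈ → stray s∈ y∈)) (+-identityʳ _)))
      rearrange : ∀ s q x y z → 2 * (s + (x + (y + (z + 0))) + q) + s ≡ x + (y + s) + (x + (z + s)) + (y + (z + s)) + 2 * q
      rearrange = solve-∀
      collect : ∀ k → (6 + k) + (6 + k) + (6 + k) + 34 ≡ 52 + 3 * k
      collect = solve-∀
      conclude : Labelled.Holds h₁ (h₂ ∷ h₃ ∷ a ∷ a′ ∷ b ∷ b′ ∷ []) (hubAtoms 3 4 5 6) → 2 * (size T + cross T Q + size Q) ≤ 52 + 3 * g m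
      conclude (aa ∷ bb ∷ _ ∷ f₁ ∷ g₁ ∷ _ ∷ _ ∷ f₂ ∷ g₂ ∷ _ ∷ _ ∷ f₃ ∷ g₃ ∷ _ ∷ []) = begin
        2 * (size T + cross T Q + size Q)                              ≡⟨ cong (λ c → 2 * (size T + c + size Q)) crossQ ⟩
        2 * (size T + (D₁ + (D₂ + (D₃ + 0))) + size Q)                 ≤⟨ m≤m+n _ (size T) ⟩
        2 * (size T + (D₁ + (D₂ + (D₃ + 0))) + size Q) + size T        ≡⟨ rearrange (size T) (size Q) D₁ D₂ D₃ ⟩
        D₁ + (D₂ + size T) + (D₁ + (D₃ + size T)) + (D₂ + (D₃ + size T)) + 2 * size Q
          ≤⟨ +-mono-≤ (+-mono-≤ (+-mono-≤
               (twoHubs ↭-refl (~-sym f₃) g₃ aa bb)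
               (twoHubs (prep h₁ (swap h₃ h₂ ↭-refl)) (~-sym f₂) g₂ aa bb))
               (twoHubs (↭-trans (prep h₂ (swap h₃ h₁ ↭-refl)) (swap h₂ h₁ ↭-refl)) (~-sym f₁) g₁ aa bb))
               (*-monoʳ-≤ 2 size-Q) ⟩
        g (2 + length T) + g (2 + length T) + g (2 + length T) + 34    ≡⟨ cong (λ l → g (2 + l) + g (2 + l) + g (2 + l) + 34) lT ⟩
        (6 + g m) + (6 + g m) + (6 + g m) + 34                         ≡⟨ collect (g m) ⟩
        52 + 3 * g m                                                   ∎
        where open ≤-Reasoning

  -- Core on seven vertices

  module _ {L T Q : List V} {m} (pL : L ↭ T ++ Q) (u : Unique L) (peel : Peel Q T) (dense : Dense Q) (lQ : length Q ≡ 7)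
      (lT : length T ≡ 2 + m) where

    private
      Bound : Set
      Bound = size L ≤ 35 + g m ⊎ 2 * size L ≤ 52 + 3 * g m

      sizeQ : size Q ≤ 21
      sizeQ = ≤-trans (size≤triangle Q) (≤-reflexive (cong triangle lQ))

      uTQ : Unique (T ++ Q)
      uTQ = Unique-↭ pL u

      uQ : Unique Q
      uQ = Unique-++ʳ T uTQ

      low : ∀ {t x Y} → t ∈ T → t ~ x → Q ↭ x ∷ Y → deg t Y ≤ 2
      low {t} {x} {Y} t∈ e q = deg-∷-≤ {Y = Y} e (≤-trans (≤-reflexive (sym (deg-↭ t q))) (All.lookup (Peel-deg peel) t∈))

      -- `start`, `first`, `second` and `third` enlarge a matching between `T` and `Q` one edge at a
      -- time. If it is maximal with at most two edges, `coverBound` gives at most 31 + g m; with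
      -- three edges `sevenTree` leaves only the hub configurations.
      third : ∀ {t₁ t₂ t₃ x₁ x₂ x₃ Y T′} → T ↭ t₁ ∷ t₂ ∷ t₃ ∷ T′ → Q ↭ x₁ ∷ x₂ ∷ x₃ ∷ Y → t₁ ~ x₁ → t₂ ~ x₂ → t₃ ~ x₃ → length Y ≡ 4 → Bound
      third {t₁} {t₂} {t₃} {x₁} {x₂} {x₃} {Y@(a ∷ b ∷ c ∷ d ∷ [])} {T′} pT pQ e₁ e₂ e₃ refl =
          conclude (Refute.refute ok req lim bnd x₁ xs refl uxs ((0 , 7) ∷ (1 , 8) ∷ (2 , 9) ∷ []) sevenTree refl
            (~-sym e₁ ∷ ~-sym e₂ ∷ ~-sym e₃ ∷ []))
        where
        open SevenLeaf
        xs : List V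
        xs = x₂ ∷ x₃ ∷ a ∷ b ∷ c ∷ d ∷ t₁ ∷ t₂ ∷ t₃ ∷ []
        open Labelled x₁ xs
        uQT : Unique ((x₁ ∷ x₂ ∷ x₃ ∷ Y) ++ T)
        uQT = Unique-↭ (↭-trans (++-comm T Q) (++⁺ʳ T pQ)) uTQ
        uT : Unique (t₁ ∷ t₂ ∷ t₃ ∷ T′)
        uT = Unique-↭ pT (Unique-++ˡ T uTQ)
        t⊆T : All (_∈ T) (t₁ ∷ t₂ ∷ t₃ ∷ [])
        t⊆T = All.tabulate λ t∈ → ∈-resp-↭ (↭-sym pT) (∈-++⁺ˡ t∈)
        uxs : Unique (x₁ ∷ xs)
        uxs = Unique-sub (x₁ ∷ x₂ ∷ x₃ ∷ Y) uQT (Unique-++ˡ (t₁ ∷ t₂ ∷ t₃ ∷ []) uT) t⊆T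
        dense′ : Dense (x₁ ∷ x₂ ∷ x₃ ∷ Y)
        dense′ {v} v∈ = ≤-trans (dense (∈-resp-↭ (↭-sym pQ) v∈)) (≤-reflexive (deg-↭ v pQ))
        finish : ∀ {a a′ b b′} → Q ↭ x₁ ∷ x₂ ∷ x₃ ∷ a ∷ a′ ∷ b ∷ b′ ∷ [] →
                 (∀ {ys} → Labelled.Holds x₁ (x₂ ∷ x₃ ∷ a ∷ a′ ∷ b ∷ b′ ∷ ys) (hubAtoms 3 4 5 6)) → Bound
        finish {a} {a′} {b} {b′} q holds = apart uT
          where
          apart : Unique (t₁ ∷ t₂ ∷ t₃ ∷ T′) → Bound
          apart ((ne₁ ∷ ne₂ ∷ _) ∷ (ne₃ ∷ _) ∷ _) = inj₂ (≤-trans (≤-reflexive (cong (2 *_)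
              (≡.trans (size-↭ (↭-trans pL (++⁺ˡ T q))) (size-++ T _))))
            (Hubs.bound x₁ x₂ x₃ a a′ b b′ (Unique-↭ (↭-trans (++-comm T Q) (++⁺ʳ T q)) uTQ) holds
              (All.lookup t⊆T (here refl)) (All.lookup t⊆T (there (here refl))) (All.lookup t⊆T (there (there (here refl))))
              e₁ e₂ e₃ ne₁ ne₂ ne₃ lT))
        conclude : Cases.Outcome ok req lim bnd val → Bound
        conclude (inj₁ i , o , _ , lt) = ⊥-elim (few-contra {x₁} {xs} {k = 7} {i} dense′ refl (at-∈ x₁ xs 7 i (<ᵇ-true i 7 o)) lt)
        conclude (inj₂ π , _ , h , _) = pairing π h
          where
          pairing : ∀ π → Holds (pairAtoms π) → Bound
          pairing p₃₄ (p0 ∷ p1 ∷ p2 ∷ p3 ∷ p4 ∷ p5 ∷ p6 ∷ p7 ∷ p8 ∷ p9 ∷ p10 ∷ p11 ∷ p12 ∷ p13 ∷ []) = finish pQ (p0 ∷ p1 ∷ p2 ∷ p3 ∷ p4 ∷ p5 ∷ p6 ∷ p7 ∷ p8 ∷ p9 ∷ p10 ∷ p11 ∷ p12 ∷ p13 ∷ [])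
          pairing p₃₅ (p0 ∷ p1 ∷ p2 ∷ p3 ∷ p4 ∷ p5 ∷ p6 ∷ p7 ∷ p8 ∷ p9 ∷ p10 ∷ p11 ∷ p12 ∷ p13 ∷ []) = finish (↭-trans pQ (prep x₁ (prep x₂ (prep x₃ (prep a (swap b c ↭-refl)))))) (p0 ∷ p1 ∷ p2 ∷ p3 ∷ p4 ∷ p5 ∷ p6 ∷ p7 ∷ p8 ∷ p9 ∷ p10 ∷ p11 ∷ p12 ∷ p13 ∷ [])
          pairing p₃₆ (p0 ∷ p1 ∷ p2 ∷ p3 ∷ p4 ∷ p5 ∷ p6 ∷ p7 ∷ p8 ∷ p9 ∷ p10 ∷ p11 ∷ p12 ∷ p13 ∷ []) = finish (↭-trans pQ (prep x₁ (prep x₂ (prep x₃ (prep a (shift d (b ∷ c ∷ []) [])))))) (p0 ∷ p1 ∷ p2 ∷ p3 ∷ p4 ∷ p5 ∷ p6 ∷ p7 ∷ p8 ∷ p9 ∷ p10 ∷ p11 ∷ p12 ∷ p13 ∷ [])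

      second : ∀ {t₁ t₂ x₁ x₂ Y T′} → T ↭ t₁ ∷ t₂ ∷ T′ → Q ↭ x₁ ∷ x₂ ∷ Y → t₁ ~ x₁ → t₂ ~ x₂ → ∀ c → cross T′ Y ≡ c → Bound
      second {t₁} {t₂} {x₁} {x₂} {Y} {T′} pT pQ e₁ e₂ zero none = inj₁ (begin
        size L                               ≤⟨ coverBound {X = x₁ ∷ x₂ ∷ []} {M = t₁ ∷ t₂ ∷ []} pL u pQ pT none
                                                  (≤-trans (m≤n+m _ (bit (adj G t₁ x₂))) (low (∈-resp-↭ (↭-sym pT) (here refl)) e₁ pQ) ∷
                                                   ≤-trans (m≤n+m _ (bit (adj G t₂ x₁))) (low (∈-resp-↭ (↭-sym pT) (there (here refl))) e₂ (↭-trans pQ (swap x₁ x₂ ↭-refl))) ∷ [])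
                                                  (denseP5 uQ dense pQ (suc-injective (suc-injective (≡.trans (sym (↭-length pQ)) lQ)))) ⟩
        size Q + (4 + g (2 + length T))      ≡⟨ cong (λ l → size Q + (4 + g (2 + l))) lT ⟩
        size Q + (10 + g m)                  ≤⟨ +-monoˡ-≤ _ sizeQ ⟩
        31 + g m                             ≤⟨ m≤n+m _ 4 ⟩
        35 + g m                             ∎)
        where open ≤-Reasoning
      second {t₁} {t₂} {x₁} {x₂} {Y} {T′} pT pQ e₁ e₂ (suc c) some =
        let t , x , t∈ , x∈ , e = cross>0⇒ T′ Y (≤-trans z<s (≤-reflexive (sym some)))
            T″ , pT′ = extract t∈
            Y′ , pY = extract x∈
            pQ′ = ↭-trans pQ (prep x₁ (prep x₂ pY))
        in third (↭-trans pT (prep t₁ (prep t₂ pT′))) pQ′ e₁ e₂ e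
             (suc-injective (suc-injective (suc-injective (≡.trans (sym (↭-length pQ′)) lQ))))

      P5-in-6 : ∀ {x Y} → Q ↭ x ∷ Y → length Y ≡ 6 → PathIn Y 5
      P5-in-6 {x} {y ∷ Y} q lY = let p , Z , lp , pp , r = denseP5 uQ dense q (suc-injective lY) in
        p , y ∷ Z , lp , pp , ↭-trans (prep y r) (↭-sym (shift y p Z))

      first : ∀ {t x Y T′} → T ↭ t ∷ T′ → Q ↭ x ∷ Y → t ~ x → ∀ c → cross T′ Y ≡ c → Bound
      first {t} {x} {Y} {T′} pT pQ e zero none = inj₁ (begin
        size L                               ≤⟨ coverBound {X = x ∷ []} {M = t ∷ []} pL u pQ pT none (low (∈-resp-↭ (↭-sym pT) (here refl)) e pQ ∷ [])
                                                  (P5-in-6 pQ (suc-injective (≡.trans (sym (↭-length pQ)) lQ))) ⟩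
        size Q + (2 + g (1 + length T))      ≡⟨ cong (λ l → size Q + (2 + g (1 + l))) lT ⟩
        size Q + (2 + g (3 + m))             ≤⟨ +-mono-≤ sizeQ (+-monoʳ-≤ 2 (g-3+ m)) ⟩
        29 + g m                             ≤⟨ m≤n+m _ 6 ⟩
        35 + g m                             ∎)
        where open ≤-Reasoning
      first {t} {x} {Y} {T′} pT pQ e (suc c) some =
        let t′ , x′ , t∈ , x∈ , e′ = cross>0⇒ T′ Y (≤-trans z<s (≤-reflexive (sym some)))
            T″ , pT′ = extract t∈
            Y′ , pY = extract x∈
        in second (↭-trans pT (prep t pT′)) (↭-trans pQ (prep x pY)) e e′ (cross T″ Y′) refl

      start : ∀ {v} → v ∈ Q → ∀ c → cross T Q ≡ c → Bound
      start v∈ zero none = inj₁ (begin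
        size L                               ≤⟨ coverBound {X = []} {M = []} pL u ↭-refl ↭-refl none [] (Dense⇒P5 dense v∈) ⟩
        size Q + g (length T)                ≡⟨ cong (λ l → size Q + g l) lT ⟩
        size Q + g (2 + m)                   ≤⟨ +-mono-≤ sizeQ (g-2+ m) ⟩
        26 + g m                             ≤⟨ m≤n+m _ 9 ⟩
        35 + g m                             ∎)
        where open ≤-Reasoning
      start v∈ (suc c) some =
        let t , x , t∈ , x∈ , e = cross>0⇒ T Q (≤-trans z<s (≤-reflexive (sym some)))
            T′ , pT = extract t∈
            Y , pQ = extract x∈
        in first pT pQ e (cross T′ Y) refl

    seven : ∀ {v} → v ∈ Q → Bound
    seven v∈ = start v∈ (cross T Q) refl

-- Degree patterns of the last peeled vertices

-- Besides the edges (i , j) between peeled vertices there are atoms (i , 10 + k) saying that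
-- peeled vertex i has at least k neighbours in the core.
data NumLeaf (Pat : Set) : Set where
  mono : ℕ → ℕ → NumLeaf Pat
  low  : List ℕ → NumLeaf Pat
  pat  : Pat → ℕ → NumLeaf Pat

nthIndex : List ℕ → ℕ → ℕ
nthIndex [] i = 0
nthIndex (j ∷ js) zero = j
nthIndex (j ∷ js) (suc i) = nthIndex js i

rename : List ℕ → Atom → Atom
rename p (i , j) = if j <ᵇ 10 then edge (nthIndex p i) (nthIndex p j) else (nthIndex p i , j)

-- The number of these atoms that hold is the degree of `i` at its deletion: edges to vertices
-- peeled later and, through three thresholds, edges to the core.
backAtoms : ℕ → ℕ → List Atom
backAtoms m i = map (i ,_) (map (λ k → suc (i + k)) (upTo (m ∸ suc i))) ++ (i , 11) ∷ (i , 12) ∷ (i , 13) ∷ []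

-- `loss` is the admissible total deficit of the back degrees from three each. A branch ends because
-- thresholds contradict each other (`mono`), because the vertices of `S` alone exceed the deficit
-- (`low`), or because the pattern occurs under the relabelling `c` (`pat`).
module NumCases {Pat : Set} (m loss : ℕ) (template : Pat → List Atom) where

  ok : NumLeaf Pat → Bool
  ok (mono i k) = true
  ok (low S) = distinctBelow m S
  ok (pat p c) = distinctBelow m (digits m c)

  req lim : NumLeaf Pat → List Atom
  req (mono i k) = (i , 11 + k) ∷ []
  req (low S) = []
  req (pat p c) = map (rename (digits m c)) (template p)
  lim (mono i k) = (i , 10 + k) ∷ []
  lim (low S) = concatMap (backAtoms m) S
  lim (pat p c) = []

  bnd : NumLeaf Pat → ℕ
  bnd (mono i k) = 1
  bnd (low S) = length S * 3 ∸ loss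
  bnd (pat p c) = 1

  open Cases ok req lim bnd public

count-++ : ∀ f as bs → count f (as ++ bs) ≡ count f as + count f bs
count-++ f [] bs = refl
count-++ f (a ∷ as) bs rewrite count-++ f as bs = sym (+-assoc (bit (f a)) (count f as) (count f bs))

count-concatMap : ∀ f (h : ℕ → List Atom) S → count f (concatMap h S) ≡ sum (map (λ i → count f (h i)) S)
count-concatMap f h [] = refl
count-concatMap f h (i ∷ S) = ≡.trans (count-++ f (h i) (concatMap h S)) (cong (count f (h i) +_) (count-concatMap f h S))

sum≤ : ∀ (B : ℕ → ℕ) k R → All (λ i → B i ≤ k) R → sum (map B R) ≤ length R * k
sum≤ B k [] [] = z≤n
sum≤ B k (i ∷ R) (p ∷ ps) = +-mono-≤ p (sum≤ B k R ps)

distinctBelow⇒Unique : ∀ m is → distinctBelow m is ≡ true → Unique is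
distinctBelow⇒Unique m [] p = []
distinctBelow⇒Unique m (i ∷ is) p with p₁ , p₂ ← ∧-split {i <ᵇ m} p with p₃ , p₄ ← ∧-split {notIn i is} p₂ =
  apart is p₃ ∷ distinctBelow⇒Unique m is p₄
  where
  apart : ∀ js → notIn i js ≡ true → All (i ≢_) js
  apart [] _ = []
  apart (j ∷ js) q with q₁ , q₂ ← ∧-split {not (i ≡ᵇ j)} q = ≢ᵇ-true i j q₁ ∷ apart js q₂

distinctBelow⇒∈ : ∀ m is → distinctBelow m is ≡ true → All (_∈ upTo m) is
distinctBelow⇒∈ m [] p = []
distinctBelow⇒∈ m (i ∷ is) p with p₁ , p₂ ← ∧-split {i <ᵇ m} p with p₃ , p₄ ← ∧-split {notIn i is} p₂ =
  ∈-upTo⁺ (<ᵇ-true i m p₁) ∷ distinctBelow⇒∈ m is p₄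

-- As no term exceeds 3, deficits are nonnegative, and a subset cannot miss more than the whole
-- does.
subsum : ∀ m loss (B : ℕ → ℕ) → All (λ i → B i ≤ 3) (upTo m) → m * 3 ≤ loss + sum (map B (upTo m)) →
         ∀ S → distinctBelow m S ≡ true → length S * 3 ∸ loss ≤ sum (map B S)
subsum m loss B le total S d with R , p ← split-off (distinctBelow⇒Unique m S d) (distinctBelow⇒∈ m S d) =
  m≤n+o⇒m∸n≤o _ loss (lin (length R * 3) chain′ (≡.trans (sym (*-distribʳ-+ 3 (length S) (length R))) (cong (_* 3) (sym lens))) assoc)
  where
  lens : m ≡ length S + length R
  lens = ≡.trans (sym (length-upTo m)) (≡.trans (↭-length p) (length-++ S))
  chain′ : m * 3 ≤ loss + (sum (map B S) + length R * 3)
  chain′ = ≤-trans total (+-monoʳ-≤ loss (≤-trans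
    (≤-reflexive (≡.trans (sum-↭ (map⁺ B p)) (≡.trans (cong sum (map-++ B S R)) (sum-++ (map B S) (map B R)))))
    (+-monoʳ-≤ (sum (map B S)) (sum≤ B 3 R (Allₚ.++⁻ʳ S (All-resp-↭ p le))))))
  assoc : loss + (sum (map B S) + length R * 3) ≡ loss + sum (map B S) + length R * 3
  assoc = sym (+-assoc loss _ _)

thresholds : ∀ d → d ≤ 3 → bit (1 ≤ᵇ d) + (bit (2 ≤ᵇ d) + (bit (3 ≤ᵇ d) + 0)) ≡ d
thresholds 0 _ = refl
thresholds 1 _ = refl
thresholds 2 _ = refl
thresholds 3 _ = refl
thresholds (suc (suc (suc (suc _)))) (s≤s (s≤s (s≤s ())))

≤ᵇ-true : ∀ m n → (m ≤ᵇ n) ≡ true → m ≤ n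
≤ᵇ-true m n p = ≤ᵇ⇒≤ m n (subst Bool.T (sym p) _)

<⇒<ᵇ-true : ∀ {m n} → m < n → (m <ᵇ n) ≡ true
<⇒<ᵇ-true {m} {n} lt with m <ᵇ n | <⇒<ᵇ lt
... | true | _ = refl

data SixPattern : Set where
  p4 p3₁₂ p3₂₁ m2 k2₁₂₃ k2₂₁₃ k2₃₁₂ edgeless : SixPattern

-- Subscripts in the names are the thresholds, in order, of the vertices that are to receive
-- distinct core neighbours; 1, 2, 3 in any order suffice for the greedy choice in `reps₃`.
sixPattern : SixPattern → List Atom
sixPattern p4 = (0 , 1) ∷ (1 , 2) ∷ (2 , 3) ∷ (0 , 11) ∷ []
sixPattern p3₁₂ = (0 , 1) ∷ (1 , 2) ∷ (2 , 11) ∷ (3 , 12) ∷ []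
sixPattern p3₂₁ = (0 , 1) ∷ (1 , 2) ∷ (2 , 12) ∷ (3 , 11) ∷ []
sixPattern m2 = (0 , 1) ∷ (2 , 3) ∷ (1 , 11) ∷ (3 , 12) ∷ []
sixPattern k2₁₂₃ = (0 , 1) ∷ (1 , 11) ∷ (2 , 12) ∷ (3 , 13) ∷ []
sixPattern k2₂₁₃ = (0 , 1) ∷ (1 , 12) ∷ (2 , 11) ∷ (3 , 13) ∷ []
sixPattern k2₃₁₂ = (0 , 1) ∷ (1 , 13) ∷ (2 , 11) ∷ (3 , 12) ∷ []
sixPattern edgeless = (0 , 13) ∷ (1 , 13) ∷ (2 , 12) ∷ (3 , 11) ∷ []

sixNumTree : Tree (NumLeaf SixPattern)
sixNumTree =
  split 3 11 (split 2 11 (split 3 12 (split 2 12 (split 1 11 (split 1 2 (split 0 1 (leaf (pat p3₂₁ 3210))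
  (split 0 2 (leaf (pat p3₁₂ 3120)) (split 0 3 (leaf (pat m2 2130)) (split 0 11 (split 2 3 (leaf (pat p3₂₁
  321)) (split 2 13 (leaf (pat k2₃₁₂ 3021)) (split 3 13 (leaf (pat k2₂₁₃ 3021)) (split 0 12 (split 0 13
  (leaf (pat k2₂₁₃ 321)) (leaf (low (0 ∷ 2 ∷ 3 ∷ [])))) (leaf (low (0 ∷ 2 ∷ 3 ∷ []))))))) (split 0 12 (leaf
  (mono 0 1)) (split 0 13 (leaf (mono 0 2)) (leaf (low (0 ∷ 3 ∷ []))))))))) (split 1 3 (split 0 1 (leaf
  (pat p3₁₂ 2310)) (split 0 2 (leaf (pat m2 3120)) (split 0 3 (leaf (pat p3₁₂ 2130)) (split 0 11 (split 2 3
  (leaf (pat p3₂₁ 231)) (split 2 13 (leaf (pat k2₂₁₃ 2031)) (split 3 13 (leaf (pat k2₃₁₂ 2031)) (split 0 12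
  (split 0 13 (leaf (pat k2₁₂₃ 231)) (leaf (low (0 ∷ 2 ∷ 3 ∷ [])))) (leaf (low (0 ∷ 2 ∷ 3 ∷ [])))))))
  (split 0 12 (leaf (mono 0 1)) (split 0 13 (leaf (mono 0 2)) (leaf (low (0 ∷ 3 ∷ []))))))))) (split 1 12
  (split 2 3 (split 0 1 (leaf (pat m2 1023)) (split 0 2 (leaf (pat p3₁₂ 1320)) (split 0 3 (leaf (pat p3₁₂
  1230)) (split 0 11 (split 1 13 (leaf (pat k2₂₁₃ 1032)) (split 3 13 (leaf (pat k2₃₁₂ 1032)) (split 0 12
  (split 0 13 (leaf (pat k2₂₁₃ 123)) (leaf (low (0 ∷ 1 ∷ 3 ∷ [])))) (leaf (low (0 ∷ 1 ∷ 3 ∷ [])))))) (split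
  0 12 (leaf (mono 0 1)) (split 0 13 (leaf (mono 0 2)) (leaf (low (0 ∷ 3 ∷ []))))))))) (split 3 13 (split 0
  1 (leaf (pat k2₂₁₃ 3210)) (split 0 2 (leaf (pat k2₂₁₃ 3120)) (split 0 3 (leaf (pat k2₃₁₂ 1230)) (split 0
  11 (split 1 13 (leaf (pat edgeless 231)) (split 2 13 (leaf (pat edgeless 132)) (split 0 12 (split 0 13
  (leaf (pat edgeless 2130)) (leaf (low (0 ∷ 1 ∷ 2 ∷ [])))) (leaf (low (0 ∷ 1 ∷ 2 ∷ [])))))) (split 0 12
  (leaf (mono 0 1)) (split 0 13 (leaf (mono 0 2)) (leaf (low (0 ∷ 3 ∷ []))))))))) (split 1 13 (split 0 1
  (leaf (pat k2₃₁₂ 2310)) (split 0 2 (leaf (pat k2₂₁₃ 1320)) (split 0 3 (leaf (pat k2₂₁₃ 1230)) (split 0 11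
  (split 2 13 (leaf (pat edgeless 321)) (split 0 12 (split 0 13 (leaf (pat edgeless 2310)) (leaf (low (0 ∷
  1 ∷ 2 ∷ 3 ∷ [])))) (leaf (low (0 ∷ 1 ∷ 2 ∷ 3 ∷ []))))) (split 0 12 (leaf (mono 0 1)) (leaf (low (0 ∷ 3 ∷
  [])))))))) (split 2 13 (split 0 1 (leaf (pat k2₂₁₃ 2310)) (split 0 2 (leaf (pat k2₃₁₂ 3120)) (split 0 3
  (leaf (pat k2₂₁₃ 2130)) (split 0 11 (split 0 12 (split 0 13 (leaf (pat edgeless 1320)) (leaf (low (0 ∷ 1
  ∷ 3 ∷ [])))) (leaf (low (0 ∷ 1 ∷ 3 ∷ [])))) (leaf (low (0 ∷ 1 ∷ 3 ∷ []))))))) (leaf (low (1 ∷ 2 ∷ 3 ∷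
  []))))))) (split 1 13 (leaf (mono 1 2)) (split 3 13 (split 0 1 (leaf (pat k2₁₂₃ 3210)) (split 0 2 (leaf
  (pat k2₂₁₃ 3120)) (split 0 3 (leaf (pat k2₃₁₂ 2130)) (split 0 11 (split 0 12 (split 0 13 (leaf (pat
  edgeless 1230)) (leaf (low (0 ∷ 1 ∷ [])))) (leaf (low (0 ∷ 1 ∷ [])))) (leaf (low (0 ∷ 1 ∷ []))))))) (leaf
  (low (1 ∷ 3 ∷ [])))))))) (split 1 12 (leaf (mono 1 1)) (split 1 3 (split 1 13 (leaf (mono 1 2)) (split 1
  2 (split 0 1 (leaf (pat p3₂₁ 3210)) (split 0 2 (leaf (pat p4 213)) (split 0 3 (leaf (pat m2 2130)) (split
  0 11 (leaf (pat p3₂₁ 213)) (split 0 12 (leaf (mono 0 1)) (leaf (low (0 ∷ 1 ∷ [])))))))) (split 3 13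
  (split 0 1 (leaf (pat p3₁₂ 2310)) (split 0 2 (leaf (pat m2 3120)) (split 0 11 (leaf (pat k2₃₁₂ 2031))
  (split 0 12 (leaf (mono 0 1)) (leaf (low (0 ∷ 1 ∷ []))))))) (leaf (low (1 ∷ 3 ∷ [])))))) (split 1 13
  (leaf (mono 1 2)) (split 1 2 (split 3 13 (split 0 1 (leaf (pat p3₂₁ 3210)) (split 0 3 (leaf (pat m2
  2130)) (split 0 11 (leaf (pat k2₂₁₃ 3021)) (split 0 12 (leaf (mono 0 1)) (leaf (low (0 ∷ 1 ∷ [])))))))
  (leaf (low (1 ∷ 3 ∷ [])))) (leaf (low (1 ∷ 3 ∷ [])))))))) (split 2 13 (leaf (mono 2 2)) (split 2 3 (split
  1 11 (split 0 1 (leaf (pat m2 3210)) (split 0 2 (leaf (pat p3₂₁ 1320)) (split 0 11 (split 0 12 (split 0 3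
  (leaf (pat p3₂₁ 1032)) (split 0 13 (leaf (pat k2₂₁₃ 132)) (split 3 13 (leaf (pat k2₃₁₂ 132)) (leaf (low
  (0 ∷ 2 ∷ 3 ∷ [])))))) (split 0 13 (leaf (mono 0 2)) (split 0 3 (split 1 2 (leaf (pat p4 1230)) (split 1
  12 (leaf (pat p3₁₂ 1032)) (split 1 13 (leaf (mono 1 2)) (leaf (low (0 ∷ 1 ∷ 2 ∷ [])))))) (leaf (low (0 ∷
  2 ∷ [])))))) (split 0 12 (leaf (mono 0 1)) (split 0 13 (leaf (mono 0 2)) (leaf (low (0 ∷ 2 ∷ []))))))))
  (split 1 12 (leaf (mono 1 1)) (split 1 2 (split 1 13 (leaf (mono 1 2)) (split 1 3 (split 0 1 (leaf (pat
  p4 123)) (split 0 2 (leaf (pat p4 213)) (split 0 3 (leaf (pat m2 3021)) (split 0 11 (leaf (pat p3₂₁ 312))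
  (leaf (low (0 ∷ 1 ∷ 2 ∷ []))))))) (leaf (low (1 ∷ 2 ∷ 3 ∷ []))))) (split 1 13 (leaf (mono 1 2)) (leaf
  (low (1 ∷ 2 ∷ 3 ∷ []))))))) (split 3 13 (split 1 2 (split 0 1 (leaf (pat p3₁₂ 3210)) (split 0 3 (leaf
  (pat m2 3021)) (split 0 11 (split 0 2 (leaf (pat p3₁₂ 3021)) (split 0 12 (leaf (pat k2₁₂₃ 3021)) (leaf
  (low (0 ∷ 2 ∷ []))))) (split 0 12 (leaf (mono 0 1)) (leaf (low (0 ∷ 2 ∷ []))))))) (split 1 11 (split 1 12
  (split 0 1 (leaf (pat k2₂₁₃ 3210)) (split 0 2 (leaf (pat k2₁₂₃ 3120)) (split 0 3 (leaf (pat k2₃₁₂ 1230))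
  (split 0 11 (split 0 12 (split 0 13 (leaf (pat edgeless 2130)) (leaf (low (0 ∷ 2 ∷ [])))) (leaf (low (0 ∷
  2 ∷ [])))) (leaf (low (0 ∷ 2 ∷ []))))))) (split 1 13 (leaf (mono 1 2)) (leaf (low (1 ∷ 2 ∷ 3 ∷ [])))))
  (split 1 12 (leaf (mono 1 1)) (leaf (low (1 ∷ 2 ∷ 3 ∷ [])))))) (leaf (low (2 ∷ 3 ∷ []))))))) (split 3 13
  (leaf (mono 3 2)) (split 2 12 (split 2 3 (split 1 11 (split 0 1 (leaf (pat m2 2310)) (split 0 3 (leaf
  (pat p3₂₁ 1230)) (split 0 11 (split 0 12 (split 0 2 (leaf (pat p3₂₁ 1023)) (split 0 13 (leaf (pat k2₂₁₃
  123)) (leaf (low (0 ∷ 3 ∷ []))))) (split 0 13 (leaf (mono 0 2)) (leaf (low (0 ∷ 3 ∷ []))))) (split 0 12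
  (leaf (mono 0 1)) (leaf (low (0 ∷ 3 ∷ []))))))) (split 1 12 (leaf (mono 1 1)) (split 1 13 (leaf (mono 1
  2)) (leaf (low (1 ∷ 3 ∷ [])))))) (split 2 13 (split 1 3 (split 0 1 (leaf (pat p3₁₂ 2310)) (split 0 2
  (leaf (pat m2 2031)) (split 0 11 (split 0 3 (leaf (pat p3₁₂ 2031)) (split 0 12 (leaf (pat k2₁₂₃ 2031))
  (leaf (low (0 ∷ 3 ∷ []))))) (split 0 12 (leaf (mono 0 1)) (leaf (low (0 ∷ 3 ∷ []))))))) (split 1 11
  (split 1 12 (split 0 1 (leaf (pat k2₂₁₃ 2310)) (split 0 2 (leaf (pat k2₃₁₂ 1320)) (split 0 3 (leaf (pat
  k2₁₂₃ 2130)) (split 0 11 (split 0 12 (split 0 13 (leaf (pat edgeless 3120)) (leaf (low (0 ∷ 3 ∷ []))))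
  (leaf (low (0 ∷ 3 ∷ [])))) (leaf (low (0 ∷ 3 ∷ []))))))) (split 1 13 (leaf (mono 1 2)) (leaf (low (1 ∷ 3
  ∷ []))))) (split 1 12 (leaf (mono 1 1)) (leaf (low (1 ∷ 3 ∷ [])))))) (leaf (low (2 ∷ 3 ∷ []))))) (split 2
  13 (leaf (mono 2 2)) (leaf (low (2 ∷ 3 ∷ []))))))) (split 2 12 (leaf (mono 2 1)) (split 2 3 (split 2 13
  (leaf (mono 2 2)) (split 3 12 (split 3 13 (split 1 11 (split 0 1 (leaf (pat m2 3210)) (split 0 2 (leaf
  (pat p3₂₁ 1320)) (split 0 11 (split 0 12 (leaf (pat k2₃₁₂ 132)) (split 0 13 (leaf (mono 0 2)) (leaf (low
  (0 ∷ 2 ∷ []))))) (split 0 12 (leaf (mono 0 1)) (leaf (low (0 ∷ 2 ∷ []))))))) (split 1 12 (leaf (mono 1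
  1)) (split 1 13 (leaf (mono 1 2)) (leaf (low (1 ∷ 2 ∷ 3 ∷ [])))))) (leaf (low (2 ∷ 3 ∷ [])))) (leaf (low
  (2 ∷ 3 ∷ []))))) (split 2 13 (leaf (mono 2 2)) (leaf (low (2 ∷ 3 ∷ []))))))) (split 3 12 (leaf (mono 3
  1)) (split 3 13 (leaf (mono 3 2)) (leaf (low (3 ∷ [])))))

-- In this tree and the next five, positions 0 to 5 are the core and 6 to 9 the peeled vertices. The
-- first core positions are the chosen neighbours of peeled vertices.
sixP4Tree : Tree (ℕ ⊎ ℕ)
sixP4Tree =
  split 1 2 (split 1 3 (split 1 4 (split 2 3 (split 2 5 (hit 9876052314) (split 3 5 (hit 9876053214) (miss
  5))) (split 2 4 (split 2 5 (hit 9876052413) (miss 2)) (miss 2))) (split 1 5 (split 2 4 (split 2 3 (hit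
  9876051324) (split 2 5 (hit 9876031524) (miss 2))) (miss 4)) (miss 1))) (split 1 4 (split 1 5 (split 2 3
  (split 2 4 (hit 9876051423) (split 2 5 (hit 9876041523) (miss 2))) (miss 3)) (miss 1)) (miss 1))) (split
  1 4 (split 1 5 (split 2 3 (split 2 4 (hit 9876051423) (miss 2)) (miss 2)) (miss 1)) (miss 1))

sixP3Tree : Tree (ℕ ⊎ ℕ)
sixP3Tree =
  split 0 3 (split 0 4 (split 1 2 (split 1 3 (split 1 4 (split 2 3 (split 2 5 (hit 8760452319) (split 3 5
  (hit 8760453219) (miss 5))) (split 2 4 (split 2 5 (hit 8760352419) (miss 2)) (miss 2))) (split 1 5 (split
  2 4 (split 4 5 (hit 8760391542) (miss 4)) (miss 4)) (miss 1))) (split 1 5 (split 2 3 (split 3 5 (hit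
  8760491532) (miss 3)) (miss 3)) (miss 1))) (split 1 5 (split 2 3 (split 2 5 (hit 8760491523) (miss 2))
  (miss 2)) (miss 1))) (split 0 5 (split 1 4 (split 2 4 (split 2 3 (hit 8760532419) (split 2 5 (hit
  8760352419) (miss 2))) (miss 4)) (miss 4)) (miss 0))) (split 0 4 (split 0 5 (split 1 3 (split 2 3 (split
  2 4 (hit 8760542319) (split 2 5 (hit 8760452319) (miss 2))) (miss 3)) (miss 3)) (miss 0)) (miss 0))

six2K2Tree : Tree (ℕ ⊎ ℕ)
six2K2Tree =
  split 0 3 (split 0 4 (split 1 3 (split 1 4 (split 2 3 (split 4 5 (hit 8913254067) (split 2 4 (split 3 5
  (hit 8914253067) (miss 5)) (miss 4))) (split 2 4 (split 3 5 (hit 8914253067) (miss 3)) (miss 2))) (split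
  1 5 (split 2 4 (split 3 5 (hit 7604289153) (split 2 3 (split 4 5 (hit 7603289154) (miss 4)) (miss 3)))
  (miss 4)) (miss 1))) (split 1 5 (split 2 3 (split 3 4 (split 2 5 (hit 7604389152) (split 4 5 (hit
  7603289154) (miss 5))) (miss 3)) (miss 3)) (miss 1))) (split 0 5 (split 1 4 (split 2 4 (split 3 4 (split
  2 5 (hit 8914376052) (split 3 5 (hit 8914276053) (miss 5))) (miss 4)) (miss 4)) (miss 4)) (miss 0)))
  (split 0 5 (split 1 3 (split 2 3 (split 3 4 (split 2 5 (hit 8913476052) (split 4 5 (hit 8913276054) (miss
  5))) (miss 3)) (miss 3)) (miss 3)) (miss 0))

sixK2Tree : Tree (ℕ ⊎ ℕ)
sixK2Tree =
  split 0 1 (split 0 2 (split 0 3 (split 0 4 (split 1 3 (split 1 4 (split 2 3 (split 4 5 (hit 9231854067)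
  (split 2 4 (split 3 5 (hit 9241853067) (miss 5)) (miss 4))) (split 2 4 (split 3 5 (hit 9241853067) (miss
  3)) (miss 2))) (split 1 5 (split 3 4 (split 4 5 (hit 9206781543) (miss 4)) (miss 4)) (miss 1))) (split 1
  5 (split 3 4 (split 3 5 (hit 9206781534) (miss 3)) (miss 3)) (miss 1))) (split 3 4 (split 4 5 (split 1 3
  (hit 9206754318) (split 2 3 (hit 8106754329) (miss 3))) (miss 4)) (miss 4))) (split 3 4 (split 3 5 (split
  1 4 (hit 9206753418) (split 2 4 (hit 8106753429) (miss 4))) (miss 3)) (miss 3))) (split 0 4 (split 0 5
  (split 2 3 (split 2 4 (split 2 5 (split 1 3 (split 4 5 (hit 9231876054) (split 3 4 (split 1 5 (hit
  7604392518) (miss 5)) (miss 4))) (split 1 4 (split 3 5 (hit 9241876053) (miss 3)) (miss 1))) (miss 2))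
  (miss 2)) (miss 2)) (miss 0)) (miss 0))) (split 0 4 (split 0 5 (split 1 3 (split 1 4 (split 1 5 (split 2
  3 (split 4 5 (hit 9231876054) (split 3 4 (split 2 5 (hit 7604381529) (miss 5)) (miss 4))) (split 2 4
  (split 3 5 (hit 9241876053) (miss 3)) (miss 2))) (miss 1)) (miss 1)) (miss 1)) (miss 0)) (miss 0))

sixSDRTree : Tree (ℕ ⊎ ℕ)
sixSDRTree =
  split 0 4 (split 1 4 (split 2 5 (split 3 5 (hit 7140682539) (split 3 4 (split 0 5 (hit 9341782506) (miss
  5)) (miss 3))) (split 2 4 (split 3 5 (split 0 5 (hit 8241793506) (miss 5)) (miss 5)) (miss 2))) (split 1
  5 (split 2 4 (split 3 5 (hit 8240671539) (split 3 4 (split 0 5 (hit 9342871506) (miss 5)) (miss 3)))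
  (miss 4)) (miss 1))) (split 0 5 (split 1 4 (split 2 4 (split 3 4 (split 1 5 (hit 9342860517) (split 2 5
  (hit 9341760528) (miss 5))) (miss 4)) (miss 4)) (miss 4)) (miss 0))

sixHubTree : Tree (ℕ ⊎ ℕ)
sixHubTree =
  split 0 3 (split 0 4 (split 3 4 (split 3 5 (hit 9271853406) (split 4 5 (hit 9271854306) (miss 5))) (split
  3 5 (split 4 5 (hit 9271860354) (miss 4)) (miss 3))) (split 0 5 (split 3 4 (split 4 5 (hit 9271860543)
  (miss 4)) (miss 4)) (miss 0))) (split 0 5 (split 3 4 (split 3 5 (hit 9271860534) (miss 3)) (miss 3))
  (miss 0))


module Peeled {n} (G : Graph n) where

  open Paths G
  open Cores G

  module Num (Q : List V) (t : V) (ts : List V) where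

    open Labelled t ts public using (at)
    open Labelled t ts using (val-edge)

    nval : Atom → Bool
    nval (i , j) = if j <ᵇ 10 then adj G (at i) (at j) else ((j ∸ 10) ≤ᵇ deg (at i) Q)

    nval-edge : ∀ x y → x < 10 → y < 10 → nval (edge x y) ≡ true → at x ~ at y
    nval-edge x y x< y< p with x <ᵇ y
    ... | true rewrite <⇒<ᵇ-true y< = p
    ... | false rewrite <⇒<ᵇ-true x< = ~-sym p

    mono-contra : ∀ i k → nval (i , 11 + k) ≡ true → count nval ((i , 10 + k) ∷ []) < 1 → ⊥
    mono-contra i k p lt with k ≤ᵇ deg (at i) Q in eq
    mono-contra i k p (s≤s ()) | true
    mono-contra i k p lt | false = subst Bool.T eq (≤⇒≤ᵇ (≤-trans (n≤1+n k) (≤ᵇ-true (suc k) (deg (at i) Q) p)))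

  rep : ∀ {s Q} → 1 ≤ deg s Q → ∃ λ x → x ∈ Q × s ~ x
  rep {s} {Q} le = deg>0⇒ s Q le

  -- Distinct representatives are chosen in order of increasing degree: each vertex has one more
  -- neighbour than there are representatives to avoid.
  reps₂ : ∀ {Q} → Unique Q → ∀ {s t} → 1 ≤ deg s Q → 2 ≤ deg t Q →
          ∃ λ x → ∃ λ y → (x ∈ Q × s ~ x) × (y ∈ Q × t ~ y) × x ≢ y
  reps₂ u {s} {t} p q =
    let x , x∈ , sx = rep p
        y , y∈ , y∉ , ty = fresh t [ x ] u q
    in x , y , (x∈ , sx) , (y∈ , ty) , λ e → y∉ (here (sym e))

  reps₃ : ∀ {Q} → Unique Q → ∀ {r s t} → 1 ≤ deg r Q → 2 ≤ deg s Q → 3 ≤ deg t Q →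
          ∃ λ x → ∃ λ y → ∃ λ z → (x ∈ Q × r ~ x) × (y ∈ Q × s ~ y) × (z ∈ Q × t ~ z) × x ≢ y × x ≢ z × y ≢ z
  reps₃ u {r} {s} {t} p q k =
    let x , y , rx , sy , x≢y = reps₂ u p q
        z , z∈ , z∉ , tz = fresh t (x ∷ y ∷ []) u k
    in x , y , z , rx , sy , (z∈ , tz) , x≢y , (λ e → z∉ (here (sym e))) , λ e → z∉ (there (here (sym e)))

-- Core on six vertices

module Six {n} (G : Graph n) (free : Paths.No2P5 G) where

  open Embedding G free
  open Cores G
  open Matchings G free
  open Peeled G

  module _ {Q T : List V} (dense : Dense Q) (u : Unique (Q ++ T)) (lQ : length Q ≡ 6) where

    private
      uQ : Unique Q
      uQ = Unique-++ˡ Q u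

    Four : V → V → V → V → Set
    Four a b c d = Unique (a ∷ b ∷ c ∷ d ∷ []) × All (_∈ T) (a ∷ b ∷ c ∷ d ∷ [])

    Four-↭ : ∀ {a b c d a′ b′ c′ d′} → a ∷ b ∷ c ∷ d ∷ [] ↭ a′ ∷ b′ ∷ c′ ∷ d′ ∷ [] → Four a b c d → Four a′ b′ c′ d′
    Four-↭ p (u , i) = Unique-↭ p u , All-resp-↭ p i

    run : ∀ {q₀ q₁ q₂ q₃ q₄ q₅ a b c d} → Q ↭ q₀ ∷ q₁ ∷ q₂ ∷ q₃ ∷ q₄ ∷ q₅ ∷ [] → Four a b c d →
          (T₀ : List Atom) (t : Tree (ℕ ⊎ ℕ)) → Refute.check (Few.ok 6) (Few.req 6) (Few.lim 6) (Few.bnd 6) T₀ [] t ≡ true →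
          Labelled.Holds q₀ (q₁ ∷ q₂ ∷ q₃ ∷ q₄ ∷ q₅ ∷ a ∷ b ∷ c ∷ d ∷ []) T₀ → ⊥
    run {q₀} {q₁} {q₂} {q₃} {q₄} {q₅} {a} {b} {c} {d} q (uf , f⊆T) T₀ t chk h = denseRefute 6 q₀ _ refl
      (Unique-sub Q′ (Unique-↭ (++⁺ʳ T q) u) uf f⊆T) dense′ refl T₀ t chk h
      where
      Q′ : List V
      Q′ = q₀ ∷ q₁ ∷ q₂ ∷ q₃ ∷ q₄ ∷ q₅ ∷ []
      dense′ : Dense Q′
      dense′ {v} v∈ = ≤-trans (dense (∈-resp-↭ (↭-sym q) v∈)) (≤-reflexive (deg-↭ v q))

    front : ∀ X → Unique X → All (_∈ Q) X → ∃ λ R → Q ↭ X ++ R × length X + length R ≡ 6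
    front X uX X⊆Q = let R , q = split-off uX X⊆Q in R , q , ≡.trans (sym (length-++ X)) (≡.trans (sym (↭-length q)) lQ)

    no-p4 : ∀ {a b c d x} → Four a b c d → a ~ b → b ~ c → c ~ d → x ∈ Q → a ~ x → ⊥
    no-p4 {x = x} f ab bc cd x∈ ax = go (front (x ∷ []) ([] ∷ []) (x∈ ∷ []))
      where
      go : (∃ λ R → Q ↭ (x ∷ []) ++ R × length (x ∷ []) + length R ≡ 6) → ⊥
      go (_ ∷ _ ∷ _ ∷ _ ∷ _ ∷ [] , q , refl) =
        run q f ((6 , 7) ∷ (7 , 8) ∷ (8 , 9) ∷ (0 , 6) ∷ []) sixP4Tree refl (ab ∷ bc ∷ cd ∷ ~-sym ax ∷ [])

    no-p3 : ∀ {a b c d x y} → Four a b c d → a ~ b → b ~ c → x ∈ Q × c ~ x → y ∈ Q × d ~ y → x ≢ y → ⊥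
    no-p3 {a} {b} {c} {d} {x} {y} f ab bc (x∈ , cx) (y∈ , dy) x≢y = go (front (x ∷ y ∷ []) ((x≢y ∷ []) ∷ [] ∷ []) (x∈ ∷ y∈ ∷ []))
      where
      go : (∃ λ R → Q ↭ (x ∷ y ∷ []) ++ R × length (x ∷ y ∷ []) + length R ≡ 6) → ⊥
      go (_ ∷ _ ∷ _ ∷ _ ∷ [] , q , refl) =
        run q (Four-↭ (++⁺ʳ (d ∷ []) (↭-sym (↭-reverse (a ∷ b ∷ c ∷ [])))) f)
          ((6 , 7) ∷ (7 , 8) ∷ (0 , 6) ∷ (1 , 9) ∷ []) sixP3Tree refl (~-sym bc ∷ ~-sym ab ∷ ~-sym cx ∷ ~-sym dy ∷ [])

    no-m2 : ∀ {a b c d x y} → Four a b c d → a ~ b → c ~ d → x ∈ Q × b ~ x → y ∈ Q × d ~ y → x ≢ y → ⊥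
    no-m2 {a} {b} {c} {d} {x} {y} f ab cd (x∈ , bx) (y∈ , dy) x≢y = go (front (x ∷ y ∷ []) ((x≢y ∷ []) ∷ [] ∷ []) (x∈ ∷ y∈ ∷ []))
      where
      go : (∃ λ R → Q ↭ (x ∷ y ∷ []) ++ R × length (x ∷ y ∷ []) + length R ≡ 6) → ⊥
      go (_ ∷ _ ∷ _ ∷ _ ∷ [] , q , refl) =
        run q (Four-↭ (swap a b ↭-refl) f) ((6 , 7) ∷ (8 , 9) ∷ (0 , 6) ∷ (1 , 9) ∷ []) six2K2Tree refl
          (~-sym ab ∷ cd ∷ ~-sym bx ∷ ~-sym dy ∷ [])

    no-k2 : ∀ {a b c d x y z} → Four a b c d → a ~ b → x ∈ Q × b ~ x → y ∈ Q × c ~ y → z ∈ Q × d ~ z → x ≢ y → x ≢ z → y ≢ z → ⊥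
    no-k2 {a} {b} {c} {d} {x} {y} {z} f ab (x∈ , bx) (y∈ , cy) (z∈ , dz) x≢y x≢z y≢z = go (front (x ∷ y ∷ z ∷ []) ((x≢y ∷ x≢z ∷ []) ∷ (y≢z ∷ []) ∷ [] ∷ []) (x∈ ∷ y∈ ∷ z∈ ∷ []))
      where
      go : (∃ λ R → Q ↭ (x ∷ y ∷ z ∷ []) ++ R × length (x ∷ y ∷ z ∷ []) + length R ≡ 6) → ⊥
      go (_ ∷ _ ∷ _ ∷ [] , q , refl) =
        run q (Four-↭ (swap a b ↭-refl) f) ((6 , 7) ∷ (0 , 6) ∷ (1 , 8) ∷ (2 , 9) ∷ []) sixK2Tree refl
          (~-sym ab ∷ ~-sym bx ∷ ~-sym cy ∷ ~-sym dz ∷ [])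

    no-sdr : ∀ {a b c d x y z w} → Four a b c d → x ∈ Q × a ~ x → y ∈ Q × b ~ y → z ∈ Q × c ~ z → w ∈ Q × d ~ w →
             x ≢ y → x ≢ z → x ≢ w → y ≢ z → y ≢ w → z ≢ w → ⊥
    no-sdr {x = x} {y} {z} {w} f (x∈ , ax) (y∈ , by) (z∈ , cz) (w∈ , dw) xy xz xw yz yw zw = go (front (x ∷ y ∷ z ∷ w ∷ []) ((xy ∷ xz ∷ xw ∷ []) ∷ (yz ∷ yw ∷ []) ∷ (zw ∷ []) ∷ [] ∷ []) (x∈ ∷ y∈ ∷ z∈ ∷ w∈ ∷ []))
      where
      go : (∃ λ R → Q ↭ (x ∷ y ∷ z ∷ w ∷ []) ++ R × length (x ∷ y ∷ z ∷ w ∷ []) + length R ≡ 6) → ⊥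
      go (_ ∷ _ ∷ [] , q , refl) =
        run q f ((0 , 6) ∷ (1 , 7) ∷ (2 , 8) ∷ (3 , 9) ∷ []) sixSDRTree refl (~-sym ax ∷ ~-sym by ∷ ~-sym cz ∷ ~-sym dw ∷ [])

    no-hub : ∀ {a b c d x y z} → Four a b c d → x ∈ Q × a ~ x → y ∈ Q × c ~ y → z ∈ Q × d ~ z → b ~ y → b ~ z →
             x ≢ y → x ≢ z → y ≢ z → ⊥
    no-hub {x = x} {y} {z} f (x∈ , ax) (y∈ , cy) (z∈ , dz) by bz x≢y x≢z y≢z = go (front (x ∷ y ∷ z ∷ []) ((x≢y ∷ x≢z ∷ []) ∷ (y≢z ∷ []) ∷ [] ∷ []) (x∈ ∷ y∈ ∷ z∈ ∷ []))
      where
      go : (∃ λ R → Q ↭ (x ∷ y ∷ z ∷ []) ++ R × length (x ∷ y ∷ z ∷ []) + length R ≡ 6) → ⊥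
      go (_ ∷ _ ∷ _ ∷ [] , q , refl) =
        run q f ((0 , 6) ∷ (1 , 7) ∷ (2 , 7) ∷ (1 , 8) ∷ (2 , 9) ∷ []) sixHubTree refl
          (~-sym ax ∷ ~-sym by ∷ ~-sym bz ∷ ~-sym cy ∷ ~-sym dz ∷ [])

    -- After `d`, `c`, `b` have received `x`, `y`, `z`, either `a` has a fourth representative, or
    -- it is adjacent to both `y` and `z`. In the latter case `c y a z b` is a P₅, the situation of
    -- `no-hub`.
    no-none : ∀ {a b c d} → Four a b c d → 3 ≤ deg a Q → 3 ≤ deg b Q → 2 ≤ deg c Q → 1 ≤ deg d Q → ⊥
    no-none {a} {b} {c} {d} f da db dc dd = go (reps₃ uQ dd dc db)
      where
      go : (∃ λ x → ∃ λ y → ∃ λ z → (x ∈ Q × d ~ x) × (y ∈ Q × c ~ y) × (z ∈ Q × b ~ z) × x ≢ y × x ≢ z × y ≢ z) → ⊥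
      go (x , y , z , dx , cy , bz , xy , xz , yz) with adj G a y in ay | adj G a z in az
      ... | true | true = no-hub {d} {a} {c} {b} (Four-↭ (↭-trans (shift d (a ∷ b ∷ c ∷ []) []) (prep d (prep a (swap b c ↭-refl)))) f) dx cy bz ay az xy xz yz
      ... | false | _ = let w , w∈ , w∉ , aw = fresh a (x ∷ z ∷ []) uQ da in
        no-sdr {a} {b} {c} {d} f (w∈ , aw) bz cy dx (λ e → w∉ (there (here e))) (λ e → absurd (≡.trans (sym (subst (a ~_) e aw)) ay)) (λ e → w∉ (here e))
          (λ e → yz (sym e)) (λ e → xz (sym e)) (λ e → xy (sym e))
        where
        absurd : true ≡ false → ⊥
        absurd ()
      ... | true | false = let w , w∈ , w∉ , aw = fresh a (x ∷ y ∷ []) uQ da in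
        no-sdr {a} {b} {c} {d} f (w∈ , aw) bz cy dx (λ e → absurd (≡.trans (sym (subst (a ~_) e aw)) az)) (λ e → w∉ (there (here e))) (λ e → w∉ (here e))
          (λ e → yz (sym e)) (λ e → xz (sym e)) (λ e → xy (sym e))
        where
        absurd : true ≡ false → ⊥
        absurd ()

  -- Six vertices span at most 15 edges, so with 25 in all the four back degrees sum to at least 10;
  -- that is the deficit 2 passed to `NumCases`. The bound 24 is 3 · 10 - 6.
  six-base : ∀ {Q t₀ t₁ t₂ t₃} → (let T = t₀ ∷ t₁ ∷ t₂ ∷ t₃ ∷ []) → Dense Q → Unique (Q ++ T) → length Q ≡ 6 → Peel Q T → size (T ++ Q) ≤ 24
  six-base {Q} {t₀} {t₁} {t₂} {t₃} dense u lQ peel@(b₀ ∷ b₁ ∷ b₂ ∷ b₃ ∷ []) = ≮⇒≥ λ big → conclude big (sound nval [] sixNumTree refl [])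
    where
    ts T : List V
    ts = t₁ ∷ t₂ ∷ t₃ ∷ []
    T = t₀ ∷ ts
    open Num Q t₀ ts
    open NumCases 4 2 sixPattern
    open Labelled t₀ ts using (val-edge; distinct⇒Unique)

    B : ℕ → ℕ
    B i = count nval (backAtoms 4 i)
    degs : All (λ t → deg t Q ≤ 3) T
    degs = Peel-deg peel
    thr : ∀ {i} → deg (at i) Q ≤ 3 → count nval ((i , 11) ∷ (i , 12) ∷ (i , 13) ∷ []) ≡ deg (at i) Q
    thr {i} le = thresholds (deg (at i) Q) le
    eq₀ : B 0 ≡ deg t₀ (ts ++ Q)
    eq₀ = cong (λ d → bit (adj G t₀ t₁) + (bit (adj G t₀ t₂) + (bit (adj G t₀ t₃) + d))) (thr {0} (All.lookup degs (here refl)))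
    eq₁ : B 1 ≡ deg t₁ (t₂ ∷ t₃ ∷ Q)
    eq₁ = cong (λ d → bit (adj G t₁ t₂) + (bit (adj G t₁ t₃) + d)) (thr {1} (All.lookup degs (there (here refl))))
    eq₂ : B 2 ≡ deg t₂ (t₃ ∷ Q)
    eq₂ = cong (λ d → bit (adj G t₂ t₃) + d) (thr {2} (All.lookup degs (there (there (here refl)))))
    eq₃ : B 3 ≡ deg t₃ Q
    eq₃ = thr {3} (All.lookup degs (there (there (there (here refl)))))
    B≤3 : All (λ i → B i ≤ 3) (upTo 4)
    B≤3 = ≤-trans (≤-reflexive eq₀) b₀ ∷ ≤-trans (≤-reflexive eq₁) b₁ ∷ ≤-trans (≤-reflexive eq₂) b₂ ∷ ≤-trans (≤-reflexive eq₃) b₃ ∷ []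
    total : 24 < size (T ++ Q) → 12 ≤ 2 + sum (map B (upTo 4))
    total big = lin 13 (≤-trans big (≤-trans (≤-reflexive split-size) (+-monoʳ-≤ (sum (map B (upTo 4)))
        (≤-trans (size≤triangle Q) (≤-reflexive (cong triangle lQ)))))) refl (final (sum (map B (upTo 4))))
      where
      final : ∀ s → s + 15 ≡ 2 + s + 13
      final = solve-∀
      regroup : ∀ a b c d e → a + (b + (c + (d + e))) ≡ a + (b + (c + (d + 0))) + e
      regroup = solve-∀
      split-size : size (T ++ Q) ≡ sum (map B (upTo 4)) + size Q
      split-size = ≡.trans (cong₂ _+_ (sym eq₀) (cong₂ _+_ (sym eq₁) (cong₂ _+_ (sym eq₂) (cong (_+ size Q) (sym eq₃)))))
        (regroup (B 0) (B 1) (B 2) (B 3) (size Q))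

    conclude : 24 < size (T ++ Q) → Outcome nval → ⊥
    conclude big (mono i k , _ , h ∷ [] , lt) = mono-contra i k h lt
    conclude big (low S , o , _ , lt) = <⇒≱ lt (≤-trans (subsum 4 2 B B≤3 (total big) S o) (≤-reflexive (sym (count-concatMap nval (backAtoms 4) S))))
    conclude big (pat p c , o , h , _) = found p h
      where
      i j k l : ℕ
      i = nthIndex (digits 4 c) 0
      j = nthIndex (digits 4 c) 1
      k = nthIndex (digits 4 c) 2
      l = nthIndex (digits 4 c) 3
      f : Four {Q} {T} dense u lQ (at i) (at j) (at k) (at l)
      f = distinct⇒Unique (Unique-++ʳ Q u) 4 ≤-refl (digits 4 c) o , Allₚ.map⁺ (All.universal (nth-∈ t₀ ts) (digits 4 c))
      uQ : Unique Q
      uQ = Unique-++ˡ Q u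
      many : ∀ r x → (suc r ≤ᵇ deg (at x) Q) ≡ true → suc r ≤ deg (at x) Q
      many r x = ≤ᵇ-true (suc r) (deg (at x) Q)
      i< : i < 10
      i< = m%n<n c 10
      j< : j < 10
      j< = m%n<n (c / 10) 10
      k< : k < 10
      k< = m%n<n (c / 10 / 10) 10
      l< : l < 10
      l< = m%n<n (c / 10 / 10 / 10) 10
      ij : nval (edge i j) ≡ true → at i ~ at j
      ij = nval-edge i j i< j<
      jk : nval (edge j k) ≡ true → at j ~ at k
      jk = nval-edge j k j< k<
      kl : nval (edge k l) ≡ true → at k ~ at l
      kl = nval-edge k l k< l<

      found : ∀ p → All (λ a → nval a ≡ true) (map (rename (digits 4 c)) (sixPattern p)) → ⊥
      found p4 (e ∷ e′ ∷ e″ ∷ m ∷ []) = let x , x∈ , ax = rep (many 0 i m) in no-p4 dense u lQ f (ij e) (jk e′) (kl e″) x∈ ax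
      found p3₁₂ (e ∷ e′ ∷ m ∷ m′ ∷ []) = let x , y , cx , dy , x≢y = reps₂ uQ (many 0 k m) (many 1 l m′) in
        no-p3 dense u lQ f (ij e) (jk e′) cx dy x≢y
      found p3₂₁ (e ∷ e′ ∷ m ∷ m′ ∷ []) = let y , x , dy , cx , y≢x = reps₂ uQ (many 0 l m′) (many 1 k m) in
        no-p3 dense u lQ f (ij e) (jk e′) cx dy (λ q → y≢x (sym q))
      found m2 (e ∷ e′ ∷ m ∷ m′ ∷ []) = let x , y , bx , dy , x≢y = reps₂ uQ (many 0 j m) (many 1 l m′) in
        no-m2 dense u lQ f (ij e) (kl e′) bx dy x≢y
      found k2₁₂₃ (e ∷ m ∷ m′ ∷ m″ ∷ []) = let x , y , z , bx , cy , dz , xy , xz , yz = reps₃ uQ (many 0 j m) (many 1 k m′) (many 2 l m″) in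
        no-k2 dense u lQ f (ij e) bx cy dz xy xz yz
      found k2₂₁₃ (e ∷ m ∷ m′ ∷ m″ ∷ []) = let y , x , z , cy , bx , dz , yx , yz , xz = reps₃ uQ (many 0 k m′) (many 1 j m) (many 2 l m″) in
        no-k2 dense u lQ f (ij e) bx cy dz (λ q → yx (sym q)) xz yz
      found k2₃₁₂ (e ∷ m ∷ m′ ∷ m″ ∷ []) = let y , z , x , cy , dz , bx , yz , yx , zx = reps₃ uQ (many 0 k m′) (many 1 l m″) (many 2 j m) in
        no-k2 dense u lQ f (ij e) bx cy dz (λ q → yx (sym q)) (λ q → zx (sym q)) yz
      found edgeless (m ∷ m′ ∷ m″ ∷ m‴ ∷ []) = no-none dense u lQ f (many 2 i m) (many 2 j m′) (many 1 k m″) (many 0 l m‴)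

data FivePattern : Set where
  p5 p4₁₂ p4₂₁ p3₁₂₃ p3₂₁₃ p3₃₁₂ m2₁₂₃ m2₁₃₂ m2₂₃₁ star₅ k2 edgeless : FivePattern

fivePattern : FivePattern → List Atom
fivePattern p5 = (0 , 1) ∷ (1 , 2) ∷ (2 , 3) ∷ (3 , 4) ∷ []
fivePattern p4₁₂ = (0 , 1) ∷ (1 , 2) ∷ (2 , 3) ∷ (3 , 11) ∷ (4 , 12) ∷ []
fivePattern p4₂₁ = (0 , 1) ∷ (1 , 2) ∷ (2 , 3) ∷ (3 , 12) ∷ (4 , 11) ∷ []
fivePattern p3₁₂₃ = (0 , 1) ∷ (1 , 2) ∷ (2 , 11) ∷ (3 , 12) ∷ (4 , 13) ∷ []
fivePattern p3₂₁₃ = (0 , 1) ∷ (1 , 2) ∷ (2 , 12) ∷ (3 , 11) ∷ (4 , 13) ∷ []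
fivePattern p3₃₁₂ = (0 , 1) ∷ (1 , 2) ∷ (2 , 13) ∷ (3 , 11) ∷ (4 , 12) ∷ []
fivePattern m2₁₂₃ = (0 , 1) ∷ (2 , 3) ∷ (1 , 11) ∷ (3 , 12) ∷ (4 , 13) ∷ []
fivePattern m2₁₃₂ = (0 , 1) ∷ (2 , 3) ∷ (1 , 11) ∷ (3 , 13) ∷ (4 , 12) ∷ []
fivePattern m2₂₃₁ = (0 , 1) ∷ (2 , 3) ∷ (1 , 12) ∷ (3 , 13) ∷ (4 , 11) ∷ []
fivePattern star₅ = (0 , 4) ∷ (1 , 4) ∷ (2 , 4) ∷ (3 , 4) ∷ (0 , 11) ∷ (1 , 12) ∷ (2 , 12) ∷ (3 , 12) ∷ (4 , 13) ∷ []
fivePattern k2 = (0 , 1) ∷ (1 , 13) ∷ (2 , 13) ∷ (3 , 13) ∷ (4 , 13) ∷ []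
fivePattern edgeless = (0 , 13) ∷ (1 , 13) ∷ (2 , 13) ∷ (3 , 13) ∷ (4 , 13) ∷ []

fiveNumTree : Tree (NumLeaf FivePattern)
fiveNumTree =
  split 4 11 (split 4 12 (split 4 13 (split 3 11 (split 3 12 (split 3 4 (split 2 11 (split 2 12 (split 2 3
  (split 1 11 (split 0 1 (leaf (pat m2₁₂₃ 42310)) (split 0 2 (leaf (pat p3₂₁₃ 41320)) (split 0 3 (leaf (pat
  p3₂₁₃ 41230)) (split 0 4 (leaf (pat m2₂₃₁ 14023)) (split 0 11 (split 0 12 (leaf (pat p3₃₁₂ 1432)) (leaf
  (low (0 ∷ [])))) (leaf (low (0 ∷ [])))))))) (split 1 12 (leaf (mono 1 1)) (split 1 4 (split 1 13 (leaf
  (mono 1 2)) (split 1 2 (split 0 1 (leaf (pat p4₁₂ 23410)) (split 0 2 (leaf (pat p4₁₂ 34120)) (split 0 3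
  (leaf (pat m2₁₃₂ 24130)) (split 0 4 (leaf (pat p4₁₂ 32140)) (split 0 11 (leaf (pat p4₂₁ 4123)) (leaf (low
  (0 ∷ [])))))))) (leaf (low (1 ∷ []))))) (split 1 13 (leaf (mono 1 2)) (leaf (low (1 ∷ []))))))) (split 2
  13 (split 1 2 (split 0 1 (leaf (pat p3₂₁₃ 43210)) (split 0 3 (leaf (pat m2₁₃₂ 42130)) (split 0 4 (leaf
  (pat m2₂₃₁ 32140)) (split 0 11 (leaf (pat m2₂₃₁ 2143)) (split 0 12 (leaf (mono 0 1)) (leaf (low (0 ∷
  [])))))))) (split 1 11 (split 0 1 (leaf (pat m2₁₂₃ 23410)) (split 0 2 (leaf (pat m2₂₃₁ 12034)) (split 0 3
  (leaf (pat p3₂₁₃ 21430)) (split 0 4 (leaf (pat p3₂₁₃ 21340)) (split 0 11 (split 0 12 (split 0 13 (split 1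
  3 (leaf (pat p3₁₂₃ 2431)) (split 1 4 (leaf (pat p3₁₂₃ 2341)) (split 1 12 (split 1 13 (leaf (pat k2
  21043)) (leaf (low (1 ∷ [])))) (leaf (low (1 ∷ [])))))) (leaf (low (0 ∷ [])))) (leaf (low (0 ∷ []))))
  (leaf (low (0 ∷ [])))))))) (split 1 12 (leaf (mono 1 1)) (split 1 13 (leaf (mono 1 2)) (leaf (low (1 ∷
  []))))))) (split 2 4 (split 1 2 (split 0 1 (leaf (pat p3₂₁₃ 43210)) (split 0 3 (leaf (pat p5 12430))
  (split 0 4 (leaf (pat m2₁₃₂ 34021)) (split 0 11 (leaf (pat m2₂₃₁ 4321)) (split 0 12 (leaf (mono 0 1))
  (leaf (low (0 ∷ [])))))))) (split 1 11 (split 0 1 (leaf (pat m2₁₃₂ 34210)) (split 0 2 (leaf (pat p4₂₁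
  13420)) (split 0 3 (leaf (pat p4₂₁ 12430)) (split 0 11 (split 0 12 (split 0 13 (leaf (pat p3₂₁₃ 1342))
  (split 0 4 (split 1 3 (leaf (pat m2₁₃₂ 24013)) (split 1 4 (leaf (pat star₅ 43201)) (split 1 12 (split 1
  13 (leaf (pat p3₂₁₃ 13240)) (leaf (low (1 ∷ [])))) (leaf (low (1 ∷ [])))))) (leaf (low (0 ∷ [])))))
  (split 0 13 (leaf (mono 0 2)) (leaf (low (0 ∷ []))))) (split 0 12 (leaf (mono 0 1)) (leaf (low (0 ∷
  [])))))))) (split 1 12 (leaf (mono 1 1)) (split 1 13 (leaf (mono 1 2)) (leaf (low (1 ∷ []))))))) (leaf
  (low (2 ∷ [])))))) (split 2 13 (leaf (mono 2 2)) (split 2 3 (split 2 4 (split 1 2 (split 0 1 (leaf (pat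
  p4₂₁ 34210)) (split 0 3 (leaf (pat p5 12430)) (split 0 4 (leaf (pat m2₁₃₂ 34021)) (split 0 11 (leaf (pat
  p3₂₁₃ 40321)) (split 0 12 (leaf (mono 0 1)) (leaf (low (0 ∷ [])))))))) (split 1 11 (split 0 1 (leaf (pat
  m2₁₃₂ 34210)) (split 0 2 (leaf (pat p4₂₁ 13420)) (split 0 3 (leaf (pat p4₂₁ 14230)) (split 0 4 (leaf (pat
  p4₂₁ 13240)) (split 0 11 (split 0 12 (leaf (pat p3₃₁₂ 1423)) (leaf (low (0 ∷ [])))) (leaf (low (0 ∷
  [])))))))) (split 1 12 (leaf (mono 1 1)) (split 1 13 (leaf (mono 1 2)) (leaf (low (1 ∷ []))))))) (leaf
  (low (2 ∷ [])))) (leaf (low (2 ∷ [])))))) (split 2 12 (leaf (mono 2 1)) (split 2 13 (leaf (mono 2 2))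
  (leaf (low (2 ∷ [])))))) (split 3 13 (split 2 11 (split 2 4 (split 2 12 (split 1 2 (split 0 1 (leaf (pat
  p3₁₂₃ 34210)) (split 0 3 (leaf (pat m2₂₃₁ 43021)) (split 0 4 (leaf (pat m2₁₂₃ 32140)) (split 0 11 (leaf
  (pat p3₂₁₃ 30421)) (split 0 12 (leaf (mono 0 1)) (leaf (low (0 ∷ [])))))))) (split 1 11 (split 0 1 (leaf
  (pat m2₁₂₃ 32410)) (split 0 2 (leaf (pat p3₂₁₃ 31420)) (split 0 3 (leaf (pat m2₂₃₁ 13024)) (split 0 4
  (leaf (pat p3₂₁₃ 31240)) (split 0 11 (split 0 12 (split 0 13 (split 1 3 (leaf (pat m2₂₃₁ 3124)) (split 1
  4 (leaf (pat p3₂₁₃ 30241)) (split 1 12 (split 1 13 (leaf (pat k2 31042)) (leaf (low (1 ∷ [])))) (leaf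
  (low (1 ∷ [])))))) (leaf (low (0 ∷ [])))) (leaf (low (0 ∷ [])))) (leaf (low (0 ∷ [])))))))) (split 1 12
  (leaf (mono 1 1)) (split 1 13 (leaf (mono 1 2)) (leaf (low (1 ∷ []))))))) (split 2 13 (leaf (mono 2 2))
  (split 2 3 (split 1 11 (split 0 1 (leaf (pat m2₁₂₃ 34210)) (split 0 2 (leaf (pat p3₂₁₃ 31420)) (split 0 3
  (leaf (pat p4₂₁ 14230)) (split 0 4 (leaf (pat p4₂₁ 13240)) (split 0 11 (split 0 12 (leaf (pat p3₃₁₂
  1423)) (leaf (low (0 ∷ [])))) (leaf (low (0 ∷ [])))))))) (split 1 12 (leaf (mono 1 1)) (split 1 3 (split
  1 13 (leaf (mono 1 2)) (split 1 2 (split 0 1 (leaf (pat p5 42310)) (split 0 2 (leaf (pat p4₁₂ 43120))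
  (split 0 3 (leaf (pat p4₁₂ 42130)) (split 0 4 (leaf (pat p5 31240)) (split 0 11 (leaf (pat p3₂₁₃ 40312))
  (leaf (low (0 ∷ [])))))))) (leaf (low (1 ∷ []))))) (split 1 13 (leaf (mono 1 2)) (leaf (low (1 ∷
  []))))))) (leaf (low (2 ∷ [])))))) (split 2 12 (split 2 3 (split 1 4 (split 0 1 (leaf (pat p3₂₁₃ 32410))
  (split 0 2 (leaf (pat m2₁₂₃ 34120)) (split 0 3 (leaf (pat m2₁₃₂ 24130)) (split 0 11 (leaf (pat m2₂₃₁
  3241)) (split 0 12 (leaf (mono 0 1)) (leaf (low (0 ∷ [])))))))) (split 1 11 (split 0 1 (leaf (pat m2₁₂₃
  42310)) (split 0 2 (leaf (pat p3₂₁₃ 41320)) (split 0 3 (leaf (pat p3₂₁₃ 41230)) (split 0 4 (leaf (pat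
  m2₂₃₁ 14023)) (split 0 11 (split 0 12 (split 0 13 (split 1 2 (leaf (pat p3₁₂₃ 40321)) (split 1 3 (leaf
  (pat p3₁₂₃ 40231)) (split 1 12 (split 1 13 (leaf (pat k2 41032)) (leaf (low (1 ∷ [])))) (leaf (low (1 ∷
  [])))))) (leaf (low (0 ∷ [])))) (leaf (low (0 ∷ [])))) (leaf (low (0 ∷ [])))))))) (split 1 12 (leaf (mono
  1 1)) (split 1 13 (leaf (mono 1 2)) (leaf (low (1 ∷ []))))))) (split 2 13 (split 1 2 (split 0 1 (leaf
  (pat p3₁₂₃ 34210)) (split 0 3 (leaf (pat m2₂₃₁ 43021)) (split 0 4 (leaf (pat m2₂₃₁ 32140)) (split 0 2
  (split 0 11 (leaf (pat p3₁₂₃ 43021)) (split 0 12 (leaf (mono 0 1)) (leaf (low (0 ∷ []))))) (split 0 11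
  (split 0 12 (split 0 13 (leaf (pat k2 43021)) (leaf (low (0 ∷ [])))) (leaf (low (0 ∷ [])))) (leaf (low (0
  ∷ [])))))))) (split 1 4 (split 0 1 (leaf (pat p3₂₁₃ 32410)) (split 0 2 (leaf (pat m2₁₂₃ 34120)) (split 0
  3 (leaf (pat m2₁₃₂ 24130)) (split 0 4 (split 0 11 (leaf (pat p3₁₂₃ 23041)) (split 0 12 (leaf (mono 0 1))
  (leaf (low (0 ∷ []))))) (split 0 11 (split 0 12 (split 0 13 (leaf (pat k2 32041)) (leaf (low (0 ∷ []))))
  (leaf (low (0 ∷ [])))) (leaf (low (0 ∷ [])))))))) (split 1 3 (split 1 11 (split 0 1 (leaf (pat p3₃₁₂
  42310)) (split 0 2 (leaf (pat m2₂₃₁ 43120)) (split 0 3 (leaf (pat p3₁₂₃ 24130)) (split 0 4 (leaf (pat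
  m2₁₃₂ 24013)) (split 0 11 (split 0 12 (split 0 13 (leaf (pat k2 42031)) (leaf (low (0 ∷ [])))) (leaf (low
  (0 ∷ [])))) (leaf (low (0 ∷ [])))))))) (split 1 12 (leaf (mono 1 1)) (leaf (low (1 ∷ []))))) (split 1 11
  (split 1 12 (split 1 13 (split 0 1 (leaf (pat k2 43210)) (split 0 2 (leaf (pat k2 43120)) (split 0 3
  (leaf (pat k2 42130)) (split 0 4 (leaf (pat k2 32140)) (split 0 11 (split 0 12 (split 0 13 (leaf (pat
  edgeless 43210)) (leaf (low (0 ∷ [])))) (leaf (low (0 ∷ [])))) (leaf (low (0 ∷ [])))))))) (leaf (low (1 ∷
  [])))) (leaf (low (1 ∷ [])))) (leaf (low (1 ∷ []))))))) (leaf (low (2 ∷ []))))) (split 2 13 (leaf (mono 2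
  2)) (leaf (low (2 ∷ [])))))) (split 2 12 (leaf (mono 2 1)) (split 2 13 (leaf (mono 2 2)) (leaf (low (2 ∷
  [])))))) (leaf (low (3 ∷ []))))) (split 3 13 (leaf (mono 3 2)) (leaf (low (3 ∷ []))))) (split 3 12 (leaf
  (mono 3 1)) (leaf (low (3 ∷ []))))) (leaf (low (4 ∷ [])))) (leaf (low (4 ∷ [])))) (leaf (low (4 ∷ [])))

fiveSDRTree : Tree (ℕ ⊎ ℕ)
fiveSDRTree =
  split 1 5 (split 0 9 (hit 8342790516) (split 1 9 (split 0 6 (hit 8342791605) (split 2 6 (hit 8340591627)
  (split 3 6 (hit 7240591638) (miss 6)))) (split 2 9 (split 0 7 (hit 8341692705) (split 1 7 (hit
  8340592716) (split 3 7 (hit 6150492738) (miss 7)))) (miss 9)))) (split 2 5 (split 3 5 (split 0 9 (hit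
  8341690527) (split 4 9 (hit 8352794016) (split 1 9 (split 0 6 (hit 8352791604) (split 2 6 (hit
  8350491627) (split 3 6 (hit 7250491638) (miss 6)))) (miss 9)))) (split 4 5 (split 0 9 (hit 8341690527)
  (split 4 9 (hit 8301694527) (split 1 9 (split 0 6 (hit 8342791605) (split 2 6 (hit 8345091627) (split 3 6
  (hit 7254091638) (miss 6)))) (miss 9)))) (miss 5))) (split 3 5 (split 4 5 (split 0 9 (hit 7241690538)
  (split 4 9 (hit 7201694538) (split 1 9 (split 0 6 (hit 8342791605) (split 2 6 (hit 8354091627) (split 3 6
  (hit 7245091638) (miss 6)))) (miss 9)))) (miss 5)) (miss 5)))

-- For `fiveSDRTree` a leaf `miss i` concerns a peeled vertex, at positions 5 to 9, and says that it
-- has fewer than three neighbours in the core 0 to 4.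
module FewLeaf where

  ok : ℕ → Bool
  ok i = (4 <ᵇ i) ∧ (i <ᵇ 10)

  req lim : ℕ → List Atom
  req i = []
  lim i = star i (upTo 5)

  bnd : ℕ → ℕ
  bnd i = 3

-- Core on five vertices

module Five {n} (G : Graph n) (free : Paths.No2P5 G) where

  open Embedding G free
  open Cores G
  open Matchings G free
  open Peeled G

  -- L contains K₃ + (K₂ ∪ K̄ₖ) as a spanning subgraph.
  record Extremal (L : List V) : Set where
    constructor extremal
    field
      {h₁ h₂ h₃ a b} : V
      {R} : List V
      perm : L ↭ h₁ ∷ h₂ ∷ h₃ ∷ a ∷ b ∷ R
      core5 : ∀ {ys} → Labelled.Holds h₁ (h₂ ∷ h₃ ∷ a ∷ b ∷ ys) (clique (upTo 5))
      joined : ∀ {r} → r ∈ R → h₁ ~ r × h₂ ~ r × h₃ ~ r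
      -- Taking away any one outer vertex must leave four, the number that `hubs-only` asks for.
      large : 5 ≤ length R

  module _ {Q T : List V} (dense : Dense Q) (u : Unique (Q ++ T)) (lQ : length Q ≡ 5) where

    private
      uQ : Unique Q
      uQ = Unique-++ˡ Q u

    -- With five vertices a missing edge at `x` leaves it degree at most 3, so the core is K₅.
    complete : ∀ {x y} → x ∈ Q → y ∈ Q → x ≢ y → x ~ y
    complete {x} {y} x∈ y∈ x≢y = go (split-off ((x≢y ∷ []) ∷ [] ∷ []) (x∈ ∷ y∈ ∷ []))
      where
      go : (∃ λ R → Q ↭ x ∷ y ∷ R) → x ~ y
      go (R , q) with adj G x y in eq
      ... | true = refl
      ... | false = ⊥-elim (<⇒≱ {deg x R} {4} (s≤s (≤-trans (deg≤length x R) (≤-reflexive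
            (suc-injective (suc-injective (≡.trans (sym (↭-length q)) lQ))))))
          (≤-trans (dense x∈) (≤-reflexive (≡.trans (deg-↭ x q) (cong₂ (λ b c → bit b + (bit c + deg x R)) (irrefl G x) eq)))))

    Five′ : V → V → V → V → V → Set
    Five′ a b c d e = Unique (a ∷ b ∷ c ∷ d ∷ e ∷ []) × All (_∈ T) (a ∷ b ∷ c ∷ d ∷ e ∷ [])

    Five′-↭ : ∀ {a b c d e a′ b′ c′ d′ e′} → a ∷ b ∷ c ∷ d ∷ e ∷ [] ↭ a′ ∷ b′ ∷ c′ ∷ d′ ∷ e′ ∷ [] → Five′ a b c d e → Five′ a′ b′ c′ d′ e′
    Five′-↭ p (u , i) = Unique-↭ p u , All-resp-↭ p i

    front : ∀ X → Unique X → All (_∈ Q) X → ∃ λ R → Q ↭ X ++ R × length X + length R ≡ 5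
    front X uX X⊆Q = let R , q = split-off uX X⊆Q in R , q , ≡.trans (sym (length-++ X)) (≡.trans (sym (↭-length q)) lQ)

    cliqueHolds : ∀ {q₀ q₁ q₂ q₃ q₄ ys} → Q ↭ q₀ ∷ q₁ ∷ q₂ ∷ q₃ ∷ q₄ ∷ [] → Labelled.Holds q₀ (q₁ ∷ q₂ ∷ q₃ ∷ q₄ ∷ ys) (clique (upTo 5))
    cliqueHolds {q₀} {q₁} {q₂} {q₃} {q₄} {ys} q = go (Unique-↭ q uQ)
      where
      i₀ : q₀ ∈ Q
      i₀ = ∈-resp-↭ (↭-sym q) (here refl)
      i₁ : q₁ ∈ Q
      i₁ = ∈-resp-↭ (↭-sym q) (there (here refl))
      i₂ : q₂ ∈ Q
      i₂ = ∈-resp-↭ (↭-sym q) (there (there (here refl)))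
      i₃ : q₃ ∈ Q
      i₃ = ∈-resp-↭ (↭-sym q) (there (there (there (here refl))))
      i₄ : q₄ ∈ Q
      i₄ = ∈-resp-↭ (↭-sym q) (there (there (there (there (here refl)))))
      go : Unique (q₀ ∷ q₁ ∷ q₂ ∷ q₃ ∷ q₄ ∷ []) → Labelled.Holds q₀ (q₁ ∷ q₂ ∷ q₃ ∷ q₄ ∷ ys) (clique (upTo 5))
      go ((n₀₁ ∷ n₀₂ ∷ n₀₃ ∷ n₀₄ ∷ []) ∷ (n₁₂ ∷ n₁₃ ∷ n₁₄ ∷ []) ∷ (n₂₃ ∷ n₂₄ ∷ []) ∷ (n₃₄ ∷ []) ∷ [] ∷ []) =
        complete i₀ i₁ n₀₁ ∷ complete i₀ i₂ n₀₂ ∷ complete i₀ i₃ n₀₃ ∷ complete i₀ i₄ n₀₄ ∷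
        complete i₁ i₂ n₁₂ ∷ complete i₁ i₃ n₁₃ ∷ complete i₁ i₄ n₁₄ ∷
        complete i₂ i₃ n₂₃ ∷ complete i₂ i₄ n₂₄ ∷ complete i₃ i₄ n₃₄ ∷ []

    five-unique : ∀ {q₀ q₁ q₂ q₃ q₄ a b c d e} → Q ↭ q₀ ∷ q₁ ∷ q₂ ∷ q₃ ∷ q₄ ∷ [] → Five′ a b c d e →
                  Unique (q₀ ∷ q₁ ∷ q₂ ∷ q₃ ∷ q₄ ∷ a ∷ b ∷ c ∷ d ∷ e ∷ [])
    five-unique q (uf , f⊆T) = Unique-sub (_ ∷ _ ∷ _ ∷ _ ∷ _ ∷ []) (Unique-↭ (++⁺ʳ T q) u) uf f⊆T

    run : ∀ {q₀ q₁ q₂ q₃ q₄ a b c d e} → Q ↭ q₀ ∷ q₁ ∷ q₂ ∷ q₃ ∷ q₄ ∷ [] → Five′ a b c d e →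
          (T₀ : List Atom) (κ : ℕ) → Refute.check {⊥} ⊥-elim ⊥-elim ⊥-elim ⊥-elim (T₀ ++ clique (upTo 5)) [] (leaf (inj₁ κ)) ≡ true →
          Labelled.Holds q₀ (q₁ ∷ q₂ ∷ q₃ ∷ q₄ ∷ a ∷ b ∷ c ∷ d ∷ e ∷ []) T₀ → ⊥
    run q f T₀ κ chk h = exhibit _ _ refl (five-unique q f) (T₀ ++ clique (upTo 5)) κ chk (Allₚ.++⁺ h (cliqueHolds q))

    Rep : V → V → Set
    Rep t x = x ∈ Q × t ~ x

    no-p5 : ∀ {a b c d e} → Five′ a b c d e → a ~ b → b ~ c → c ~ d → d ~ e → ⊥
    no-p5 {a} {b} {c} {d} {e} f ab bc cd de =
        go (front ([]) [] ([]))
      where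
      go : (∃ λ R → Q ↭ ([]) ++ R × 0 + length R ≡ 5) → ⊥
      go (_ ∷ _ ∷ _ ∷ _ ∷ _ ∷ [] , q , refl) = run q f ((5 , 6) ∷ (6 , 7) ∷ (7 , 8) ∷ (8 , 9) ∷ []) 4321098765 refl (ab ∷ bc ∷ cd ∷ de ∷ [])

    no-p4 : ∀ {a b c d e x y} → Five′ a b c d e → a ~ b → b ~ c → c ~ d → Rep d x → Rep e y → x ≢ y → ⊥
    no-p4 {a} {b} {c} {d} {e} {x} {y} f ab bc cd (x∈ , dx) (y∈ , ey) xy =
        go (front (x ∷ y ∷ []) ((xy ∷ []) ∷ [] ∷ []) (x∈ ∷ y∈ ∷ []))
      where
      go : (∃ λ R → Q ↭ (x ∷ y ∷ []) ++ R × 2 + length R ≡ 5) → ⊥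
      go (_ ∷ _ ∷ _ ∷ [] , q , refl) = run q f ((5 , 6) ∷ (6 , 7) ∷ (7 , 8) ∷ (0 , 8) ∷ (1 , 9) ∷ []) 4321908765 refl (ab ∷ bc ∷ cd ∷ ~-sym dx ∷ ~-sym ey ∷ [])

    no-p3 : ∀ {a b c d e x y z} → Five′ a b c d e → a ~ b → b ~ c → Rep c x → Rep d y → Rep e z → x ≢ y × x ≢ z × y ≢ z → ⊥
    no-p3 {a} {b} {c} {d} {e} {x} {y} {z} f ab bc (x∈ , cx) (y∈ , dy) (z∈ , ez) (xy , xz , yz) =
        go (front (x ∷ y ∷ z ∷ []) ((xy ∷ xz ∷ []) ∷ (yz ∷ []) ∷ [] ∷ []) (x∈ ∷ y∈ ∷ z∈ ∷ []))
      where
      go : (∃ λ R → Q ↭ (x ∷ y ∷ z ∷ []) ++ R × 3 + length R ≡ 5) → ⊥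
      go (_ ∷ _ ∷ [] , q , refl) = run q f ((5 , 6) ∷ (6 , 7) ∷ (0 , 7) ∷ (1 , 8) ∷ (2 , 9) ∷ []) 9241830765 refl (ab ∷ bc ∷ ~-sym cx ∷ ~-sym dy ∷ ~-sym ez ∷ [])

    no-m2 : ∀ {a b c d e x y z} → Five′ a b c d e → a ~ b → c ~ d → Rep b x → Rep d y → Rep e z → x ≢ y × x ≢ z × y ≢ z → ⊥
    no-m2 {a} {b} {c} {d} {e} {x} {y} {z} f ab cd (x∈ , bx) (y∈ , dy) (z∈ , ez) (xy , xz , yz) =
        go (front (x ∷ y ∷ z ∷ []) ((xy ∷ xz ∷ []) ∷ (yz ∷ []) ∷ [] ∷ []) (x∈ ∷ y∈ ∷ z∈ ∷ []))
      where
      go : (∃ λ R → Q ↭ (x ∷ y ∷ z ∷ []) ++ R × 3 + length R ≡ 5) → ⊥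
      go (_ ∷ _ ∷ [] , q , refl) = run q f ((5 , 6) ∷ (7 , 8) ∷ (0 , 6) ∷ (1 , 8) ∷ (2 , 9) ∷ []) 4318792065 refl (ab ∷ cd ∷ ~-sym bx ∷ ~-sym dy ∷ ~-sym ez ∷ [])

    no-k2-sdr : ∀ {a b c d e x y z w} → Five′ a b c d e → a ~ b → Rep b x → Rep c y → Rep d z → Rep e w → (x ≢ y × x ≢ z × x ≢ w) × (y ≢ z × y ≢ w) × z ≢ w → ⊥
    no-k2-sdr {a} {b} {c} {d} {e} {x} {y} {z} {w} f ab (x∈ , bx) (y∈ , cy) (z∈ , dz) (w∈ , ew) ((xy , xz , xw) , (yz , yw) , zw) =
        go (front (x ∷ y ∷ z ∷ w ∷ []) ((xy ∷ xz ∷ xw ∷ []) ∷ (yz ∷ yw ∷ []) ∷ (zw ∷ []) ∷ [] ∷ []) (x∈ ∷ y∈ ∷ z∈ ∷ w∈ ∷ []))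
      where
      go : (∃ λ R → Q ↭ (x ∷ y ∷ z ∷ w ∷ []) ++ R × 4 + length R ≡ 5) → ⊥
      go (_ ∷ [] , q , refl) = run q f ((5 , 6) ∷ (0 , 6) ∷ (1 , 7) ∷ (2 , 8) ∷ (3 , 9) ∷ []) 9342871065 refl (ab ∷ ~-sym bx ∷ ~-sym cy ∷ ~-sym dz ∷ ~-sym ew ∷ [])

    no-k2-same : ∀ {a b c d e x y z} → Five′ a b c d e → a ~ b → Rep b x → Rep c y → d ~ y → Rep d z → e ~ z → x ≢ y × x ≢ z × y ≢ z → ⊥
    no-k2-same {a} {b} {c} {d} {e} {x} {y} {z} f ab (x∈ , bx) (y∈ , cy) dy (z∈ , dz) ez (xy , xz , yz) =
        go (front (x ∷ y ∷ z ∷ []) ((xy ∷ xz ∷ []) ∷ (yz ∷ []) ∷ [] ∷ []) (x∈ ∷ y∈ ∷ z∈ ∷ []))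
      where
      go : (∃ λ R → Q ↭ (x ∷ y ∷ z ∷ []) ++ R × 3 + length R ≡ 5) → ⊥
      go (_ ∷ _ ∷ [] , q , refl) = run q f ((5 , 6) ∷ (0 , 6) ∷ (1 , 7) ∷ (1 , 8) ∷ (2 , 8) ∷ (2 , 9) ∷ []) 9281743065 refl (ab ∷ ~-sym bx ∷ ~-sym cy ∷ ~-sym dy ∷ ~-sym dz ∷ ~-sym ez ∷ [])

    no-star-same : ∀ {a b c d e x y z} → Five′ a b c d e → d ~ e → Rep a x → Rep b y → Rep c x → c ~ y → Rep e z → x ≢ y × x ≢ z × y ≢ z → ⊥
    no-star-same {a} {b} {c} {d} {e} {x} {y} {z} f de (x∈ , ax) (y∈ , by) (_ , cx) cy (z∈ , ez) (xy , xz , yz) =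
        go (front (x ∷ y ∷ z ∷ []) ((xy ∷ xz ∷ []) ∷ (yz ∷ []) ∷ [] ∷ []) (x∈ ∷ y∈ ∷ z∈ ∷ []))
      where
      go : (∃ λ R → Q ↭ (x ∷ y ∷ z ∷ []) ++ R × 3 + length R ≡ 5) → ⊥
      go (_ ∷ _ ∷ [] , q , refl) = run q f ((8 , 9) ∷ (0 , 5) ∷ (1 , 6) ∷ (0 , 7) ∷ (1 , 7) ∷ (2 , 9) ∷ []) 4329861705 refl (de ∷ ~-sym ax ∷ ~-sym by ∷ ~-sym cx ∷ ~-sym cy ∷ ~-sym ez ∷ [])

    Distinct : (x y z w : V) → Set
    Distinct x y z w = (x ≢ y × x ≢ z × x ≢ w) × (y ≢ z × y ≢ w) × z ≢ w

    SDR : V → V → V → V → Set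
    SDR a b c d = ∃ λ x → ∃ λ y → ∃ λ z → ∃ λ w → (Rep a x × Rep b y × Rep c z × Rep d w) × Distinct x y z w

    Full : V → V → V → V → Set
    Full s x y z = s ~ x × s ~ y × s ~ z

    -- If `s` misses one of the three, only two vertices need excluding, and three neighbours leave
    -- another one.
    spread : ∀ {s} x y z → 3 ≤ deg s Q → (∃ λ w → Rep s w × w ≢ x × w ≢ y × w ≢ z) ⊎ Full s x y z
    spread {s} x y z le with adj G s x in sx | adj G s y in sy | adj G s z in sz
    ... | true | true | true = inj₂ (refl , refl , refl)
    ... | false | _ | _ = let w , w∈ , w∉ , sw = fresh s (y ∷ z ∷ []) uQ le in
      inj₁ (w , (w∈ , sw) , (λ e → false≢ (subst (s ~_) e sw) sx) , (λ e → w∉ (here e)) , λ e → w∉ (there (here e)))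
      where
      false≢ : ∀ {b} → b ≡ true → b ≡ false → ⊥
      false≢ refl ()
    ... | true | false | _ = let w , w∈ , w∉ , sw = fresh s (x ∷ z ∷ []) uQ le in
      inj₁ (w , (w∈ , sw) , (λ e → w∉ (here e)) , (λ e → false≢ (subst (s ~_) e sw) sy) , λ e → w∉ (there (here e)))
      where
      false≢ : ∀ {b} → b ≡ true → b ≡ false → ⊥
      false≢ refl ()
    ... | true | true | false = let w , w∈ , w∉ , sw = fresh s (x ∷ y ∷ []) uQ le in
      inj₁ (w , (w∈ , sw) , (λ e → w∉ (here e)) , (λ e → w∉ (there (here e))) , λ e → false≢ (subst (s ~_) e sw) sz)
      where
      false≢ : ∀ {b} → b ≡ true → b ≡ false → ⊥
      false≢ refl ()

    Same : V → V → V → V → Set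
    Same a b c d = ∃ λ x → ∃ λ y → ∃ λ z → (x ∈ Q × y ∈ Q × z ∈ Q) × (x ≢ y × x ≢ z × y ≢ z) ×
      Full a x y z × Full b x y z × Full c x y z × Full d x y z

    -- A case of Hall's theorem. `a`, `b`, `c` receive `x`, `y`, `z` greedily. If `d` is confined to
    -- these, any of the other three with a neighbour elsewhere moves there and cedes its
    -- representative to `d`; if none can move, all four are joined to the same triple.
    hall : ∀ {a b c d} → 3 ≤ deg a Q → 3 ≤ deg b Q → 3 ≤ deg c Q → 3 ≤ deg d Q → SDR a b c d ⊎ Same a b c d
    hall {a} {b} {c} {d} da db dc dd = go (reps₃ uQ (≤-trans (m≤n+m 1 2) da) (≤-trans (n≤1+n 2) db) dc)
      where
      go : (∃ λ x → ∃ λ y → ∃ λ z → Rep a x × Rep b y × Rep c z × x ≢ y × x ≢ z × y ≢ z) → SDR a b c d ⊎ Same a b c d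
      go (x , y , z , ax@(x∈ , _) , by@(y∈ , _) , cz@(z∈ , _) , xy , xz , yz) with spread x y z dd
      ... | inj₁ (w , dw , wx , wy , wz) =
        inj₁ (x , y , z , w , (ax , by , cz , dw) , (xy , xz , λ e → wx (sym e)) , (yz , λ e → wy (sym e)) , λ e → wz (sym e))
      ... | inj₂ fd@(dx , dy , dz) with spread x y z da
      ... | inj₁ (w , aw , wx , wy , wz) =
        inj₁ (w , y , z , x , (aw , by , cz , (x∈ , dx)) , (wy , wz , wx) , (yz , λ e → xy (sym e)) , λ e → xz (sym e))
      ... | inj₂ fa with spread x y z db
      ... | inj₁ (w , bw , wx , wy , wz) =
        inj₁ (x , w , z , y , (ax , bw , cz , (y∈ , dy)) , ((λ e → wx (sym e)) , xz , xy) , (wz , wy) , λ e → yz (sym e))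
      ... | inj₂ fb with spread x y z dc
      ... | inj₁ (w , cw , wx , wy , wz) =
        inj₁ (x , y , w , z , (ax , by , cw , (z∈ , dz)) , (xy , (λ e → wx (sym e)) , xz) , ((λ e → wy (sym e)) , yz) , wz)
      ... | inj₂ fc = inj₂ (x , y , z , (x∈ , y∈ , z∈) , (xy , xz , yz) , fa , fb , fc , fd)

    no-k2 : ∀ {a b c d e} → Five′ a b c d e → a ~ b → 3 ≤ deg b Q → 3 ≤ deg c Q → 3 ≤ deg d Q → 3 ≤ deg e Q → ⊥
    no-k2 {a} {b} {c} {d} {e} f ab db dc dd de = go (hall db dc dd de)
      where
      go : SDR b c d e ⊎ Same b c d e → ⊥
      go (inj₁ (x , y , z , w , (bx , cy , dz , ew) , dist)) = no-k2-sdr f ab bx cy dz ew dist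
      go (inj₂ (x , y , z , (x∈ , y∈ , z∈) , (xy , xz , yz) , (bx , _) , (_ , cy , _) , (_ , dy , dz) , (_ , _ , ez))) =
        no-k2-same f ab (x∈ , bx) (y∈ , cy) dy (z∈ , dz) ez (xy , xz , yz)

    -- Let `x`, `y` represent `a`, `b`. If `c` misses one of them it has a third representative, and
    -- the path `d e a` makes this an instance of `no-p3`. Otherwise `a x c y b` is a P₅, and `d e`
    -- continues into the core through a further neighbour of `e`.
    no-star : ∀ {a b c d e} → Five′ a b c d e → a ~ e → b ~ e → c ~ e → d ~ e →
              1 ≤ deg a Q → 2 ≤ deg b Q → 2 ≤ deg c Q → 3 ≤ deg e Q → ⊥
    no-star {a} {b} {c} {d} {e} f ae be ce de da db dc dde = go (reps₂ uQ da db)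
      where
      go : (∃ λ x → ∃ λ y → Rep a x × Rep b y × x ≢ y) → ⊥
      go (x , y , ax , by , xy) = next (fresh e (x ∷ y ∷ []) uQ dde) (adj G c x) refl (adj G c y) refl
        where
        other : (∃ λ z → z ∈ Q × z ∉ y ∷ [] × c ~ z) → ¬ (c ~ x) → ⊥
        other (z , z∈ , z∉ , cz) ¬cx = no-p3 (Five′-↭ reorder f) de (~-sym ae) ax by (z∈ , cz) (xy , (λ { refl → ¬cx cz }) , λ { refl → z∉ (here refl) })
          where
          reorder : a ∷ b ∷ c ∷ d ∷ e ∷ [] ↭ d ∷ e ∷ a ∷ b ∷ c ∷ []
          reorder = ++-comm (a ∷ b ∷ c ∷ []) (d ∷ e ∷ [])
        other′ : (∃ λ z → z ∈ Q × z ∉ x ∷ [] × c ~ z) → ¬ (c ~ y) → ⊥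
        other′ (z , z∈ , z∉ , cz) ¬cy = no-p3 (Five′-↭ (++-comm (a ∷ b ∷ c ∷ []) (d ∷ e ∷ [])) f) de (~-sym ae) ax by (z∈ , cz)
          (xy , (λ { refl → z∉ (here refl) }) , λ { refl → ¬cy cz })
        clash : ∀ {β} → β ≡ false → ¬ (β ≡ true)
        clash refl ()
        next : (∃ λ w → w ∈ Q × w ∉ x ∷ y ∷ [] × e ~ w) → ∀ β → adj G c x ≡ β → ∀ γ → adj G c y ≡ γ → ⊥
        next _ false cx _ _ = other (fresh c (y ∷ []) uQ dc) (clash cx)
        next _ true _ false cy = other′ (fresh c (x ∷ []) uQ dc) (clash cy)
        next (w , w∈ , w∉ , ew) true cx true cy =
          no-star-same f de ax by (proj₁ ax , cx) cy (w∈ , ew) (xy , (λ { refl → w∉ (here refl) }) , λ { refl → w∉ (there (here refl)) })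

    no-sdr : ∀ {a b c d e x y z w} → Five′ a b c d e → (∀ {t} → t ∈ a ∷ b ∷ c ∷ d ∷ e ∷ [] → 3 ≤ deg t Q) →
             Rep a x → Rep b y → Rep c z → Rep d w → Distinct x y z w → ⊥
    no-sdr {a} {b} {c} {d} {e} {x} {y} {z} {w} f three (x∈ , ax) (y∈ , by) (z∈ , cz) (w∈ , dw) ((xy , xz , xw) , (yz , yw) , zw) =
        go (front (x ∷ y ∷ z ∷ w ∷ []) ((xy ∷ xz ∷ xw ∷ []) ∷ (yz ∷ yw ∷ []) ∷ (zw ∷ []) ∷ [] ∷ []) (x∈ ∷ y∈ ∷ z∈ ∷ w∈ ∷ []))
      where
      go : (∃ λ R → Q ↭ x ∷ y ∷ z ∷ w ∷ R × 4 + length R ≡ 5) → ⊥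
      go (v ∷ [] , q , refl) = conclude (Refute.refute ok req lim bnd x xs refl (five-unique q f)
          ((0 , 5) ∷ (1 , 6) ∷ (2 , 7) ∷ (3 , 8) ∷ clique (upTo 5)) fiveSDRTree refl
          (~-sym ax ∷ ~-sym by ∷ ~-sym cz ∷ ~-sym dw ∷ cliqueHolds q))
        where
        open FewLeaf
        xs : List V
        xs = y ∷ z ∷ w ∷ v ∷ a ∷ b ∷ c ∷ d ∷ e ∷ []
        open Labelled x xs
        late : ∀ i → (4 <ᵇ i) ∧ (i <ᵇ 10) ≡ true → at i ∈ a ∷ b ∷ c ∷ d ∷ e ∷ []
        late (suc (suc (suc (suc (suc i))))) o = nth-∈ a (b ∷ c ∷ d ∷ e ∷ []) i
        conclude : Cases.Outcome ok req lim bnd val → ⊥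
        conclude (i , o , _ , lt) = <⇒≱ lt (≤-trans (three (late i o))
          (≤-reflexive (≡.trans (deg-↭ (at i) q) (sym (count-star i (upTo 5))))))

    -- Four distinct representatives are excluded by `no-sdr`, so `hall` yields a triple joined to
    -- `a`, `b`, `c`, `d`. A neighbour of `e` off the triple would complete such a system with `a`,
    -- `b`, `c`. The triple becomes the hubs and the other two core vertices the edge K₂.
    all-same : ∀ {a b c d e} → T ↭ a ∷ b ∷ c ∷ d ∷ e ∷ [] → Five′ a b c d e → (∀ {t} → t ∈ a ∷ b ∷ c ∷ d ∷ e ∷ [] → 3 ≤ deg t Q) → Extremal (T ++ Q)
    all-same {a} {b} {c} {d} {e} pT f three = go (hall (three (here refl)) (three (there (here refl))) (three (there (there (here refl))))
        (three (there (there (there (here refl))))))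
      where
      last : ∀ {x y z} → x ∈ Q × y ∈ Q × z ∈ Q → (x ≢ y × x ≢ z × y ≢ z) → Full a x y z → Full b x y z → Full c x y z → Full d x y z →
             (∃ λ w → Rep e w × w ≢ x × w ≢ y × w ≢ z) ⊎ Full e x y z → Extremal (T ++ Q)
      last {x} {y} {z} (x∈ , y∈ , z∈) (xy , xz , yz) (ax , _) (_ , by , _) (_ , _ , cz) _ (inj₁ (w , ew , wx , wy , wz)) =
        ⊥-elim (no-sdr {a} {b} {c} {e} {d} (Five′-↭ (prep a (prep b (prep c (swap d e ↭-refl)))) f)
          (λ t∈ → three (∈-resp-↭ (prep a (prep b (prep c (swap e d ↭-refl)))) t∈)) (x∈ , ax) (y∈ , by) (z∈ , cz) ew
          ((xy , xz , λ q → wx (sym q)) , (yz , λ q → wy (sym q)) , λ q → wz (sym q)))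
      last {x} {y} {z} (x∈ , y∈ , z∈) (xy , xz , yz) fa fb fc fd (inj₂ fe) =
          build (front (x ∷ y ∷ z ∷ []) ((xy ∷ xz ∷ []) ∷ (yz ∷ []) ∷ [] ∷ []) (x∈ ∷ y∈ ∷ z∈ ∷ []))
        where
        flip : ∀ {t} → Full t x y z → x ~ t × y ~ t × z ~ t
        flip (p , q , r) = ~-sym p , ~-sym q , ~-sym r
        joins : ∀ {r} → r ∈ a ∷ b ∷ c ∷ d ∷ e ∷ [] → x ~ r × y ~ r × z ~ r
        joins (here refl) = flip fa
        joins (there (here refl)) = flip fb
        joins (there (there (here refl))) = flip fc
        joins (there (there (there (here refl)))) = flip fd
        joins (there (there (there (there (here refl))))) = flip fe
        build : (∃ λ R → Q ↭ x ∷ y ∷ z ∷ R × 3 + length R ≡ 5) → Extremal (T ++ Q)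
        build (v ∷ w ∷ [] , q , refl) =
          extremal {h₁ = x} {y} {z} {v} {w} {a ∷ b ∷ c ∷ d ∷ e ∷ []} (↭-trans (++-comm T Q) (++⁺ q pT)) (λ {ys} → cliqueHolds {ys = ys} q) joins ≤-refl
      go : SDR a b c d ⊎ Same a b c d → Extremal (T ++ Q)
      go (inj₁ (x , y , z , w , (ax , by , cz , dw) , dist)) = ⊥-elim (no-sdr f three ax by cz dw dist)
      go (inj₂ (x , y , z , i , ne , fa , fb , fc , fd)) = last i ne fa fb fc fd (spread x y z (three (there (there (there (there (here refl)))))))

  -- K₅ has 10 edges, so with more than 24 the five back degrees sum to at least 15: all equal 3,
  -- and the admissible deficit is 0.
  five-base : ∀ {Q t₀ t₁ t₂ t₃ t₄} → (let T = t₀ ∷ t₁ ∷ t₂ ∷ t₃ ∷ t₄ ∷ []) → Dense Q → Unique (Q ++ T) → length Q ≡ 5 → Peel Q T →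
              size (T ++ Q) ≤ 24 ⊎ Extremal (T ++ Q)
  five-base {Q} {t₀} {t₁} {t₂} {t₃} {t₄} dense u lQ peel@(b₀ ∷ b₁ ∷ b₂ ∷ b₃ ∷ b₄ ∷ []) = decide (size (T ++ Q) ≤? 24)
    where
    ts T : List V
    ts = t₁ ∷ t₂ ∷ t₃ ∷ t₄ ∷ []
    T = t₀ ∷ ts
    open Num Q t₀ ts
    open NumCases 5 0 fivePattern
    open Labelled t₀ ts using (distinct⇒Unique)

    B : ℕ → ℕ
    B i = count nval (backAtoms 5 i)
    degs : All (λ t → deg t Q ≤ 3) T
    degs = Peel-deg peel
    thr : ∀ {i} → deg (at i) Q ≤ 3 → count nval ((i , 11) ∷ (i , 12) ∷ (i , 13) ∷ []) ≡ deg (at i) Q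
    thr {i} le = thresholds (deg (at i) Q) le
    eq₀ : B 0 ≡ deg t₀ (ts ++ Q)
    eq₀ = cong (λ d → bit (adj G t₀ t₁) + (bit (adj G t₀ t₂) + (bit (adj G t₀ t₃) + (bit (adj G t₀ t₄) + d)))) (thr {0} (All.lookup degs (here refl)))
    eq₁ : B 1 ≡ deg t₁ (t₂ ∷ t₃ ∷ t₄ ∷ Q)
    eq₁ = cong (λ d → bit (adj G t₁ t₂) + (bit (adj G t₁ t₃) + (bit (adj G t₁ t₄) + d))) (thr {1} (All.lookup degs (there (here refl))))
    eq₂ : B 2 ≡ deg t₂ (t₃ ∷ t₄ ∷ Q)
    eq₂ = cong (λ d → bit (adj G t₂ t₃) + (bit (adj G t₂ t₄) + d)) (thr {2} (All.lookup degs (there (there (here refl)))))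
    eq₃ : B 3 ≡ deg t₃ (t₄ ∷ Q)
    eq₃ = cong (λ d → bit (adj G t₃ t₄) + d) (thr {3} (All.lookup degs (there (there (there (here refl))))))
    eq₄ : B 4 ≡ deg t₄ Q
    eq₄ = thr {4} (All.lookup degs (there (there (there (there (here refl))))))
    B≤3 : All (λ i → B i ≤ 3) (upTo 5)
    B≤3 = ≤-trans (≤-reflexive eq₀) b₀ ∷ ≤-trans (≤-reflexive eq₁) b₁ ∷ ≤-trans (≤-reflexive eq₂) b₂ ∷
      ≤-trans (≤-reflexive eq₃) b₃ ∷ ≤-trans (≤-reflexive eq₄) b₄ ∷ []
    total : 24 < size (T ++ Q) → 15 ≤ sum (map B (upTo 5))
    total big = lin 10 (≤-trans big (≤-trans (≤-reflexive split-size) (+-monoʳ-≤ (sum (map B (upTo 5)))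
        (≤-trans (size≤triangle Q) (≤-reflexive (cong triangle lQ)))))) refl refl
      where
      regroup : ∀ a b c d e f → a + (b + (c + (d + (e + f)))) ≡ a + (b + (c + (d + (e + 0)))) + f
      regroup = solve-∀
      split-size : size (T ++ Q) ≡ sum (map B (upTo 5)) + size Q
      split-size = ≡.trans (cong₂ _+_ (sym eq₀) (cong₂ _+_ (sym eq₁) (cong₂ _+_ (sym eq₂) (cong₂ _+_ (sym eq₃) (cong (_+ size Q) (sym eq₄))))))
        (regroup (B 0) (B 1) (B 2) (B 3) (B 4) (size Q))

    conclude : 24 < size (T ++ Q) → Outcome nval → Extremal (T ++ Q)
    conclude big (mono i k , _ , h ∷ [] , lt) = ⊥-elim (mono-contra i k h lt)
    conclude big (low S , o , _ , lt) =
      ⊥-elim (<⇒≱ lt (≤-trans (subsum 5 0 B B≤3 (total big) S o) (≤-reflexive (sym (count-concatMap nval (backAtoms 5) S)))))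
    conclude big (pat p c , o , h , _) = found p h
      where
      i j k l m : ℕ
      i = nthIndex (digits 5 c) 0
      j = nthIndex (digits 5 c) 1
      k = nthIndex (digits 5 c) 2
      l = nthIndex (digits 5 c) 3
      m = nthIndex (digits 5 c) 4
      f : Five′ {Q} {T} dense u lQ (at i) (at j) (at k) (at l) (at m)
      f = distinct⇒Unique (Unique-++ʳ Q u) 5 ≤-refl (digits 5 c) o , Allₚ.map⁺ (All.universal (nth-∈ t₀ ts) (digits 5 c))
      uQ : Unique Q
      uQ = Unique-++ˡ Q u
      many : ∀ r x → (suc r ≤ᵇ deg (at x) Q) ≡ true → suc r ≤ deg (at x) Q
      many r x = ≤ᵇ-true (suc r) (deg (at x) Q)
      i< : i < 10
      i< = m%n<n c 10
      j< : j < 10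
      j< = m%n<n (c / 10) 10
      k< : k < 10
      k< = m%n<n (c / 10 / 10) 10
      l< : l < 10
      l< = m%n<n (c / 10 / 10 / 10) 10
      m< : m < 10
      m< = m%n<n (c / 10 / 10 / 10 / 10) 10
      found : ∀ p → All (λ a → nval a ≡ true) (map (rename (digits 5 c)) (fivePattern p)) → Extremal (T ++ Q)
      found p5 (e ∷ e′ ∷ e″ ∷ e‴ ∷ []) = ⊥-elim (no-p5 dense u lQ f (nval-edge i j i< j< e) (nval-edge j k j< k< e′) (nval-edge k l k< l< e″) (nval-edge l m l< m< e‴))
      found p4₁₂ (e ∷ e′ ∷ e″ ∷ r ∷ r′ ∷ []) = let x , y , dx , ey , xy = reps₂ uQ (many 0 l r) (many 1 m r′) in
        ⊥-elim (no-p4 dense u lQ f (nval-edge i j i< j< e) (nval-edge j k j< k< e′) (nval-edge k l k< l< e″) dx ey xy)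
      found p4₂₁ (e ∷ e′ ∷ e″ ∷ r ∷ r′ ∷ []) = let y , x , ey , dx , yx = reps₂ uQ (many 0 m r′) (many 1 l r) in
        ⊥-elim (no-p4 dense u lQ f (nval-edge i j i< j< e) (nval-edge j k j< k< e′) (nval-edge k l k< l< e″) dx ey (λ q → yx (sym q)))
      found p3₁₂₃ (e ∷ e′ ∷ r ∷ r′ ∷ r″ ∷ []) = let x , y , z , cx , dy , ez , xy , xz , yz = reps₃ uQ (many 0 k r) (many 1 l r′) (many 2 m r″) in
        ⊥-elim (no-p3 dense u lQ f (nval-edge i j i< j< e) (nval-edge j k j< k< e′) cx dy ez (xy , xz , yz))
      found p3₂₁₃ (e ∷ e′ ∷ r ∷ r′ ∷ r″ ∷ []) = let y , x , z , dy , cx , ez , yx , yz , xz = reps₃ uQ (many 0 l r′) (many 1 k r) (many 2 m r″) in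
        ⊥-elim (no-p3 dense u lQ f (nval-edge i j i< j< e) (nval-edge j k j< k< e′) cx dy ez ((λ q → yx (sym q)) , xz , yz))
      found p3₃₁₂ (e ∷ e′ ∷ r ∷ r′ ∷ r″ ∷ []) = let y , z , x , dy , ez , cx , yz , yx , zx = reps₃ uQ (many 0 l r′) (many 1 m r″) (many 2 k r) in
        ⊥-elim (no-p3 dense u lQ f (nval-edge i j i< j< e) (nval-edge j k j< k< e′) cx dy ez ((λ q → yx (sym q)) , (λ q → zx (sym q)) , yz))
      found m2₁₂₃ (e ∷ e′ ∷ r ∷ r′ ∷ r″ ∷ []) = let x , y , z , bx , dy , ez , xy , xz , yz = reps₃ uQ (many 0 j r) (many 1 l r′) (many 2 m r″) in
        ⊥-elim (no-m2 dense u lQ f (nval-edge i j i< j< e) (nval-edge k l k< l< e′) bx dy ez (xy , xz , yz))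
      found m2₁₃₂ (e ∷ e′ ∷ r ∷ r′ ∷ r″ ∷ []) = let x , z , y , bx , ez , dy , xz , xy , zy = reps₃ uQ (many 0 j r) (many 1 m r″) (many 2 l r′) in
        ⊥-elim (no-m2 dense u lQ f (nval-edge i j i< j< e) (nval-edge k l k< l< e′) bx dy ez (xy , xz , λ q → zy (sym q)))
      found m2₂₃₁ (e ∷ e′ ∷ r ∷ r′ ∷ r″ ∷ []) = let z , x , y , ez , bx , dy , zx , zy , xy = reps₃ uQ (many 0 m r″) (many 1 j r) (many 2 l r′) in
        ⊥-elim (no-m2 dense u lQ f (nval-edge i j i< j< e) (nval-edge k l k< l< e′) bx dy ez (xy , (λ q → zx (sym q)) , λ q → zy (sym q)))
      found star₅ (e ∷ e′ ∷ e″ ∷ e‴ ∷ r ∷ r′ ∷ r″ ∷ _ ∷ r‴ ∷ []) =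
        ⊥-elim (no-star dense u lQ f (nval-edge i m i< m< e) (nval-edge j m j< m< e′) (nval-edge k m k< m< e″) (nval-edge l m l< m< e‴)
          (many 0 i r) (many 1 j r′) (many 1 k r″) (many 2 m r‴))
      found k2 (e ∷ r ∷ r′ ∷ r″ ∷ r‴ ∷ []) =
        ⊥-elim (no-k2 dense u lQ f (nval-edge i j i< j< e) (many 2 j r) (many 2 k r′) (many 2 l r″) (many 2 m r‴))
      found edgeless (r ∷ r′ ∷ r″ ∷ r‴ ∷ r⁗ ∷ []) = all-same dense u lQ
        (↭-exhaust (proj₁ f) (proj₂ f) refl) f λ where
          (here refl) → many 2 i r
          (there (here refl)) → many 2 j r′
          (there (there (here refl))) → many 2 k r″
          (there (there (there (here refl)))) → many 2 l r‴
          (there (there (there (there (here refl))))) → many 2 m r⁗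

    decide : Dec (size (T ++ Q) ≤ 24) → size (T ++ Q) ≤ 24 ⊎ Extremal (T ++ Q)
    decide (yes le) = inj₁ le
    decide (no ¬le) = inj₂ (conclude (≰⇒> ¬le) (sound nval [] fiveNumTree refl []))

-- Assembling the cases into the possible shapes of the graph

module Structure {n} (G : Graph n) (free : Paths.No2P5 G) where

  open Embedding G free
  open P5Free G
  open Cores G
  open NinePath G free using (ninePath)
  open Matchings G free using (eight)
  open Seven G free using (seven)
  open Six G free using (six-base)
  open Five G free

  -- Adding back the peeled vertices

  module _ {h₁ h₂ h₃ a b : V} (core5 : ∀ {ys} → Labelled.Holds h₁ (h₂ ∷ h₃ ∷ a ∷ b ∷ ys) (clique (upTo 5))) where

    private
      Joined : V → Set
      Joined r = h₁ ~ r × h₂ ~ r × h₃ ~ r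

      -- `l₂ h₂ l₃ h₃ l₄` is one P₅; the edge to `t` is completed by `a`, `b`, `h₁`, `l₁` to the
      -- other. This takes four outer vertices.
      far : ∀ {l₁ l₂ l₃ l₄ t} → Unique (h₁ ∷ h₂ ∷ h₃ ∷ a ∷ b ∷ l₁ ∷ l₂ ∷ l₃ ∷ l₄ ∷ t ∷ []) →
            Joined l₁ → Joined l₂ → Joined l₃ → Joined l₄ → a ~ t ⊎ b ~ t ⊎ l₁ ~ t → ⊥
      far u (j₁ , _) (_ , j₂ , _) (_ , j₃ , j₃′) (_ , _ , j₄) (inj₁ e) =
        exhibit _ _ refl u ((3 , 9) ∷ (0 , 5) ∷ (1 , 6) ∷ (1 , 7) ∷ (2 , 7) ∷ (2 , 8) ∷ clique (upTo 5)) 8271650439 refl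
          (e ∷ j₁ ∷ j₂ ∷ j₃ ∷ j₃′ ∷ j₄ ∷ core5)
      far u (j₁ , _) (_ , j₂ , _) (_ , j₃ , j₃′) (_ , _ , j₄) (inj₂ (inj₁ e)) =
        exhibit _ _ refl u ((4 , 9) ∷ (0 , 5) ∷ (1 , 6) ∷ (1 , 7) ∷ (2 , 7) ∷ (2 , 8) ∷ clique (upTo 5)) 8271650349 refl
          (e ∷ j₁ ∷ j₂ ∷ j₃ ∷ j₃′ ∷ j₄ ∷ core5)
      far u (j₁ , _) (_ , j₂ , _) (_ , j₃ , j₃′) (_ , _ , j₄) (inj₂ (inj₂ e)) =
        exhibit _ _ refl u ((5 , 9) ∷ (0 , 5) ∷ (1 , 6) ∷ (1 , 7) ∷ (2 , 7) ∷ (2 , 8) ∷ clique (upTo 5)) 8271643059 refl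
          (e ∷ j₁ ∷ j₂ ∷ j₃ ∷ j₃′ ∷ j₄ ∷ core5)

    hubs-only : ∀ {t S} → Unique (t ∷ h₁ ∷ h₂ ∷ h₃ ∷ a ∷ b ∷ S) → (∀ {r} → r ∈ S → Joined r) → 4 ≤ length S →
                ∀ {x} → x ∈ a ∷ b ∷ S → ¬ x ~ t
    hubs-only {t} u j le = go u j le
      where
      five : List V
      five = h₁ ∷ h₂ ∷ h₃ ∷ a ∷ b ∷ []
      prefix : ∀ l₁ l₂ l₃ l₄ S → Unique (t ∷ five ++ l₁ ∷ l₂ ∷ l₃ ∷ l₄ ∷ S) → Unique (five ++ l₁ ∷ l₂ ∷ l₃ ∷ l₄ ∷ t ∷ [])
      prefix l₁ l₂ l₃ l₄ S u = Unique-↭ (++-comm [ t ] (five ++ l₁ ∷ l₂ ∷ l₃ ∷ l₄ ∷ [])) (Unique-++ˡ (t ∷ five ++ l₁ ∷ l₂ ∷ l₃ ∷ l₄ ∷ []) u)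
      go : ∀ {S} → Unique (t ∷ five ++ S) → (∀ {r} → r ∈ S → Joined r) → 4 ≤ length S → ∀ {x} → x ∈ a ∷ b ∷ S → ¬ x ~ t
      at-front : ∀ {S} → Unique (t ∷ five ++ S) → (∀ {r} → r ∈ S → Joined r) → 4 ≤ length S → ∀ {x S′} → S ↭ x ∷ S′ → ¬ x ~ t
      at-front {S} u j le {x} {S′} p e = four (Unique-↭ (prep t (++⁺ˡ five p)) u) (λ r∈ → j (∈-resp-↭ (↭-sym p) r∈)) (≤-pred (≤-trans le (≤-reflexive (↭-length p))))
        where
        four : ∀ {S′} → Unique (t ∷ five ++ x ∷ S′) → (∀ {r} → r ∈ x ∷ S′ → Joined r) → 3 ≤ length S′ → ⊥
        four {l₂ ∷ l₃ ∷ l₄ ∷ S″} u j _ = far (prefix x l₂ l₃ l₄ S″ u) (j (here refl)) (j (there (here refl))) (j (there (there (here refl))))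
          (j (there (there (there (here refl))))) (inj₂ (inj₂ e))
        four {_ ∷ []} _ _ (s≤s ())
        four {_ ∷ _ ∷ []} _ _ (s≤s (s≤s ()))
      go {l₁ ∷ l₂ ∷ l₃ ∷ l₄ ∷ S} u j le (here refl) e = far (prefix l₁ l₂ l₃ l₄ S u) (j (here refl)) (j (there (here refl)))
        (j (there (there (here refl)))) (j (there (there (there (here refl))))) (inj₁ e)
      go {l₁ ∷ l₂ ∷ l₃ ∷ l₄ ∷ S} u j le (there (here refl)) e = far (prefix l₁ l₂ l₃ l₄ S u) (j (here refl)) (j (there (here refl)))
        (j (there (there (here refl)))) (j (there (there (there (here refl))))) (inj₂ (inj₁ e))
      go u j le (there (there x∈)) e = at-front u j le (proj₂ (extract x∈)) e
      go {_ ∷ []} u j (s≤s ()) (here refl) e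
      go {_ ∷ _ ∷ []} u j (s≤s (s≤s ())) (here refl) e
      go {_ ∷ _ ∷ _ ∷ []} u j (s≤s (s≤s (s≤s ()))) (here refl) e
      go {_ ∷ []} u j (s≤s ()) (there (here refl)) e
      go {_ ∷ _ ∷ []} u j (s≤s (s≤s ())) (there (here refl)) e
      go {_ ∷ _ ∷ _ ∷ []} u j (s≤s (s≤s (s≤s ()))) (there (here refl)) e

  -- By `hubs-only` all neighbours of `t` in `L` are hubs, and there are just three of these, so `t`
  -- is one more outer vertex.
  Extremal-∷ : ∀ {t L} → Unique (t ∷ L) → 3 ≤ deg t L → Extremal L → Extremal (t ∷ L)
  Extremal-∷ {t} {L} u three (extremal {h₁} {h₂} {h₃} {a} {b} {R} p core5 joined large) =
      extremal (↭-trans (prep t p) (↭-sym (shift t (h₁ ∷ h₂ ∷ h₃ ∷ a ∷ b ∷ []) R))) core5 joined′ (≤-trans large (n≤1+n _))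
    where
    none : deg t (a ∷ b ∷ R) ≡ 0
    none with deg t (a ∷ b ∷ R) in eq
    ... | zero = refl
    ... | suc _ = let x , x∈ , e = deg>0⇒ t (a ∷ b ∷ R) (≤-trans z<s (≤-reflexive (sym eq))) in
      ⊥-elim (hubs-only core5 (Unique-↭ (prep t p) u) joined (≤-trans (n≤1+n 4) large) x∈ (~-sym e))
    total : 3 ≤ bit (adj G t h₁) + (bit (adj G t h₂) + (bit (adj G t h₃) + 0))
    total = ≤-trans three (≤-reflexive (≡.trans (deg-↭ t p) (cong (λ d → bit (adj G t h₁) + (bit (adj G t h₂) + (bit (adj G t h₃) + d))) none)))
    all3 : ∀ x y z → 3 ≤ bit x + (bit y + (bit z + 0)) → x ≡ true × y ≡ true × z ≡ true
    all3 true true true _ = refl , refl , refl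
    all3 true true false (s≤s (s≤s ()))
    all3 true false true (s≤s (s≤s ()))
    all3 true false false (s≤s ())
    all3 false true true (s≤s (s≤s ()))
    all3 false true false (s≤s ())
    all3 false false true (s≤s ())
    all3 false false false ()
    joined′ : ∀ {r} → r ∈ t ∷ R → h₁ ~ r × h₂ ~ r × h₃ ~ r
    joined′ (here refl) = let p , q , r = all3 _ _ _ total in ~-sym p , ~-sym q , ~-sym r
    joined′ (there r∈) = joined r∈

  -- The bound 3n - 6 persists, as each further vertex adds at most three edges. In the extremal
  -- alternative a vertex of back degree three extends the configuration, while a smaller one costs
  -- the single edge between 3n - 5 and 3n - 6.
  five : ∀ {Q T} → Dense Q → Unique (T ++ Q) → length Q ≡ 5 → Peel Q T → 5 ≤ length T →
         size (T ++ Q) + 6 ≤ (length T + 5) * 3 ⊎ Extremal (T ++ Q)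
  five {T = []} dense u lQ peel ()
  five {T = _ ∷ []} dense u lQ peel (s≤s ())
  five {T = _ ∷ _ ∷ []} dense u lQ peel (s≤s (s≤s ()))
  five {T = _ ∷ _ ∷ _ ∷ []} dense u lQ peel (s≤s (s≤s (s≤s ())))
  five {T = _ ∷ _ ∷ _ ∷ _ ∷ []} dense u lQ peel (s≤s (s≤s (s≤s (s≤s ()))))
  five {Q} {T@(_ ∷ _ ∷ _ ∷ _ ∷ _ ∷ [])} dense u lQ peel _ = base (five-base dense (Unique-↭ (++-comm T Q) u) lQ peel)
    where
    base : size (T ++ Q) ≤ 24 ⊎ Extremal (T ++ Q) → size (T ++ Q) + 6 ≤ 30 ⊎ Extremal (T ++ Q)
    base (inj₁ le) = inj₁ (+-monoˡ-≤ 6 le)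
    base (inj₂ e) = inj₂ e
  five {Q} {t ∷ T@(_ ∷ _ ∷ _ ∷ _ ∷ _ ∷ _)} dense u lQ (p ∷ peel) _ =
      step (five dense (AllPairs.tail u) lQ peel (s≤s (s≤s (s≤s (s≤s (s≤s z≤n))))))
    where
    step : size (T ++ Q) + 6 ≤ (length T + 5) * 3 ⊎ Extremal (T ++ Q) →
           deg t (T ++ Q) + size (T ++ Q) + 6 ≤ 3 + (length T + 5) * 3 ⊎ Extremal (t ∷ T ++ Q)
    step (inj₁ le) = inj₁ (≤-trans (≤-reflexive (+-assoc (deg t (T ++ Q)) _ 6)) (+-mono-≤ p le))
    step (inj₂ ext) with 3 ≤? deg t (T ++ Q)
    ... | yes three = inj₂ (Extremal-∷ u three ext)
    ... | no ¬three = inj₁ (≤-trans (+-monoˡ-≤ 6 (+-mono-≤ (≤-pred (≰⇒> ¬three)) (≤-trans (Peel-size peel)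
          (+-monoʳ-≤ (length T * 3) (≤-trans (size≤triangle Q) (≤-reflexive (cong triangle lQ))))))) (≤-reflexive (arith (length T))))
      where
      arith : ∀ l → 2 + (l * 3 + 10) + 6 ≡ 3 + (l + 5) * 3
      arith = solve-∀

  six : ∀ {Q T} → Dense Q → Unique (T ++ Q) → length Q ≡ 6 → Peel Q T → 4 ≤ length T → size (T ++ Q) + 6 ≤ (length T + 6) * 3
  six {T = []} dense u lQ peel ()
  six {T = _ ∷ []} dense u lQ peel (s≤s ())
  six {T = _ ∷ _ ∷ []} dense u lQ peel (s≤s (s≤s ()))
  six {T = _ ∷ _ ∷ _ ∷ []} dense u lQ peel (s≤s (s≤s (s≤s ())))
  six {Q} {T@(_ ∷ _ ∷ _ ∷ _ ∷ [])} dense u lQ peel _ = +-monoˡ-≤ 6 (six-base dense (Unique-↭ (++-comm T Q) u) lQ peel)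
  six {Q} {t ∷ T@(_ ∷ _ ∷ _ ∷ _ ∷ _)} dense u lQ (p ∷ peel) _ =
    ≤-trans (≤-reflexive (+-assoc (deg t (T ++ Q)) _ 6)) (+-mono-≤ p (six dense (AllPairs.tail u) lQ peel (s≤s (s≤s (s≤s (s≤s z≤n))))))

  -- With n = 9 + m the two competing values are 36 + g m and 22 + 3m = 3n - 5. Falling strictly
  -- below either one rules out having the maximum number of edges, so two kinds of `few-edges` are
  -- kept instead of a comparison with the larger value.
  data Shape (L : List V) (m : ℕ) : Set where
    K₉-component : ∀ {R S} → L ↭ R ++ S → length R ≡ 9 → size R ≡ 36 → cross R S ≡ 0 → NoP5 S → Shape L m
    three-hubs   : Extremal L → size L ≤ 22 + m * 3 → Shape L m
    few-edges₁   : size L < 36 + g m → Shape L m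
    few-edges₂   : size L < 22 + m * 3 → Shape L m

  module _ {L : List V} {m} (u : Unique L) (lL : length L ≡ 9 + m) (m>0 : 0 < m) where

    private
      nine : ∀ {T Q} → L ↭ T ++ Q → Dense Q → PathIn Q 9 → Shape L m
      nine {T} {Q} pL dense (p , W , lp , pp , q) = go (ninePath u dense lp pp pS q ∈-++⁺ˡ)
        where
        S : List V
        S = W ++ T
        pS : L ↭ p ++ S
        pS = ↭-trans pL (↭-trans (++-comm T Q) (↭-trans (++⁺ʳ T q) (↭-reflexive (++-assoc p W T))))
        uS : Unique (p ++ S)
        uS = Unique-↭ pS u
        lS : length S ≡ m
        lS = +-cancelˡ-≡ 9 _ _ (≡.trans (cong (_+ length S) (sym lp)) (≡.trans (sym (length-++ p)) (≡.trans (sym (↭-length pS)) lL)))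
        uS′ : Unique (take 5 p ++ (drop 5 p ++ S))
        uS′ = subst Unique (≡.trans (cong (_++ S) (sym (take++drop≡id 5 p))) (++-assoc (take 5 p) (drop 5 p) S)) uS
        no5 : NoP5 S
        no5 = NoP5-⊆ (∈-++⁺ʳ (drop 5 p)) (No2P5⇒NoP5 free {take 5 p} (≡.trans (length-take 5 p) (cong (5 ⊓_) lp))
          (Path-++ˡ (take 5 p) (subst Path (sym (take++drop≡id 5 p)) pp)) uS′)
        sizeS : size S ≤ g m
        sizeS = ≤-trans (NoP5⇒size≤g (Unique-++ʳ p uS) no5) (≤-reflexive (cong g lS))
        go : cross p S ≡ 0 ⊎ size L ≤ 20 + length S + size S → Shape L m
        go (inj₁ none) with size p ≤? 35
        ... | yes le = few-edges₁ (s≤s (≤-trans (≤-reflexive (pull p pS none)) (+-mono-≤ le sizeS)))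
        ... | no ¬le = K₉-component {R = p} pS lp (≤-antisym (≤-trans (size≤triangle p) (≤-reflexive (cong triangle lp))) (≰⇒> ¬le)) none no5
        -- There are at most 20 + m + g m edges, and g m ≤ 3m/2 keeps this below 22 + 3m; doubling
        -- avoids the half.
        go (inj₂ le) = few-edges₂ (*-cancelˡ-< 2 (size L) (22 + m * 3) (begin-strict
          2 * size L                       ≤⟨ *-monoʳ-≤ 2 (≤-trans le (+-mono-≤ (≤-reflexive (cong (20 +_) lS)) sizeS)) ⟩
          2 * (20 + m + g m)               ≡⟨ *-distribˡ-+ 2 (20 + m) (g m) ⟩
          2 * (20 + m) + 2 * g m           ≤⟨ +-monoʳ-≤ (2 * (20 + m)) (2g≤3* m) ⟩
          2 * (20 + m) + 3 * m             ≤⟨ m≤m+n _ (m + 3) ⟩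
          2 * (20 + m) + 3 * m + (m + 3)   <⟨ n<1+n _ ⟩
          1 + (2 * (20 + m) + 3 * m + (m + 3)) ≡⟨ arith m ⟩
          2 * (22 + m * 3)                 ∎))
          where
          open ≤-Reasoning
          arith : ∀ m → 1 + (2 * (20 + m) + 3 * m + (m + 3)) ≡ 2 * (22 + m * 3)
          arith = solve-∀

      lengths : ∀ {T Q : List V} {k} → L ↭ T ++ Q → length Q ≡ k → length T + k ≡ 9 + m
      lengths {T} pL lQ = ≡.trans (cong (length T +_) (sym lQ)) (≡.trans (sym (length-++ T)) (≡.trans (sym (↭-length pL)) lL))

      below : ∀ {s} → s + 6 ≤ (9 + m) * 3 → s < 22 + m * 3
      below {s} le = lin 5 le (arith s) (arith′ m)
        where
        arith : ∀ s → 1 + s + 5 ≡ s + 6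
        arith = solve-∀
        arith′ : ∀ m → (9 + m) * 3 ≡ 22 + m * 3 + 5
        arith′ = solve-∀

      -- The half 26 + 3g/2 lies below 36 + g as long as g ≤ 19. From g = 20 on, 52 + 3g ≤ 32 + 4g ≤
      -- 32 + 6m, which is below twice 22 + 3m.
      half : 2 * size L ≤ 52 + 3 * g m → Shape L m
      half le with g m ≤? 19
      ... | yes small = few-edges₁ (*-cancelˡ-< 2 (size L) (36 + g m) (begin-strict
          2 * size L                 ≤⟨ le ⟩
          52 + 3 * g m               ≡⟨ expand (g m) ⟩
          52 + 2 * g m + g m         ≤⟨ +-monoʳ-≤ (52 + 2 * g m) small ⟩
          52 + 2 * g m + 19          <⟨ n<1+n _ ⟩
          1 + (52 + 2 * g m + 19)    ≡⟨ join (g m) ⟩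
          2 * (36 + g m)             ∎))
        where
        open ≤-Reasoning
        expand : ∀ x → 52 + 3 * x ≡ 52 + 2 * x + x
        expand = solve-∀
        join : ∀ x → 1 + (52 + 2 * x + 19) ≡ 2 * (36 + x)
        join = solve-∀
      ... | no ¬small = few-edges₂ (*-cancelˡ-< 2 (size L) (22 + m * 3) (begin-strict
          2 * size L                 ≤⟨ le ⟩
          52 + 3 * g m               ≡⟨⟩
          32 + 20 + 3 * g m          ≤⟨ +-monoˡ-≤ (3 * g m) (+-monoʳ-≤ 32 (≰⇒> ¬small)) ⟩
          32 + g m + 3 * g m         ≡⟨ expand (g m) ⟩
          32 + 2 * (2 * g m)         ≤⟨ +-monoʳ-≤ 32 (*-monoʳ-≤ 2 (2g≤3* m)) ⟩
          32 + 2 * (3 * m)           <⟨ m<n+m _ {12} z<s ⟩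
          12 + (32 + 2 * (3 * m))    ≡⟨ join m ⟩
          2 * (22 + m * 3)           ∎))
        where
        open ≤-Reasoning
        expand : ∀ x → 32 + x + 3 * x ≡ 32 + 2 * (2 * x)
        expand = solve-∀
        join : ∀ m → 12 + (32 + 2 * (3 * m)) ≡ 2 * (22 + m * 3)
        join = solve-∀

      atLeast5 : ∀ {Q C v} → Dense Q → v ∈ Q → Q ↭ C → 5 ≤ length C
      atLeast5 {Q} {C} dense v∈ q = go (Dense⇒P5 dense v∈)
        where
        go : PathIn Q 5 → 5 ≤ length C
        go (p , W , lp , _ , r) = ≤-trans (≤-trans (≤-reflexive (sym lp)) (m≤m+n (length p) (length W)))
          (≤-reflexive (≡.trans (sym (length-++ p)) (≡.trans (sym (↭-length r)) (↭-length q))))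

      coreOf : ∀ k {T Q C} → length C ≡ k → L ↭ T ++ Q → Peel Q T → Dense Q → ∀ {v} → v ∈ Q → Q ↭ C → Cycle C → Shape L m
      coreOf 5 {T} {Q} lC pL peel dense v∈ q cyc = go (five dense (Unique-↭ pL u) lQ peel
          -- Here n ≥ 10 enters as `m>0`: at least five vertices are peeled, as the base case on ten
          -- vertices requires.
          (+-cancelʳ-≤ 5 5 (length T) (≤-trans (+-monoʳ-≤ 9 m>0) (≤-reflexive (sym lens)))))
        where
        lQ : length Q ≡ 5
        lQ = ≡.trans (↭-length q) lC
        lens : length T + 5 ≡ 9 + m
        lens = lengths {T} pL lQ
        go : size (T ++ Q) + 6 ≤ (length T + 5) * 3 ⊎ Extremal (T ++ Q) → Shape L m
        go (inj₁ le) = few-edges₂ (below (≤-trans (≤-reflexive (cong (_+ 6) (size-↭ pL))) (≤-trans le (≤-reflexive (cong (_* 3) lens)))))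
        go (inj₂ (extremal p c j l)) = three-hubs (extremal (↭-trans pL p) c j l)
          (lin 5 (+-monoˡ-≤ 5 (≤-trans (≤-reflexive (size-↭ pL)) (≤-trans (Peel-size peel)
            (+-monoʳ-≤ (length T * 3) (≤-trans (size≤triangle Q) (≤-reflexive (cong triangle lQ))))))) refl
            (≡.trans (arith (length T)) (≡.trans (cong (_* 3) lens) (arith′ m))))
          where
          arith : ∀ l → l * 3 + 10 + 5 ≡ (l + 5) * 3
          arith = solve-∀
          arith′ : ∀ m → (9 + m) * 3 ≡ 22 + m * 3 + 5
          arith′ = solve-∀
      coreOf 6 {T} {Q} lC pL peel dense v∈ q cyc = few-edges₂ (below (≤-trans (≤-reflexive (cong (_+ 6) (size-↭ pL)))
          (≤-trans (six dense (Unique-↭ pL u) lQ peel (+-cancelʳ-≤ 6 4 (length T) (≤-trans (+-monoʳ-≤ 9 m>0) (≤-reflexive (sym lens)))))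
            (≤-reflexive (cong (_* 3) lens)))))
        where
        lQ : length Q ≡ 6
        lQ = ≡.trans (↭-length q) lC
        lens : length T + 6 ≡ 9 + m
        lens = lengths {T} pL lQ
      coreOf 7 {T} {Q} lC pL peel dense v∈ q cyc = go (seven pL u peel dense lQ
          (+-cancelʳ-≡ 7 (length T) (2 + m) (≡.trans (lengths {T} pL lQ) (arith m))) v∈)
        where
        lQ : length Q ≡ 7
        lQ = ≡.trans (↭-length q) lC
        arith : ∀ m → 9 + m ≡ 2 + m + 7
        arith = solve-∀
        go : size L ≤ 35 + g m ⊎ 2 * size L ≤ 52 + 3 * g m → Shape L m
        go (inj₁ le) = few-edges₁ (s≤s le)
        go (inj₂ le) = half le
      coreOf 8 {T} {Q} lC pL peel dense v∈ q cyc = few-edges₁ (s≤s (eight pL u peel dense q cyc lC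
          (+-cancelʳ-≡ 8 (length T) (1 + m) (≡.trans (lengths {T} pL (≡.trans (↭-length q) lC)) (arith m)))))
        where
        arith : ∀ m → 9 + m ≡ 1 + m + 8
        arith = solve-∀
      -- A Hamiltonian cycle on nine or more vertices contains a path on nine, so the nine-vertex
      -- case applies.
      coreOf (suc (suc (suc (suc (suc (suc (suc (suc (suc k))))))))) {T} {Q} {c ∷ cs} lC pL peel dense v∈ q cyc =
        nine pL dense (take 9 (c ∷ cs) , drop 9 (c ∷ cs) , ≡.trans (length-take 9 (c ∷ cs)) (cong (9 ⊓_) lC) ,
          Path-++ˡ (take 9 (c ∷ cs)) (subst Path (sym (take++drop≡id 9 (c ∷ cs))) (Path-++ˡ (c ∷ cs) cyc)) ,
          ↭-trans q (↭-reflexive (sym (take++drop≡id 9 (c ∷ cs)))))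
      coreOf 0 lC pL peel dense v∈ q cyc = ⊥-elim (<⇒≱ (≤-trans (s≤s (≤-reflexive lC)) (m≤m+n 1 4)) (atLeast5 dense v∈ q))
      coreOf 1 lC pL peel dense v∈ q cyc = ⊥-elim (<⇒≱ (≤-trans (s≤s (≤-reflexive lC)) (m≤m+n 2 3)) (atLeast5 dense v∈ q))
      coreOf 2 lC pL peel dense v∈ q cyc = ⊥-elim (<⇒≱ (≤-trans (s≤s (≤-reflexive lC)) (m≤m+n 3 2)) (atLeast5 dense v∈ q))
      coreOf 3 lC pL peel dense v∈ q cyc = ⊥-elim (<⇒≱ (≤-trans (s≤s (≤-reflexive lC)) (m≤m+n 4 1)) (atLeast5 dense v∈ q))
      coreOf 4 lC pL peel dense v∈ q cyc = ⊥-elim (<⇒≱ (≤-trans (s≤s (≤-reflexive lC)) (m≤m+n 5 0)) (atLeast5 dense v∈ q))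

    shape : Shape L m
    shape = go (core (length L) L ≤-refl)
      where
      go : Core L → Shape L m
      go (T , [] , pL , peel , dense) = few-edges₂ (below (≤-trans (≤-reflexive (cong (_+ 6) (size-↭ pL′)))
          (≤-trans (Peel-[] peel (≤-trans (m≤m+n 3 (6 + m)) (≤-reflexive (sym lT)))) (≤-reflexive (cong (_* 3) lT)))))
        where
        pL′ : L ↭ T
        pL′ = ↭-trans pL (↭-reflexive (++-identityʳ T))
        lT : length T ≡ 9 + m
        lT = ≡.trans (sym (↭-length pL′)) lL
      go (T , v ∷ Q , pL , peel , dense) = found (longPath free (Unique-++ʳ T (Unique-↭ pL u)) dense (here refl))
        where
        found : PathIn (v ∷ Q) 9 ⊎ (∃ λ C → v ∷ Q ↭ C × Cycle C) → Shape L m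
        found (inj₁ p) = nine pL dense p
        found (inj₂ (C , q , cyc)) = coreOf (length C) refl pL peel dense (here refl) q cyc

-- Unions and joins

module _ {m n} (b : Bool) (G : Graph m) (H : Graph n) where

  adj-ll : ∀ i j → adj (comb b G H) (i ↑ˡ n) (j ↑ˡ n) ≡ adj G i j
  adj-ll i j rewrite Finₚ.splitAt-↑ˡ m i n | Finₚ.splitAt-↑ˡ m j n = refl

  adj-rr : ∀ i j → adj (comb b G H) (m ↑ʳ i) (m ↑ʳ j) ≡ adj H i j
  adj-rr i j rewrite Finₚ.splitAt-↑ʳ m n i | Finₚ.splitAt-↑ʳ m n j = refl

  adj-lr : ∀ i j → adj (comb b G H) (i ↑ˡ n) (m ↑ʳ j) ≡ b
  adj-lr i j rewrite Finₚ.splitAt-↑ˡ m i n | Finₚ.splitAt-↑ʳ m n j = refl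

  private
    module X = Count (comb b G H)
    module Gᶜ = Count G
    module Hᶜ = Count H

    deg-l : ∀ i L → X.deg (i ↑ˡ n) (map (_↑ˡ n) L) ≡ Gᶜ.deg i L
    deg-l i [] = refl
    deg-l i (j ∷ L) = cong₂ _+_ (cong bit (adj-ll i j)) (deg-l i L)

    deg-r : ∀ i L → X.deg (m ↑ʳ i) (map (m ↑ʳ_) L) ≡ Hᶜ.deg i L
    deg-r i [] = refl
    deg-r i (j ∷ L) = cong₂ _+_ (cong bit (adj-rr i j)) (deg-r i L)

    deg-lr : ∀ i L → X.deg (i ↑ˡ n) (map (m ↑ʳ_) L) ≡ length L * bit b
    deg-lr i [] = refl
    deg-lr i (j ∷ L) = cong₂ _+_ (cong bit (adj-lr i j)) (deg-lr i L)

    size-l : ∀ L → X.size (map (_↑ˡ n) L) ≡ Gᶜ.size L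
    size-l [] = refl
    size-l (i ∷ L) = cong₂ _+_ (deg-l i L) (size-l L)

    size-r : ∀ L → X.size (map (m ↑ʳ_) L) ≡ Hᶜ.size L
    size-r [] = refl
    size-r (i ∷ L) = cong₂ _+_ (deg-r i L) (size-r L)

    cross-lr : ∀ A L → X.cross (map (_↑ˡ n) A) (map (m ↑ʳ_) L) ≡ length A * (length L * bit b)
    cross-lr [] L = refl
    cross-lr (i ∷ A) L = cong₂ _+_ (deg-lr i L) (cross-lr A L)

    tabulate-+ : ∀ m {k} {A : Set} (f : Fin (m + k) → A) → tabulate f ≡ tabulate (f ∘ (_↑ˡ k)) ++ tabulate (f ∘ (m ↑ʳ_))
    tabulate-+ zero f = refl
    tabulate-+ (suc m) f = cong (f Fin.zero ∷_) (tabulate-+ m (f ∘ Fin.suc))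

  edges-comb : edges (comb b G H) ≡ edges G + m * (n * bit b) + edges H
  edges-comb = begin
    edges (comb b G H)                          ≡⟨ X.edges≡size ⟩
    X.size (allFin (m + n))                     ≡⟨ cong X.size (≡.trans (tabulate-+ m (λ i → i))
                                                    (sym (cong₂ _++_ (map-tabulate (λ i → i) (_↑ˡ n)) (map-tabulate (λ i → i) (m ↑ʳ_))))) ⟩
    X.size (map (_↑ˡ n) (allFin m) ++ map (m ↑ʳ_) (allFin n))
      ≡⟨ X.size-++ (map (_↑ˡ n) (allFin m)) (map (m ↑ʳ_) (allFin n)) ⟩
    X.size (map (_↑ˡ n) (allFin m)) + X.cross (map (_↑ˡ n) (allFin m)) (map (m ↑ʳ_) (allFin n)) + X.size (map (m ↑ʳ_) (allFin n))
      ≡⟨ cong₂ _+_ (cong₂ _+_ (≡.trans (size-l (allFin m)) (sym Gᶜ.edges≡size)) (≡.trans (cross-lr (allFin m) (allFin n))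
           (cong₂ (λ k l → k * (l * bit b)) (len m) (len n)))) (≡.trans (size-r (allFin n)) (sym Hᶜ.edges≡size)) ⟩
    edges G + m * (n * bit b) + edges H         ∎
    where
    open ≡.≡-Reasoning
    len : ∀ k → length (allFin k) ≡ k
    len k = length-tabulate {n = k} (λ i → i)

edges-E : ∀ k → edges (E k) ≡ 0
edges-E k = ≡.trans (Count.edges≡size (E k)) (go (allFin k))
  where
  open Count (E k)
  deg0 : ∀ v L → deg v L ≡ 0
  deg0 v [] = refl
  deg0 v (u ∷ L) = deg0 v L
  go : ∀ L → size L ≡ 0
  go [] = refl
  go (v ∷ L) = cong₂ _+_ (deg0 v L) (go L)

-- Graphs attaining the bound

P5-adjacent : ∀ {n} {G : Graph n} ((f , _ , hom) : P 5 ⊆ᵍ G) →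
  All (λ (i , j) → adj G (f i) (f j) ≡ true) ((# 0 , # 1) ∷ (# 1 , # 2) ∷ (# 2 , # 3) ∷ (# 3 , # 4) ∷ [])
P5-adjacent (f , _ , hom) = hom (# 0) (# 1) refl ∷ hom (# 1) (# 2) refl ∷ hom (# 2) (# 3) refl ∷ hom (# 3) (# 4) refl ∷ []

module _ {m n} (G : Graph m) (H : Graph n) where

  private
    Left Right : Fin (m + n) → Set
    Left v = ∃ λ x → v ≡ x ↑ˡ n
    Right v = ∃ λ x → v ≡ m ↑ʳ x

    side : ∀ v → Left v ⊎ Right v
    side v with splitAt m v in eq
    ... | inj₁ x = inj₁ (x , sym (Finₚ.splitAt⁻¹-↑ˡ eq))
    ... | inj₂ x = inj₂ (x , sym (Finₚ.splitAt⁻¹-↑ʳ eq))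

    no-lr : ∀ {u v} → adj (G ∪ᵍ H) u v ≡ true → Left u → Right v → ⊥
    no-lr e (x , refl) (y , refl) with () ← ≡.trans (sym e) (adj-lr false G H x y)

    stays-left : ∀ {u v} → adj (G ∪ᵍ H) u v ≡ true → Left u → Left v
    stays-left {u} {v} e l = [ (λ l′ → l′) , (λ r → ⊥-elim (no-lr e l r)) ]′ (side v)

    stays-right : ∀ {u v} → adj (G ∪ᵍ H) u v ≡ true → Right u → Right v
    stays-right {u} {v} e r = [ (λ l → ⊥-elim (no-lr (≡.trans (adj-sym (G ∪ᵍ H) v u) e) l r)) , (λ r′ → r′) ]′ (side v)

    spread₅ : ∀ {S : Fin (m + n) → Set} {f : Fin 5 → Fin (m + n)} → (∀ {u v} → adj (G ∪ᵍ H) u v ≡ true → S u → S v) →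
              All (λ (i , j) → adj (G ∪ᵍ H) (f i) (f j) ≡ true) ((# 0 , # 1) ∷ (# 1 , # 2) ∷ (# 2 , # 3) ∷ (# 3 , # 4) ∷ []) →
              S (f (# 0)) → ∀ i → S (f i)
    spread₅ {S} {f} st (e₀ ∷ e₁ ∷ e₂ ∷ e₃ ∷ []) s₀ = λ where
        Fin.zero → s₀
        (Fin.suc Fin.zero) → s₁
        (Fin.suc (Fin.suc Fin.zero)) → s₂
        (Fin.suc (Fin.suc (Fin.suc Fin.zero))) → s₃
        (Fin.suc (Fin.suc (Fin.suc (Fin.suc Fin.zero)))) → st e₃ s₃
      where
      s₁ : S (f (# 1))
      s₁ = st e₀ s₀
      s₂ : S (f (# 2))
      s₂ = st e₁ s₁
      s₃ : S (f (# 3))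
      s₃ = st e₂ s₂

  -- P₅ is connected, so it lies within one part. On the left only the location is kept, because
  -- there the argument counts vertices; on the right the embedding is needed for recursion.
  P5-side : ((f , _) : P 5 ⊆ᵍ (G ∪ᵍ H)) → (∀ i → ∃ λ x → f i ≡ x ↑ˡ n) ⊎ P 5 ⊆ᵍ H
  P5-side p@(f , inj , hom) with side (f (# 0))
  ... | inj₁ l = inj₁ (spread₅ {f = f} stays-left (P5-adjacent {G = G ∪ᵍ H} p) l)
  ... | inj₂ r = inj₂ ((λ i → proj₁ (all i)) ,
      (λ {i} {j} eq → inj (≡.trans (proj₂ (all i)) (≡.trans (cong (m ↑ʳ_) eq) (sym (proj₂ (all j)))))) ,
      λ i j e → ≡.trans (sym (adj-rr false G H _ _)) (subst₂′ (proj₂ (all i)) (proj₂ (all j)) (hom i j e)))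
    where
    all : ∀ i → Right (f i)
    all = spread₅ {f = f} stays-right (P5-adjacent {G = G ∪ᵍ H} p) r
    subst₂′ : ∀ {u v u′ v′} → u ≡ u′ → v ≡ v′ → adj (G ∪ᵍ H) u v ≡ true → adj (G ∪ᵍ H) u′ v′ ≡ true
    subst₂′ refl refl e = e

blocks : ∀ m → Graph m
blocks 0 = K 0
blocks 1 = K 1
blocks 2 = K 2
blocks 3 = K 3
blocks (suc (suc (suc (suc m)))) = K 4 ∪ᵍ blocks m

edges-blocks : ∀ m → edges (blocks m) ≡ g m
edges-blocks 0 = refl
edges-blocks 1 = refl
edges-blocks 2 = refl
edges-blocks 3 = refl
edges-blocks (suc (suc (suc (suc m)))) = ≡.trans (edges-comb false (K 4) (blocks m))
  (≡.trans (cong₂ (λ z e → 6 + 4 * z + e) (*-zeroʳ m) (edges-blocks m)) refl)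

tooSmall : ∀ {m n} → n < m → {f : Fin m → Fin n} → (∀ {i j} → f i ≡ f j → i ≡ j) → ⊥
tooSmall lt inj = <⇒≱ lt (Finₚ.injective⇒≤ inj)

P5-free-blocks : ∀ m → Free (P 5) (blocks m)
P5-free-blocks 0 (f , inj , _) = tooSmall z<s inj
P5-free-blocks 1 (f , inj , _) = tooSmall (s≤s z<s) inj
P5-free-blocks 2 (f , inj , _) = tooSmall (s≤s (s≤s z<s)) inj
P5-free-blocks 3 (f , inj , _) = tooSmall (s≤s (s≤s (s≤s z<s))) inj
P5-free-blocks (suc (suc (suc (suc m)))) p@(f , inj , _) with P5-side (K 4) (blocks m) p
... | inj₂ q = P5-free-blocks m q
... | inj₁ l = tooSmall {5} {4} ≤-refl {λ i → proj₁ (l i)}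
  (λ {i} {j} eq → inj (≡.trans (proj₂ (l i)) (≡.trans (cong (_↑ˡ m) eq) (sym (proj₂ (l j))))))

firstP5 : ∀ {n} {G : Graph n} → (P 5 ∪ᵍ P 5) ⊆ᵍ G → P 5 ⊆ᵍ G
firstP5 (f , inj , hom) = (λ i → f (i ↑ˡ 5)) , (λ eq → Finₚ.↑ˡ-injective 5 _ _ (inj eq)) ,
  λ i j e → hom _ _ (≡.trans (adj-ll false (P 5) (P 5) i j) e)

secondP5 : ∀ {n} {G : Graph n} → (P 5 ∪ᵍ P 5) ⊆ᵍ G → P 5 ⊆ᵍ G
secondP5 (f , inj , hom) = (λ i → f (5 ↑ʳ i)) , (λ eq → Finₚ.↑ʳ-injective 5 _ _ (inj eq)) ,
  λ i j e → hom _ _ (≡.trans (adj-rr false (P 5) (P 5) i j) e)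

-- A P₅ in the right part is excluded by `P5-free-blocks`; otherwise both lie in K₉, which has only
-- nine vertices for their ten.
2P5-free-K₉∪blocks : ∀ m → Free (P 5 ∪ᵍ P 5) (K 9 ∪ᵍ blocks m)
2P5-free-K₉∪blocks m p@(f , inj , hom)
  with P5-side (K 9) (blocks m) (firstP5 {G = K 9 ∪ᵍ blocks m} p) | P5-side (K 9) (blocks m) (secondP5 {G = K 9 ∪ᵍ blocks m} p)
... | inj₂ q | _ = P5-free-blocks m q
... | inj₁ _ | inj₂ q = P5-free-blocks m q
... | inj₁ l | inj₁ l′ = tooSmall {10} {9} ≤-refl {λ i → proj₁ (all i)}
    (λ {i} {j} eq → inj (≡.trans (proj₂ (all i)) (≡.trans (cong (_↑ˡ m) eq) (sym (proj₂ (all j))))))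
  where
  all : ∀ i → ∃ λ x → f i ≡ x ↑ˡ m
  all i with splitAt 5 i in eq
  ... | inj₁ j = proj₁ (l j) , ≡.trans (cong f (sym (Finₚ.splitAt⁻¹-↑ˡ eq))) (proj₂ (l j))
  ... | inj₂ j = proj₁ (l′ j) , ≡.trans (cong f (sym (Finₚ.splitAt⁻¹-↑ʳ eq))) (proj₂ (l′ j))

edges-K₉∪blocks : ∀ m → edges (K 9 ∪ᵍ blocks m) ≡ 36 + g m
edges-K₉∪blocks m = ≡.trans (edges-comb false (K 9) (blocks m)) (cong₂ (λ z e → 36 + 9 * z + e) (*-zeroʳ m) (edges-blocks m))

module HubGraph (k : ℕ) where

  X : Graph (3 + (2 + k))
  X = K 3 +ᵍ (K 2 ∪ᵍ E k)

  edges-X : edges X ≡ 10 + k * 3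
  edges-X = ≡.trans (edges-comb true (K 3) (K 2 ∪ᵍ E k))
    (≡.trans (cong (λ e → 3 + 3 * ((2 + k) * 1) + e) (≡.trans (edges-comb false (K 2) (E k)) (cong₂ (λ z e → 1 + 2 * z + e) (*-zeroʳ k) (edges-E k))))
      (arith k))
    where
    arith : ∀ k → 3 + 3 * ((2 + k) * 1) + 1 ≡ 10 + k * 3
    arith = solve-∀

  Hub Pair NonHub : Fin (3 + (2 + k)) → Set
  Hub v = ∃ λ (x : Fin 3) → v ≡ x ↑ˡ (2 + k)
  NonHub v = ∃ λ (y : Fin (2 + k)) → v ≡ 3 ↑ʳ y
  Pair v = ∃ λ (x : Fin 2) → v ≡ 3 ↑ʳ (x ↑ˡ k)

  hub? : ∀ v → Hub v ⊎ NonHub v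
  hub? v with splitAt 3 v in eq
  ... | inj₁ x = inj₁ (x , sym (Finₚ.splitAt⁻¹-↑ˡ eq))
  ... | inj₂ y = inj₂ (y , sym (Finₚ.splitAt⁻¹-↑ʳ eq))

  pairs-only : ∀ {u v} → NonHub u → NonHub v → adj X u v ≡ true → Pair u × Pair v
  pairs-only (x , refl) (y , refl) e = go x y (≡.trans (sym (adj-rr true (K 3) (K 2 ∪ᵍ E k) x y)) e)
    where
    go : ∀ x y → adj (K 2 ∪ᵍ E k) x y ≡ true → Pair (3 ↑ʳ x) × Pair (3 ↑ʳ y)
    go x y e with splitAt 2 x in ex | splitAt 2 y in ey
    ... | inj₁ i | inj₁ j = (i , cong (3 ↑ʳ_) (sym (Finₚ.splitAt⁻¹-↑ˡ ex))) , (j , cong (3 ↑ʳ_) (sym (Finₚ.splitAt⁻¹-↑ˡ ey)))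
    go x y () | inj₁ _ | inj₂ _
    go x y () | inj₂ _ | inj₁ _
    go x y () | inj₂ _ | inj₂ _

  module _ (p : P 5 ⊆ᵍ X) where

    private
      f : Fin 5 → Fin (3 + (2 + k))
      f = proj₁ p

      inj : ∀ {i j} → f i ≡ f j → i ≡ j
      inj = proj₁ (proj₂ p)

      hom : ∀ i j → adj (P 5) i j ≡ true → adj X (f i) (f j) ≡ true
      hom = proj₂ (proj₂ p)

      three : ∀ {i j l} → i ≢ j → i ≢ l → j ≢ l → Pair (f i) → Pair (f j) → Pair (f l) → ⊥
      three {i} {j} {l} i≢j i≢l j≢l (x , ex) (y , ey) (z , ez) = two x y z
          (λ { refl → i≢j (inj (≡.trans ex (sym ey))) }) (λ { refl → i≢l (inj (≡.trans ex (sym ez))) }) (λ { refl → j≢l (inj (≡.trans ey (sym ez))) })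
        where
        two : (x y z : Fin 2) → x ≢ y → x ≢ z → y ≢ z → ⊥
        two Fin.zero Fin.zero _ p _ _ = p refl
        two Fin.zero (Fin.suc Fin.zero) Fin.zero _ q _ = q refl
        two Fin.zero (Fin.suc Fin.zero) (Fin.suc Fin.zero) _ _ r = r refl
        two (Fin.suc Fin.zero) (Fin.suc Fin.zero) _ p _ _ = p refl
        two (Fin.suc Fin.zero) Fin.zero (Fin.suc Fin.zero) _ q _ = q refl
        two (Fin.suc Fin.zero) Fin.zero Fin.zero _ _ r = r refl

    TwoHubs : Set
    TwoHubs = ∃ λ i → ∃ λ j → i ≢ j × Hub (f i) × Hub (f j)

    -- Away from the hubs the only edge is the pair, so a P₅ with at most one hub would have three
    -- vertices in the pair. Two disjoint P₅ would then need four of the three hubs.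
    two-hubs : TwoHubs
    two-hubs with hub? (f (# 0)) | hub? (f (# 1)) | hub? (f (# 2)) | hub? (f (# 3)) | hub? (f (# 4))
    ... | _ | inj₁ h | _ | inj₁ h′ | _ = # 1 , # 3 , (λ ()) , h , h′
    ... | _ | inj₁ h | inj₁ h′ | inj₂ _ | _ = # 1 , # 2 , (λ ()) , h , h′
    ... | _ | inj₁ h | inj₂ _ | inj₂ _ | inj₁ h′ = # 1 , # 4 , (λ ()) , h , h′
    ... | _ | inj₁ h | inj₂ n₂ | inj₂ n₃ | inj₂ n₄ =
      let p₂ , p₃ = pairs-only n₂ n₃ (hom (# 2) (# 3) refl)
          _ , p₄ = pairs-only n₃ n₄ (hom (# 3) (# 4) refl)
      in ⊥-elim (three (λ ()) (λ ()) (λ ()) p₂ p₃ p₄)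
    ... | _ | inj₂ _ | inj₁ h | inj₁ h′ | _ = # 2 , # 3 , (λ ()) , h , h′
    ... | inj₁ h | inj₂ _ | inj₂ _ | inj₁ h′ | _ = # 0 , # 3 , (λ ()) , h , h′
    ... | inj₂ n₀ | inj₂ n₁ | inj₂ n₂ | inj₁ _ | _ =
      let p₀ , p₁ = pairs-only n₀ n₁ (hom (# 0) (# 1) refl)
          _ , p₂ = pairs-only n₁ n₂ (hom (# 1) (# 2) refl)
      in ⊥-elim (three (λ ()) (λ ()) (λ ()) p₀ p₁ p₂)
    ... | _ | inj₂ n₁ | inj₂ n₂ | inj₂ n₃ | _ =
      let p₁ , p₂ = pairs-only n₁ n₂ (hom (# 1) (# 2) refl)
          _ , p₃ = pairs-only n₂ n₃ (hom (# 2) (# 3) refl)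
      in ⊥-elim (three (λ ()) (λ ()) (λ ()) p₁ p₂ p₃)
    ... | inj₁ h | inj₂ _ | inj₁ h′ | inj₂ _ | _ = # 0 , # 2 , (λ ()) , h , h′
    ... | inj₂ _ | inj₂ _ | inj₁ h | inj₂ _ | inj₁ h′ = # 2 , # 4 , (λ ()) , h , h′
    ... | inj₂ n₀ | inj₂ n₁ | inj₁ _ | inj₂ n₃ | inj₂ n₄ =
      let p₀ , p₁ = pairs-only n₀ n₁ (hom (# 0) (# 1) refl)
          p₃ , _ = pairs-only n₃ n₄ (hom (# 3) (# 4) refl)
      in ⊥-elim (three (λ ()) (λ ()) (λ ()) p₀ p₁ p₃)

  2P5-free-X : Free (P 5 ∪ᵍ P 5) X
  2P5-free-X p@(f , inj , hom) = clash (two-hubs (firstP5 {G = X} p)) (two-hubs (secondP5 {G = X} p))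
    where
    clash : TwoHubs (firstP5 {G = X} p) → TwoHubs (secondP5 {G = X} p) → ⊥
    clash (i , j , i≢j , (x , ex) , (y , ey)) (i′ , j′ , i′≢j′ , (x′ , ex′) , (y′ , ey′)) = tooSmall {4} {3} ≤-refl {lookup hubs}
        (λ {q} {r} → lookup-distinct distinct q r)
      where
      hubs : List (Fin 3)
      hubs = x ∷ y ∷ x′ ∷ y′ ∷ []
      lookup-distinct : ∀ {L : List (Fin 3)} → Unique L → ∀ q r → lookup L q ≡ lookup L r → q ≡ r
      lookup-distinct = Paths.lookup-injective (K 3)
      separate : ∀ {q r z z′} → q ≢ r → f q ≡ z ↑ˡ (2 + k) → f r ≡ z′ ↑ˡ (2 + k) → z ≢ z′
      separate q≢r eq eq′ refl = q≢r (inj (≡.trans eq (sym eq′)))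
      apart : ∀ (a b : Fin 5) → a ↑ˡ 5 ≢ 5 ↑ʳ b
      apart a b eq with () ← ≡.trans (sym (Finₚ.splitAt-↑ˡ 5 a 5)) (≡.trans (cong (splitAt 5) eq) (Finₚ.splitAt-↑ʳ 5 5 b))
      distinct : Unique hubs
      distinct = (separate (λ e → i≢j (Finₚ.↑ˡ-injective 5 _ _ e)) ex ey ∷ separate (apart i i′) ex ex′ ∷ separate (apart i j′) ex ey′ ∷ []) ∷
        (separate (apart j i′) ey ex′ ∷ separate (apart j j′) ey ey′ ∷ []) ∷
        (separate (λ e → i′≢j′ (Finₚ.↑ʳ-injective 5 _ _ e)) ex′ ey′ ∷ []) ∷ [] ∷ []

-- Recognising the extremal graphs

≅-from : ∀ {m n} {G : Graph n} {H : Graph m} (f : Fin m → Fin n) → (∀ {i j} → f i ≡ f j → i ≡ j) →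
         (∀ v → ∃ λ i → f i ≡ v) → (∀ i j → adj H i j ≡ adj G (f i) (f j)) → G ≅ H
≅-from {G = G} {H} f inj surj hom =
  mk↔ₛ′ (λ v → proj₁ (surj v)) f (λ i → inj (proj₂ (surj (f i)))) (λ v → proj₂ (surj v)) ,
  λ u v → sym (≡.trans (hom _ _) (cong₂ (adj G) (proj₂ (surj u)) (proj₂ (surj v))))

module Enumerate {n r s} (R S : List (Fin n)) (lR : r ≡ length R) (lS : s ≡ length S) where

  left : Fin r → Fin n
  left i = lookup R (cast lR i)

  right : Fin s → Fin n
  right j = lookup S (cast lS j)

  enum : Fin (r + s) → Fin n
  enum i = [ left , right ]′ (splitAt r i)

  lookup-cast-injective : ∀ {k} {L : List (Fin n)} (eq : k ≡ length L) → Unique L → ∀ {i j} →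
                          lookup L (cast eq i) ≡ lookup L (cast eq j) → i ≡ j
  lookup-cast-injective {L = L} eq u {i} {j} p = Finₚ.toℕ-injective (≡.trans (sym (Finₚ.toℕ-cast eq i))
    (≡.trans (cong toℕ (Paths.lookup-injective (E n) u (cast eq i) (cast eq j) p)) (Finₚ.toℕ-cast eq j)))

  lookup-cast-surjective : ∀ {k} {L : List (Fin n)} (eq : k ≡ length L) {v} → v ∈ L → ∃ λ i → lookup L (cast eq i) ≡ v
  lookup-cast-surjective {L = L} refl v∈ = index v∈ , ≡.trans (cong (lookup L) (Finₚ.cast-is-id refl (index v∈))) (sym (Anyₚ.lookup-index v∈))

  enum-injective : Unique (R ++ S) → ∀ {i j} → enum i ≡ enum j → i ≡ j
  enum-injective u {i} {j} p with splitAt r i in ei | splitAt r j in ej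
  ... | inj₁ x | inj₁ y with refl ← lookup-cast-injective lR (Unique-++ˡ R u) {x} {y} p =
    ≡.trans (sym (Finₚ.splitAt⁻¹-↑ˡ ei)) (Finₚ.splitAt⁻¹-↑ˡ ej)
  ... | inj₂ x | inj₂ y with refl ← lookup-cast-injective lS (Unique-++ʳ R u) {x} {y} p =
    ≡.trans (sym (Finₚ.splitAt⁻¹-↑ʳ ei)) (Finₚ.splitAt⁻¹-↑ʳ ej)
  ... | inj₁ x | inj₂ y = ⊥-elim (Paths.disjoint-++ (E n) R u (∈-lookup (cast lR x)) (∈-lookup (cast lS y)) p)
  ... | inj₂ x | inj₁ y = ⊥-elim (Paths.disjoint-++ (E n) R u (∈-lookup (cast lR y)) (∈-lookup (cast lS x)) (sym p))

  enum-surjective : (∀ v → v ∈ R ++ S) → ∀ v → ∃ λ i → enum i ≡ v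
  enum-surjective all v with ∈-++⁻ R (all v)
  ... | inj₁ v∈ = let i , p = lookup-cast-surjective lR v∈ in i ↑ˡ s , ≡.trans (cong [ left , right ]′ (Finₚ.splitAt-↑ˡ r i s)) p
  ... | inj₂ v∈ = let j , p = lookup-cast-surjective lS v∈ in r ↑ʳ j , ≡.trans (cong [ left , right ]′ (Finₚ.splitAt-↑ʳ r s j)) p

  ≅-comb : ∀ {G : Graph n} {A : Graph r} {B : Graph s} {b} → Unique (R ++ S) → (∀ v → v ∈ R ++ S) →
           (∀ i j → adj A i j ≡ adj G (left i) (left j)) → (∀ i j → adj B i j ≡ adj G (right i) (right j)) →
           (∀ i j → adj G (left i) (right j) ≡ b) → G ≅ comb b A B
  ≅-comb {G} {A} {B} {b} u all ll rr lr = ≅-from {G = G} {H = comb b A B} enum (enum-injective u) (enum-surjective all) hom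
    where
    hom : ∀ i j → adj (comb b A B) i j ≡ adj G (enum i) (enum j)
    hom i j with splitAt r i | splitAt r j
    ... | inj₁ x | inj₁ y = ll x y
    ... | inj₂ x | inj₂ y = rr x y
    ... | inj₁ x | inj₂ y = sym (lr x y)
    ... | inj₂ x | inj₁ y = sym (≡.trans (adj-sym G (right x) (left y)) (lr y x))

K-adj : ∀ {k} (i j : Fin k) → i ≢ j → adj (K k) i j ≡ true
K-adj i j i≢j with toℕ i ≡ᵇ toℕ j in eq
... | false = refl
... | true = ⊥-elim (i≢j (Finₚ.toℕ-injective (≡ᵇ-true _ _ eq)))

module Recognise {n} (G : Graph n) where

  open Paths G

  not~ : ∀ {u v} → ¬ u ~ v → adj G u v ≡ false
  not~ = Boolₚ.¬-not

  clique-adj : ∀ {k L} (eq : k ≡ length L) → Unique L → (∀ {x y} → x ∈ L → y ∈ L → x ≢ y → x ~ y) →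
               ∀ i j → adj (K k) i j ≡ adj G (lookup L (cast eq i)) (lookup L (cast eq j))
  clique-adj {k} {L} eq u c i j with i Finₚ.≟ j
  ... | yes refl = ≡.trans (irrefl (K k) i) (sym (irrefl G _))
  ... | no i≢j = ≡.trans (K-adj i j i≢j) (sym (c (∈-lookup (cast eq i)) (∈-lookup (cast eq j))
      λ p → i≢j (Enumerate.lookup-cast-injective {n} {0} {0} [] [] refl refl eq u p)))

  AllPairs⇒ : ∀ {L} → AllPairs _~_ L → ∀ {x y} → x ∈ L → y ∈ L → x ≢ y → x ~ y
  AllPairs⇒ (a ∷ p) (here refl) (here refl) ne = ⊥-elim (ne refl)
  AllPairs⇒ (a ∷ p) (here refl) (there y∈) ne = All.lookup a y∈
  AllPairs⇒ (a ∷ p) (there x∈) (here refl) ne = ~-sym (All.lookup a x∈)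
  AllPairs⇒ (a ∷ p) (there x∈) (there y∈) ne = AllPairs⇒ p x∈ y∈ ne

  deg≡length⇒ : ∀ v L → deg v L ≡ length L → All (v ~_) L
  deg≡length⇒ v [] p = []
  deg≡length⇒ v (w ∷ L) p with adj G v w in e
  ... | true = e ∷ deg≡length⇒ v L (suc-injective p)
  ... | false = ⊥-elim (<⇒≱ (s≤s (deg≤length v L)) (≤-reflexive (sym p)))

  -- Both summands of `size` are bounded by those of `triangle`, so equality of the sums forces
  -- equality of each.
  size≡triangle⇒ : ∀ L → size L ≡ triangle (length L) → AllPairs _~_ L
  size≡triangle⇒ [] eq = []
  size≡triangle⇒ (v ∷ L) eq =
      deg≡length⇒ v L (+-cancelʳ-≡ (size L) (deg v L) (length L) (≡.trans eq (cong (length L +_) (sym tail-full)))) ∷ size≡triangle⇒ L tail-full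
    where
    tail-full : size L ≡ triangle (length L)
    tail-full = ≤-antisym (size≤triangle L) (+-cancelˡ-≤ (length L) _ _ (≤-trans (≤-reflexive (sym eq)) (+-monoˡ-≤ (size L) (deg≤length v L))))

  tabulate-lookup-cast : ∀ {k} {L : List V} (eq : k ≡ length L) → tabulate (λ i → lookup L (cast eq i)) ≡ L
  tabulate-lookup-cast {L = L} refl = ≡.trans (tabulate-cong (λ i → cong (lookup L) (Finₚ.cast-is-id refl i))) (tabulate-lookup L)

  induced : ∀ {k} → (Fin k → V) → Graph k
  induced f = record { adj = λ i j → adj G (f i) (f j) ; adj-sym = λ i j → adj-sym G (f i) (f j) ; irrefl = λ i → irrefl G (f i) }

  edges-induced : ∀ {k} (f : Fin k → V) → edges (induced f) ≡ size (tabulate f)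
  edges-induced {k} f = ≡.trans H.edges≡size (≡.trans (go (allFin k)) (cong size (map-tabulate (λ i → i) f)))
    where
    module H = Count (induced f)
    deg-map : ∀ i L → H.deg i L ≡ deg (f i) (map f L)
    deg-map i [] = refl
    deg-map i (j ∷ L) = cong (bit (adj G (f i) (f j)) +_) (deg-map i L)
    go : ∀ L → H.size L ≡ size (map f L)
    go [] = refl
    go (i ∷ L) = cong₂ _+_ (deg-map i L) (go L)

  Free⇒NoP5 : Free (P 5) G → NoP5 (allFin n)
  Free⇒NoP5 free p@(_ ∷ _ ∷ _ ∷ _ ∷ _ ∷ []) refl u _ pp = free (lookup p , (λ {i} {j} → lookup-injective u i j) , lookup-P pp)


P5-bound : ∀ {k} (H : Graph k) → Free (P 5) H → edges H ≤ g k
P5-bound {k} H free = ≤-trans (≤-reflexive (Count.edges≡size H)) (≤-trans (P5Free.NoP5⇒size≤g H (Uniqueₚ.allFin⁺ k) (Recognise.Free⇒NoP5 H free))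
  (≤-reflexive (cong g (length-tabulate {n = k} (λ i → i)))))

-- The upper bound, the extremal graphs and the theorem

module Final (k : ℕ) (G : Graph (10 + k)) (free : Free (P 5 ∪ᵍ P 5) G) where

  n m : ℕ
  n = 10 + k
  m = suc k

  open Paths G
  open P5Free G
  open Recognise G
  open Structure G (Free⇒No2P5 free)
  open Five G (Free⇒No2P5 free)

  shapeG : Shape (allFin n) m
  shapeG = shape (Uniqueₚ.allFin⁺ n) (length-tabulate {n = n} (λ i → i)) z<s

  bound : edges G ≤ (36 + g m) ⊔ (22 + m * 3)
  bound = ≤-trans (≤-reflexive edges≡size) (go shapeG)
    where
    go : Shape (allFin n) m → size (allFin n) ≤ (36 + g m) ⊔ (22 + m * 3)
    go (K₉-component {R} {S} p lR sR none no5) = ≤-trans (≤-trans (≤-reflexive (pull R p none))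
      (+-mono-≤ (≤-reflexive sR) (≤-trans (NoP5⇒size≤g (Unique-++ʳ R (Unique-↭ p (Uniqueₚ.allFin⁺ n))) no5)
        (≤-reflexive (cong g (+-cancelˡ-≡ 9 _ _ (≡.trans (cong (_+ length S) (sym lR)) (≡.trans (sym (length-++ R))
          (≡.trans (sym (↭-length p)) (length-tabulate {n = n} (λ i → i)))))))))))
      (m≤m⊔n (36 + g m) (22 + m * 3))
    go (three-hubs _ le) = ≤-trans le (m≤n⊔m (36 + g m) (22 + m * 3))
    go (few-edges₁ lt) = ≤-trans (<⇒≤ lt) (m≤m⊔n (36 + g m) (22 + m * 3))
    go (few-edges₂ lt) = ≤-trans (<⇒≤ lt) (m≤n⊔m (36 + g m) (22 + m * 3))

  Conclusion : Set
  Conclusion = (Σ (Graph m) λ H → Free (P 5) H × IsEx m (P 5) (edges H) × (G ≅ (K 9 ∪ᵍ H)))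
    ⊎ (G ≅ (K 3 +ᵍ (K 2 ∪ᵍ E (5 + k))))

  -- The K₉ takes exactly 36 edges and none cross, so the graph induced on `S` has at least `g m`.
  -- By `P5-bound` no P₅-free graph on m vertices has more, which makes it extremal.
  K₉-case : ∀ {R S} → allFin n ↭ R ++ S → length R ≡ 9 → size R ≡ 36 → cross R S ≡ 0 → NoP5 S → 36 + g m ≤ edges G → Conclusion
  K₉-case {R} {S} p lR sR none no5 many = inj₁ (H , freeH , ((H , freeH , refl) , most) , iso)
    where
    u : Unique (R ++ S)
    u = Unique-↭ p (Uniqueₚ.allFin⁺ n)
    lS : m ≡ length S
    lS = sym (+-cancelˡ-≡ 9 _ _ (≡.trans (cong (_+ length S) (sym lR)) (≡.trans (sym (length-++ R))
      (≡.trans (sym (↭-length p)) (length-tabulate {n = n} (λ i → i))))))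
    open Enumerate R S (sym lR) lS
    H : Graph m
    H = induced right
    freeH : Free (P 5) H
    freeH q@(f , inj , hom) = no5 (map right′ (allFin 5)) refl (Uniqueₚ.map⁺ (λ e → inj (lookup-cast-injective lS (Unique-++ʳ R u) e)) (Uniqueₚ.allFin⁺ 5))
        (Allₚ.map⁺ (All.universal (λ i → ∈-lookup (cast lS (f i))) (allFin 5)))
        (hom (# 0) (# 1) refl ∷ hom (# 1) (# 2) refl ∷ hom (# 2) (# 3) refl ∷ hom (# 3) (# 4) refl ∷ [-])
      where
      right′ : Fin 5 → V
      right′ i = right (f i)
    edgesH : g m ≤ edges H
    edgesH = +-cancelˡ-≤ 36 _ _ (≤-trans many (≤-reflexive (≡.trans edges≡size (≡.trans (pull R p none) (cong₂ _+_ sR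
      (sym (≡.trans (edges-induced right) (cong size (tabulate-lookup-cast {L = S} lS)))))))))
    most : ∀ (H′ : Graph m) → Free (P 5) H′ → edges H′ ≤ edges H
    most H′ free′ = ≤-trans (P5-bound H′ free′) edgesH
    iso : G ≅ (K 9 ∪ᵍ H)
    iso = ≅-comb {G = G} {A = K 9} {B = H} u (λ v → ∈-resp-↭ p (∈-allFin v))
      (clique-adj (sym lR) (Unique-++ˡ R u) (AllPairs⇒ (size≡triangle⇒ R (≡.trans sR (sym (cong triangle lR)))))) (λ i j → refl)
      (λ i j → not~ (deg≡0⇒ {L = S} (cross≡0⇒deg {A = R} S none (∈-lookup (cast (sym lR) i))) (∈-lookup (cast lS j))))

  hub-case : Extremal (allFin n) → Conclusion
  hub-case (extremal {h₁} {h₂} {h₃} {a} {b} {R} p core5 joined large) = inj₂ iso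
    where
    A B : List V
    A = h₁ ∷ h₂ ∷ h₃ ∷ []
    B = a ∷ b ∷ R
    u : Unique (A ++ B)
    u = Unique-↭ p (Uniqueₚ.allFin⁺ n)
    lR : 5 + k ≡ length R
    lR = +-cancelˡ-≡ 5 _ _ (≡.trans (sym (length-tabulate {n = n} (λ i → i))) (↭-length p))
    lB : 2 + (5 + k) ≡ length B
    lB = cong (2 +_) lR
    module AB = Enumerate A B refl lB
    module IJ = Enumerate (a ∷ b ∷ []) R refl lR

    clique₅ : List V
    clique₅ = h₁ ∷ h₂ ∷ h₃ ∷ a ∷ b ∷ []

    five-clique : ∀ {x y} → x ∈ clique₅ → y ∈ clique₅ → x ≢ y → x ~ y
    five-clique = AllPairs⇒ (go core5)
      where
      go : Labelled.Holds h₁ (h₂ ∷ h₃ ∷ a ∷ b ∷ []) (clique (upTo 5)) → AllPairs _~_ clique₅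
      go (e₁₂ ∷ e₁₃ ∷ e₁a ∷ e₁b ∷ e₂₃ ∷ e₂a ∷ e₂b ∷ e₃a ∷ e₃b ∷ eab ∷ []) =
        (e₁₂ ∷ e₁₃ ∷ e₁a ∷ e₁b ∷ []) ∷ (e₂₃ ∷ e₂a ∷ e₂b ∷ []) ∷ (e₃a ∷ e₃b ∷ []) ∷ (eab ∷ []) ∷ [] ∷ []

    hub-B : ∀ {x y} → x ∈ A → y ∈ B → x ~ y
    hub-B x∈ (here refl) = five-clique (∈-++⁺ˡ x∈) (there (there (there (here refl)))) (disjoint-++ A u x∈ (here refl))
    hub-B x∈ (there (here refl)) = five-clique (∈-++⁺ˡ x∈) (there (there (there (there (here refl))))) (disjoint-++ A u x∈ (there (here refl)))
    hub-B (here refl) (there (there y∈)) = proj₁ (joined y∈)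
    hub-B (there (here refl)) (there (there y∈)) = proj₁ (proj₂ (joined y∈))
    hub-B (there (there (here refl))) (there (there y∈)) = proj₂ (proj₂ (joined y∈))

    -- The vertex `r` is regarded as newly attached to the configuration without it. Four outer
    -- vertices remain by `large`, so `hubs-only` applies.
    isolated : ∀ {r x} → r ∈ R → x ∈ B → ¬ x ~ r
    isolated {r} {x} r∈ x∈ e = go (extract r∈)
      where
      go : (∃ λ R′ → R ↭ r ∷ R′) → ⊥
      go (R′ , q) = hubs-only core5 (Unique-↭ (↭-trans (++⁺ˡ (h₁ ∷ h₂ ∷ h₃ ∷ a ∷ b ∷ []) q) (shift r (h₁ ∷ h₂ ∷ h₃ ∷ a ∷ b ∷ []) R′)) u)
          (λ s∈ → joined (∈-resp-↭ (↭-sym q) (there s∈))) (≤-pred (≤-trans large (≤-reflexive (↭-length q)))) (member′ x∈) e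
        where
        member′ : x ∈ a ∷ b ∷ R → x ∈ a ∷ b ∷ R′
        member′ (here refl) = here refl
        member′ (there (here refl)) = there (here refl)
        member′ (there (there x∈R)) with ∈-resp-↭ q x∈R
        ... | here refl = ⊥-elim (~-irrefl e)
        ... | there x∈R′ = there (there x∈R′)

    inner : ∀ i j → adj (K 2 ∪ᵍ E (5 + k)) i j ≡ adj G (AB.right i) (AB.right j)
    inner i j = ≡.trans (go i j) (cong₂ (adj G) (same i) (same j))
      where
      same : ∀ i → IJ.enum i ≡ AB.right i
      same Fin.zero = refl
      same (Fin.suc Fin.zero) = refl
      same (Fin.suc (Fin.suc i)) = refl
      go : ∀ i j → adj (K 2 ∪ᵍ E (5 + k)) i j ≡ adj G (IJ.enum i) (IJ.enum j)
      go i j with splitAt 2 i | splitAt 2 j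
      ... | inj₁ x | inj₁ y = clique-adj {L = a ∷ b ∷ []} refl (Unique-++ˡ (a ∷ b ∷ []) (Unique-++ʳ A u))
        (λ x∈ y∈ → five-clique (∈-++⁺ʳ A x∈) (∈-++⁺ʳ A y∈)) x y
      ... | inj₁ x | inj₂ y = sym (not~ (isolated (∈-lookup (cast lR y)) (∈-++⁺ˡ (∈-lookup {xs = a ∷ b ∷ []} (cast refl x)))))
      ... | inj₂ x | inj₁ y = sym (not~ λ e → isolated (∈-lookup (cast lR x)) (∈-++⁺ˡ (∈-lookup {xs = a ∷ b ∷ []} (cast refl y))) (~-sym e))
      ... | inj₂ x | inj₂ y = sym (not~ (isolated (∈-lookup (cast lR y)) (there (there (∈-lookup (cast lR x))))))

    iso : G ≅ (K 3 +ᵍ (K 2 ∪ᵍ E (5 + k)))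
    iso = AB.≅-comb {G = G} {A = K 3} {B = K 2 ∪ᵍ E (5 + k)} u (λ v → ∈-resp-↭ p (∈-allFin v))
      (clique-adj {L = A} refl (Unique-++ˡ A u) (λ x∈ y∈ → five-clique (∈-++⁺ˡ x∈) (∈-++⁺ˡ y∈))) inner
      (λ i j → hub-B (∈-lookup (cast refl i)) (∈-lookup (cast lB j)))

  structure : edges G ≡ (36 + g m) ⊔ (22 + m * 3) → Conclusion
  structure eq = go shapeG
    where
    go : Shape (allFin n) m → Conclusion
    go (K₉-component p lR sR none no5) = K₉-case p lR sR none no5 (≤-trans (m≤m⊔n (36 + g m) (22 + m * 3)) (≤-reflexive (sym eq)))
    go (three-hubs ext _) = hub-case ext
    go (few-edges₁ lt) = ⊥-elim (<⇒≱ lt (≤-trans (m≤m⊔n (36 + g m) (22 + m * 3)) (≤-reflexive (≡.trans (sym eq) edges≡size))))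
    go (few-edges₂ lt) = ⊥-elim (<⇒≱ lt (≤-trans (m≤n⊔m (36 + g m) (22 + m * 3)) (≤-reflexive (≡.trans (sym eq) edges≡size))))

target : ∀ k → bracket (10 + k) ⊔ (3 * (10 + k) ∸ 5) ≡ (36 + g (suc k)) ⊔ (22 + suc k * 3)
target k = cong₂ _⊔_ (bracket≡ (suc k)) (≡.trans (cong (_∸ 5) (arith k)) (m+n∸n≡m (22 + suc k * 3) 5))
  where
  arith : ∀ k → 3 * (10 + k) ≡ 22 + suc k * 3 + 5
  arith = solve-∀

attained : ∀ k → Σ (Graph (10 + k)) λ G → Free (P 5 ∪ᵍ P 5) G × edges G ≡ (36 + g (suc k)) ⊔ (22 + suc k * 3)
attained k = go (≤-total (36 + g (suc k)) (22 + suc k * 3))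
  where
  arith : ∀ k → 10 + (5 + k) * 3 ≡ 22 + suc k * 3
  arith = solve-∀
  go : 36 + g (suc k) ≤ 22 + suc k * 3 ⊎ 22 + suc k * 3 ≤ 36 + g (suc k) → _
  go (inj₁ le) = HubGraph.X (5 + k) , HubGraph.2P5-free-X (5 + k) ,
    ≡.trans (HubGraph.edges-X (5 + k)) (≡.trans (arith k) (sym (m≤n⇒m⊔n≡n le)))
  go (inj₂ le) = K 9 ∪ᵍ blocks (suc k) , 2P5-free-K₉∪blocks (suc k) ,
    ≡.trans (edges-K₉∪blocks (suc k)) (sym (m≥n⇒m⊔n≡m le))

theorem1p9 : (n : ℕ) → 10 ≤ n →
    IsEx n (P 5 ∪ᵍ P 5) (bracket n ⊔ (3 * n ∸ 5))
    × (∀ (G : Graph n) → Free (P 5 ∪ᵍ P 5) G → edges G ≡ bracket n ⊔ (3 * n ∸ 5) →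
        (Σ (Graph (n ∸ 9)) λ H → Free (P 5) H × IsEx (n ∸ 9) (P 5) (edges H) × (G ≅ (K 9 ∪ᵍ H)))
        ⊎ (G ≅ (K 3 +ᵍ (K 2 ∪ᵍ E (n ∸ 5)))))
-- Writing n as `10 + k` lets `n ∸ 9` and `n ∸ 5` compute to `suc k` and `5 + k`.
theorem1p9 n 10≤n with k , refl ← m≤n⇒∃[o]m+o≡n 10≤n =
  ((proj₁ (attained k) , proj₁ (proj₂ (attained k)) , ≡.trans (proj₂ (proj₂ (attained k))) (sym (target k))) ,
   (λ G free → ≤-trans (Final.bound k G free) (≤-reflexive (sym (target k))))) ,
  λ G free eq → Final.structure k G free (≡.trans eq (target k))
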